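{- $$\lim_{n\to\infty}\frac1n\cdot\frac{1}{\mathrm{Cat}_n^2}\sum_{\sigma,\rho\in\mathrm{NC}(n)}\bigl(|\sigma|+|\rho|-2|\sigma\vee\rho|\bigr)=\frac{3\pi-8}{8-2\pi}<0.83,$$ where on the right-hand side $\pi=3.14159\ldots$ is the usual constant.
   Context: For a positive integer $n$, a partition $\sigma$ of $\{1,\ldots,n\}$ is non-crossing if there are no two distinct blocks $V,W$ of $\sigma$ and numbers $a<b<c<d$ with $a,c\in V$ and $b,d\in W$. $\mathrm{NC}(n)$ is the set of non-crossing partitions of $\{1,\ldots,n\}$, partially ordered by $\sigma\le\rho$ iff every block of $\sigma$ is contained in a block of $\rho$; this partially ordered set is a lattice, and $\sigma\vee\rho$ denotes the join (least common upper bound) of $\sigma,\rho$ in $\mathrm{NC}(n)$. $|\sigma|$ is the number of blocks of $\sigma$. $\mathrm{Cat}_n=\frac{(2n)!}{n!(n+1)!}=|\mathrm{NC}(n)|$ is the $n$th Catalan number. -}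

module Defs where

open import Data.Fin.Base as Fin using (Fin)
open import Data.Fin.Properties as Fin using (all?; any?)
open import Data.Fin.Subset using (Subset; inside; outside; _∈_; _⊆_)
open import Data.Fin.Subset.Properties using (_∈?_; _⊆?_; ⊆-antisym)
open import Data.Integer.Base as ℤ using (ℤ; 0ℤ; -1ℤ)
open import Data.List.Base using (List; []; _∷_; cartesianProductWith; deduplicate; foldr; length; mapMaybe)
import Data.List.Membership.Propositional as List
open import Data.List.Membership.Propositional.Properties using (∈-cartesianProductWith⁺; ∈-map⁺)
open import Data.List.Relation.Unary.All as All using (All; []; _∷_)
open import Data.List.Relation.Unary.AllPairs using ([]; _∷_)
open import Data.List.Relation.Unary.Any as Any using (here; there)
open import Data.List.Relation.Unary.Any.Properties using (mapMaybe⁺)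
open import Data.List.Relation.Unary.Unique.Propositional using (Unique)
open import Data.List.Relation.Unary.Unique.Propositional.Properties using (cartesianProductWith⁺)
open import Data.Maybe.Base using (Maybe; just; nothing)
import Data.Maybe.Relation.Unary.Any as Maybe
open import Data.Bool.Base using (true; false)
import Data.Bool.Properties as Bool
open import Data.Nat.Base as ℕ using (ℕ; zero; suc; _!)
open import Data.Nat.Coprimality using (1-coprimeTo)
import Data.Nat.Properties as ℕ
open import Data.Product.Base using (∃; ∃₂; _×_; _,_; proj₁; proj₂)
open import Data.Rational.Base as ℚ using (ℚ; mkℚ; 0ℚ; 1ℚ; ½)
import Data.Rational.Properties as ℚ
open import Data.Rational.Solver using (module +-*-Solver)
open import Data.Sum.Base using (_⊎_; inj₁; inj₂)
open import Data.Vec.Base as Vec using (Vec; []; _∷_; lookup; tabulate; toList)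
open import Data.Vec.Properties using (≡-dec; ∷-injective; lookup∘tabulate; []=⇒lookup; lookup⇒[]=)
open import Relation.Binary.Definitions using (Decidable; DecidableEquality)
open import Relation.Binary.Lattice.Definitions using (Supremum)
open import Relation.Binary.PropositionalEquality
open import Relation.Nullary.Decidable
open import Relation.Nullary.Negation using (¬_; contradiction)

-- A partition of Fin n is encoded by its block map: the i-th entry is the
-- block containing i.  This encoding is unique, and the blocks of the
-- partition are exactly the entries of the vector.
BlockMap : ℕ → Set
BlockMap n = Vec (Subset n) n

IsPartition : ∀ {n} → BlockMap n → Set
IsPartition p =
  (∀ i → i ∈ lookup p i) ×
  (∀ i j → j ∈ lookup p i → lookup p j ≡ lookup p i)

Crossing : ∀ {n} → BlockMap n → Set
Crossing p =
  ∃₂ λ i j → let V = lookup p i; W = lookup p j in V ≢ W ×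
  ∃₂ λ a b → ∃₂ λ c d →
    (a Fin.< b × b Fin.< c × c Fin.< d) × (a ∈ V × c ∈ V) × (b ∈ W × d ∈ W)

IsNonCrossing : ∀ {n} → BlockMap n → Set
IsNonCrossing p = IsPartition p × ¬ Crossing p

-- The validity proof is irrelevant, so equality in NC n is equality of
-- block maps.
record NC (n : ℕ) : Set where
  constructor mkNC
  field
    blocks         : BlockMap n
    .isNonCrossing : IsNonCrossing blocks

open NC public using (blocks)

block : ∀ {n} → NC n → Fin n → Subset n
block σ i = lookup (blocks σ) i

infix 4 _≤ᴺ_
_≤ᴺ_ : ∀ {n} → NC n → NC n → Set
σ ≤ᴺ ρ = ∀ i → ∃ λ j → block σ i ⊆ block ρ j

_≟ᵇ_ : ∀ {n} → DecidableEquality (Subset n)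
_≟ᵇ_ = ≡-dec Bool._≟_

#blocks : ∀ {n} → NC n → ℕ
#blocks σ = length (deduplicate _≟ᵇ_ (toList (blocks σ)))

isPartition? : ∀ {n} (p : BlockMap n) → Dec (IsPartition p)
isPartition? p =
  all? (λ i → i ∈? lookup p i) ×-dec
  all? (λ i → all? λ j → (j ∈? lookup p i) →-dec (lookup p j ≟ᵇ lookup p i))

crossing? : ∀ {n} (p : BlockMap n) → Dec (Crossing p)
crossing? p =
  any? λ i → any? λ j → ¬? (lookup p i ≟ᵇ lookup p j) ×-dec
  (any? λ a → any? λ b → any? λ c → any? λ d →
    (a Fin.<? b ×-dec b Fin.<? c ×-dec c Fin.<? d) ×-dec
    ((a ∈? lookup p i) ×-dec (c ∈? lookup p i)) ×-dec
    ((b ∈? lookup p j) ×-dec (d ∈? lookup p j)))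

isNonCrossing? : ∀ {n} (p : BlockMap n) → Dec (IsNonCrossing p)
isNonCrossing? p = isPartition? p ×-dec ¬? (crossing? p)

isNonCrossing : ∀ {n} (σ : NC n) → IsNonCrossing (blocks σ)
isNonCrossing (mkNC p q) = recompute (isNonCrossing? p) q

infix 4 _≤ᴺ?_
_≤ᴺ?_ : ∀ {n} → Decidable (_≤ᴺ_ {n})
σ ≤ᴺ? ρ = all? λ i → any? λ j → block σ i ⊆? block ρ j

allVecs : ∀ {A : Set} → List A → ∀ n → List (Vec A n)
allVecs xs zero    = [] ∷ []
allVecs xs (suc n) = cartesianProductWith _∷_ xs (allVecs xs n)

allBlockMaps : ∀ n → List (BlockMap n)
allBlockMaps n = allVecs (allVecs (inside ∷ outside ∷ []) n) n

toNC : ∀ {n} → BlockMap n → Maybe (NC n)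
toNC p with isNonCrossing? p
... | yes q = just (mkNC p q)
... | no  _ = nothing

allNC : ∀ n → List (NC n)
allNC n = mapMaybe toNC (allBlockMaps n)

∈-allVecs : ∀ {A : Set} {xs : List A} → (∀ x → x List.∈ xs) →
            ∀ {n} (v : Vec A n) → v List.∈ allVecs xs n
∈-allVecs full []      = here refl
∈-allVecs full (x ∷ v) = ∈-cartesianProductWith⁺ _∷_ (full x) (∈-allVecs full v)

∈-allBlockMaps : ∀ {n} (p : BlockMap n) → p List.∈ allBlockMaps n
∈-allBlockMaps = ∈-allVecs (∈-allVecs λ where
  true  → here refl
  false → there (here refl))

toNC-blocks : ∀ {n} (σ : NC n) → Maybe.Any (σ ≡_) (toNC (blocks σ))
toNC-blocks σ with isNonCrossing? (blocks σ)
... | yes _ = Maybe.just refl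
... | no ¬q = contradiction (isNonCrossing σ) ¬q

∈-allNC : ∀ {n} (σ : NC n) → σ List.∈ allNC n
∈-allNC {n} σ = mapMaybe⁺ toNC (allBlockMaps n)
  (Any.map (λ eq → subst (Maybe.Any (σ ≡_)) eq (toNC-blocks σ))
           (∈-map⁺ toNC (∈-allBlockMaps (blocks σ))))

toNC-just : ∀ {n} (p : BlockMap n) {σ} → toNC p ≡ just σ → blocks σ ≡ p
toNC-just p eq with isNonCrossing? p
toNC-just p refl | yes _ = refl

allVecs-unique : ∀ {A : Set} {xs : List A} → Unique xs → ∀ n → Unique (allVecs xs n)
allVecs-unique u zero    = [] ∷ []
allVecs-unique u (suc n) = cartesianProductWith⁺ _∷_ ∷-injective u (allVecs-unique u n)

allNC-unique : ∀ n → Unique (allNC n)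
allNC-unique n = go (allBlockMaps n)
  (allVecs-unique (allVecs-unique (((λ ()) ∷ []) ∷ [] ∷ []) n) n)
  where
  fresh : ∀ {p σ} ps → toNC p ≡ just σ → All (p ≢_) ps → All (σ ≢_) (mapMaybe toNC ps)
  fresh []       eq []          = []
  fresh (q ∷ qs) eq (p≢q ∷ p≢qs) with toNC q in eq′
  ... | nothing = fresh qs eq p≢qs
  ... | just τ  =
    (λ σ≡τ → p≢q (trans (sym (toNC-just _ eq)) (trans (cong blocks σ≡τ) (toNC-just q eq′))))
    ∷ fresh qs eq p≢qs

  go : ∀ ps → Unique ps → Unique (mapMaybe toNC ps)
  go []       []       = []
  go (p ∷ ps) (p∉ ∷ u) with toNC p in eq
  ... | nothing = go ps u
  ... | just σ  = fresh ps eq p∉ ∷ go ps u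

module _ {n} (σ ρ : NC n) where

  -- j lies in the block of i in every common upper bound of σ and ρ.
  Joined : Fin n → Fin n → Set
  Joined i j = All (λ τ → σ ≤ᴺ τ × ρ ≤ᴺ τ → j ∈ block τ i) (allNC n)

  joined? : ∀ i j → Dec (Joined i j)
  joined? i j =
    All.all? (λ τ → ((σ ≤ᴺ? τ) ×-dec (ρ ≤ᴺ? τ)) →-dec (j ∈? block τ i)) (allNC n)

  joinBlocks : BlockMap n
  joinBlocks = tabulate λ i → tabulate λ j → does (joined? i j)

  private
    entry : ∀ i j → lookup (lookup joinBlocks i) j ≡ does (joined? i j)
    entry i j = trans
      (cong (λ v → lookup v j) (lookup∘tabulate (λ i → tabulate λ j → does (joined? i j)) i))
      (lookup∘tabulate (λ j → does (joined? i j)) j)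

  ∈-joinBlocks⁻ : ∀ {i j} → j ∈ lookup joinBlocks i →
                  ∀ τ → σ ≤ᴺ τ → ρ ≤ᴺ τ → j ∈ block τ i
  ∈-joinBlocks⁻ {i} {j} j∈ τ σ≤τ ρ≤τ with joined? i j | trans (sym (entry i j)) ([]=⇒lookup j∈)
  ... | yes all | _ = All.lookup all (∈-allNC τ) (σ≤τ , ρ≤τ)

  ∈-joinBlocks⁺ : ∀ {i j} → (∀ τ → σ ≤ᴺ τ → ρ ≤ᴺ τ → j ∈ block τ i) →
                  j ∈ lookup joinBlocks i
  ∈-joinBlocks⁺ {i} {j} f = lookup⇒[]= j (lookup joinBlocks i)
    (trans (entry i j)
      (dec-true (joined? i j) (All.universal (λ τ (σ≤τ , ρ≤τ) → f τ σ≤τ ρ≤τ) (allNC n))))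

  joinBlocks-isPartition : IsPartition joinBlocks
  joinBlocks-isPartition =
      (λ i → ∈-joinBlocks⁺ λ τ _ _ → proj₁ (proj₁ (isNonCrossing τ)) i)
    , λ i j j∈ →
        let same = λ τ σ≤τ ρ≤τ →
              proj₂ (proj₁ (isNonCrossing τ)) i j (∈-joinBlocks⁻ j∈ τ σ≤τ ρ≤τ)
        in ⊆-antisym
          (λ k∈ → ∈-joinBlocks⁺ λ τ a b → subst (_ ∈_) (same τ a b) (∈-joinBlocks⁻ k∈ τ a b))
          (λ k∈ → ∈-joinBlocks⁺ λ τ a b → subst (_ ∈_) (sym (same τ a b)) (∈-joinBlocks⁻ k∈ τ a b))

  joinBlocks-nonCrossing : ¬ Crossing joinBlocks
  joinBlocks-nonCrossing (i , j , V≢W , a , b , c , d , ord , (a∈ , c∈) , (b∈ , d∈)) =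
    V≢W (sym (proj₂ joinBlocks-isPartition i j (∈-joinBlocks⁺ λ τ σ≤τ ρ≤τ → j∈ τ σ≤τ ρ≤τ)))
    where
    j∈ : ∀ τ → σ ≤ᴺ τ → ρ ≤ᴺ τ → j ∈ block τ i
    j∈ τ σ≤τ ρ≤τ with block τ i ≟ᵇ block τ j
    ... | yes eq = subst (j ∈_) (sym eq) (proj₁ (proj₁ (isNonCrossing τ)) j)
    ... | no neq = contradiction
      (i , j , neq , a , b , c , d , ord , (↓ a∈ , ↓ c∈) , (↓ b∈ , ↓ d∈))
      (proj₂ (isNonCrossing τ))
      where
      ↓ : ∀ {k l} → l ∈ lookup joinBlocks k → l ∈ block τ k
      ↓ l∈ = ∈-joinBlocks⁻ l∈ τ σ≤τ ρ≤τ

infixr 6 _∨_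
_∨_ : ∀ {n} → NC n → NC n → NC n
σ ∨ ρ = mkNC (joinBlocks σ ρ) (joinBlocks-isPartition σ ρ , joinBlocks-nonCrossing σ ρ)

block-mono : ∀ {n} {σ τ : NC n} → σ ≤ᴺ τ → ∀ i → block σ i ⊆ block τ i
block-mono {σ = σ} {τ} σ≤τ i x∈ with σ≤τ i
... | j , sub = subst (_ ∈_)
  (sym (proj₂ (proj₁ (isNonCrossing τ)) j i (sub (proj₁ (proj₁ (isNonCrossing σ)) i))))
  (sub x∈)

∨-supremum : ∀ {n} → Supremum (_≤ᴺ_ {n}) _∨_
∨-supremum σ ρ =
    (λ i → i , λ x∈ → ∈-joinBlocks⁺ σ ρ λ τ σ≤τ _ → block-mono {σ = σ} {τ} σ≤τ i x∈)
  , (λ i → i , λ x∈ → ∈-joinBlocks⁺ σ ρ λ τ _ ρ≤τ → block-mono {σ = ρ} {τ} ρ≤τ i x∈)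
  , λ τ σ≤τ ρ≤τ i → i , λ x∈ → ∈-joinBlocks⁻ σ ρ x∈ τ σ≤τ ρ≤τ

distance : ∀ {n} → NC n → NC n → ℤ
distance σ ρ =
  ℤ.+ #blocks σ ℤ.+ ℤ.+ #blocks ρ ℤ.- ℤ.+ 2 ℤ.* ℤ.+ #blocks (σ ∨ ρ)

sum : List ℤ → ℤ
sum = foldr ℤ._+_ 0ℤ

Cat : ℕ → ℚ
Cat n = ℤ.+ ((2 ℕ.* n) !) ℚ./ (n ! ℕ.* suc n !)
  where instance _ = n ℕ.!* suc n !≢0

Cat²≢0 : ∀ n → ℚ.NonZero (Cat n ℚ.* Cat n)
Cat²≢0 n = ℚ.pos⇒nonZero (Cat n ℚ.* Cat n)
  where
  instance
    _ = n ℕ.!* suc n !≢0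
    _ = (2 ℕ.* n) ℕ.!≢0
    Cat-pos : ℚ.Positive (Cat n)
    Cat-pos = ℚ.normalize-pos ((2 ℕ.* n) !) (n ! ℕ.* suc n !)
    Cat²-pos : ℚ.Positive (Cat n ℚ.* Cat n)
    Cat²-pos = ℚ.pos*pos⇒pos (Cat n) (Cat n)

meanDistance : (n : ℕ) .{{_ : ℕ.NonZero n}} → ℚ
meanDistance n =
  (ℤ.+ 1 ℚ./ n) ℚ.* (ℚ.1/ (Cat n ℚ.* Cat n)) {{Cat²≢0 n}} ℚ.*
  (sum (cartesianProductWith distance (allNC n) (allNC n)) ℚ./ 1)

IsCauchy : (ℕ → ℚ) → Set
IsCauchy x = ∀ ε → 0ℚ ℚ.< ε → ∃ λ N → ∀ m n → N ℕ.≤ m → N ℕ.≤ n →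
             ℚ.∣ x m ℚ.- x n ∣ ℚ.< ε

-- A real number is presented by a Cauchy sequence of rationals; reals are
-- compared only through _<_, which respects equality of the limits.
record ℝ : Set where
  constructor mkℝ
  field
    seq    : ℕ → ℚ
    cauchy : IsCauchy seq

open ℝ public

infix 4 _<_ _#_

fromℚ : ℚ → ℝ
fromℚ q = mkℝ (λ _ → q) λ ε 0<ε → 0 , λ _ _ _ _ →
  subst (ℚ._< ε) (sym (cong ℚ.∣_∣ (ℚ.+-inverseʳ q))) 0<ε

fromℕ : ℕ → ℝ
fromℕ n = fromℚ (ℤ.+ n ℚ./ 1)

_<_ : ℝ → ℝ → Set
x < y = ∃ λ δ → 0ℚ ℚ.< δ × ∃ λ N → ∀ n → N ℕ.≤ n → seq x n ℚ.+ δ ℚ.≤ seq y n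

data _#_ (x y : ℝ) : Set where
  lt : x < y → x # y
  gt : y < x → x # y

module _ where
  open +-*-Solver
  open ℚ.≤-Reasoning

  p≤∣p∣ : ∀ p → p ℚ.≤ ℚ.∣ p ∣
  p≤∣p∣ p with ℚ.≤-total 0ℚ p
  ... | inj₁ 0≤p = ℚ.≤-reflexive (sym (ℚ.0≤p⇒∣p∣≡p 0≤p))
  ... | inj₂ p≤0 = ℚ.≤-trans p≤0 (ℚ.0≤∣p∣ p)

  ∣p-q∣≡∣q-p∣ : ∀ p q → ℚ.∣ p ℚ.- q ∣ ≡ ℚ.∣ q ℚ.- p ∣
  ∣p-q∣≡∣q-p∣ p q = trans
    (cong ℚ.∣_∣ (solve 2 (λ p q → p :- q := :- (q :- p)) refl p q))
    (ℚ.∣-p∣≡∣p∣ (q ℚ.- p))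

  p≤q⇒0≤q-p : ∀ {p q} → p ℚ.≤ q → 0ℚ ℚ.≤ q ℚ.- p
  p≤q⇒0≤q-p {p} {q} p≤q = begin
    0ℚ        ≡⟨ ℚ.+-inverseʳ p ⟨
    p ℚ.- p   ≤⟨ ℚ.+-monoˡ-≤ (ℚ.- p) p≤q ⟩
    q ℚ.- p   ∎

  p-q≤p : ∀ {p q} → 0ℚ ℚ.≤ q → p ℚ.- q ℚ.≤ p
  p-q≤p {p} {q} 0≤q = begin
    p ℚ.- q     ≤⟨ ℚ.+-monoʳ-≤ p (ℚ.neg-antimono-≤ 0≤q) ⟩
    p ℚ.+ 0ℚ    ≡⟨ ℚ.+-identityʳ p ⟩
    p           ∎

  ∣∣p∣-∣q∣∣≤∣p-q∣ : ∀ p q → ℚ.∣ ℚ.∣ p ∣ ℚ.- ℚ.∣ q ∣ ∣ ℚ.≤ ℚ.∣ p ℚ.- q ∣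
  ∣∣p∣-∣q∣∣≤∣p-q∣ p q with ℚ.∣p∣≡p∨∣p∣≡-p (ℚ.∣ p ∣ ℚ.- ℚ.∣ q ∣)
  ... | inj₁ eq = subst (ℚ._≤ ℚ.∣ p ℚ.- q ∣) (sym eq) (oneSided p q)
    where
    oneSided : ∀ p q → ℚ.∣ p ∣ ℚ.- ℚ.∣ q ∣ ℚ.≤ ℚ.∣ p ℚ.- q ∣
    oneSided p q = begin
      ℚ.∣ p ∣ ℚ.- ℚ.∣ q ∣
        ≡⟨ cong (λ r → ℚ.∣ r ∣ ℚ.- ℚ.∣ q ∣) (solve 2 (λ p q → p := (p :- q) :+ q) refl p q) ⟩
      ℚ.∣ (p ℚ.- q) ℚ.+ q ∣ ℚ.- ℚ.∣ q ∣
        ≤⟨ ℚ.+-monoˡ-≤ (ℚ.- ℚ.∣ q ∣) (ℚ.∣p+q∣≤∣p∣+∣q∣ (p ℚ.- q) q) ⟩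
      (ℚ.∣ p ℚ.- q ∣ ℚ.+ ℚ.∣ q ∣) ℚ.- ℚ.∣ q ∣
        ≡⟨ solve 2 (λ a b → (a :+ b) :- b := a) refl ℚ.∣ p ℚ.- q ∣ ℚ.∣ q ∣ ⟩
      ℚ.∣ p ℚ.- q ∣ ∎
  ... | inj₂ eq = subst (ℚ._≤ ℚ.∣ p ℚ.- q ∣) (sym eq) (begin
      ℚ.- (ℚ.∣ p ∣ ℚ.- ℚ.∣ q ∣)
        ≡⟨ cong (λ r → ℚ.- (ℚ.∣ p ∣ ℚ.- ℚ.∣ r ∣)) (solve 2 (λ p q → q := p :- (p :- q)) refl p q) ⟩
      ℚ.- (ℚ.∣ p ∣ ℚ.- ℚ.∣ p ℚ.- (p ℚ.- q) ∣)
        ≡⟨ solve 2 (λ a b → :- (a :- b) := b :- a) refl ℚ.∣ p ∣ ℚ.∣ p ℚ.- (p ℚ.- q) ∣ ⟩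
      ℚ.∣ p ℚ.- (p ℚ.- q) ∣ ℚ.- ℚ.∣ p ∣
        ≤⟨ ℚ.+-monoˡ-≤ (ℚ.- ℚ.∣ p ∣) (ℚ.∣p-q∣≤∣p∣+∣q∣ p (p ℚ.- q)) ⟩
      (ℚ.∣ p ∣ ℚ.+ ℚ.∣ p ℚ.- q ∣) ℚ.- ℚ.∣ p ∣
        ≡⟨ solve 2 (λ a b → (a :+ b) :- a := b) refl ℚ.∣ p ∣ ℚ.∣ p ℚ.- q ∣ ⟩
      ℚ.∣ p ℚ.- q ∣ ∎)

  +-cauchy : ∀ {x y} → IsCauchy x → IsCauchy y → IsCauchy (λ n → x n ℚ.+ y n)
  +-cauchy {x} {y} cx cy ε 0<ε =
    let ½ε>0 = ℚ.*-monoʳ-<-pos ½ 0<ε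
        N , hx = cx (½ ℚ.* ε) ½ε>0
        M , hy = cy (½ ℚ.* ε) ½ε>0
    in N ℕ.⊔ M , λ m n ≤m ≤n → begin-strict
      ℚ.∣ (x m ℚ.+ y m) ℚ.- (x n ℚ.+ y n) ∣
        ≡⟨ cong ℚ.∣_∣ (solve 4 (λ a b c d → (a :+ b) :- (c :+ d) := (a :- c) :+ (b :- d))
                       refl (x m) (y m) (x n) (y n)) ⟩
      ℚ.∣ (x m ℚ.- x n) ℚ.+ (y m ℚ.- y n) ∣
        ≤⟨ ℚ.∣p+q∣≤∣p∣+∣q∣ (x m ℚ.- x n) (y m ℚ.- y n) ⟩
      ℚ.∣ x m ℚ.- x n ∣ ℚ.+ ℚ.∣ y m ℚ.- y n ∣
        <⟨ ℚ.+-mono-< (hx m n (ℕ.m⊔n≤o⇒m≤o N M ≤m) (ℕ.m⊔n≤o⇒m≤o N M ≤n))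
                      (hy m n (ℕ.m⊔n≤o⇒n≤o N M ≤m) (ℕ.m⊔n≤o⇒n≤o N M ≤n)) ⟩
      ½ ℚ.* ε ℚ.+ ½ ℚ.* ε
        ≡⟨ solve 1 (λ e → con ½ :* e :+ con ½ :* e := e) refl ε ⟩
      ε ∎

  neg-cauchy : ∀ {x} → IsCauchy x → IsCauchy (λ n → ℚ.- x n)
  neg-cauchy {x} cx ε 0<ε = let N , hx = cx ε 0<ε in N , λ m n ≤m ≤n → begin-strict
    ℚ.∣ (ℚ.- x m) ℚ.- (ℚ.- x n) ∣
      ≡⟨ cong ℚ.∣_∣ (solve 2 (λ a b → (:- a) :- (:- b) := b :- a) refl (x m) (x n)) ⟩
    ℚ.∣ x n ℚ.- x m ∣  <⟨ hx n m ≤n ≤m ⟩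
    ε                  ∎

  ∣∣-cauchy : ∀ {x} → IsCauchy x → IsCauchy (λ n → ℚ.∣ x n ∣)
  ∣∣-cauchy {x} cx ε 0<ε = let N , hx = cx ε 0<ε in N , λ m n ≤m ≤n →
    ℚ.≤-<-trans (∣∣p∣-∣q∣∣≤∣p-q∣ (x m) (x n)) (hx m n ≤m ≤n)

  EventuallyBounded : (ℕ → ℚ) → Set
  EventuallyBounded x = ∃ λ B → 0ℚ ℚ.< B × ∃ λ N → ∀ n → N ℕ.≤ n → ℚ.∣ x n ∣ ℚ.≤ B

  cauchy⇒bounded : ∀ {x} → IsCauchy x → EventuallyBounded x
  cauchy⇒bounded {x} cx = let N , hx = cx 1ℚ (ℚ.positive⁻¹ 1ℚ) in
    ℚ.∣ x N ∣ ℚ.+ 1ℚ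
    , ℚ.+-mono-≤-< (ℚ.0≤∣p∣ (x N)) (ℚ.positive⁻¹ 1ℚ)
    , N , λ n ≤n → begin
      ℚ.∣ x n ∣
        ≡⟨ cong ℚ.∣_∣ (solve 2 (λ a b → a := b :+ (a :- b)) refl (x n) (x N)) ⟩
      ℚ.∣ x N ℚ.+ (x n ℚ.- x N) ∣
        ≤⟨ ℚ.∣p+q∣≤∣p∣+∣q∣ (x N) (x n ℚ.- x N) ⟩
      ℚ.∣ x N ∣ ℚ.+ ℚ.∣ x n ℚ.- x N ∣
        ≤⟨ ℚ.+-monoʳ-≤ ℚ.∣ x N ∣ (ℚ.<⇒≤ (hx n N ≤n ℕ.≤-refl)) ⟩
      ℚ.∣ x N ∣ ℚ.+ 1ℚ ∎

  ∣∣*-mono : ∀ {p q B η} → ℚ.∣ p ∣ ℚ.≤ B → 0ℚ ℚ.< B → ℚ.∣ q ∣ ℚ.< η → ℚ.∣ p ℚ.* q ∣ ℚ.< B ℚ.* η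
  ∣∣*-mono {p} {q} {B} {η} p≤B 0<B q<η = begin-strict
    ℚ.∣ p ℚ.* q ∣          ≡⟨ ℚ.∣p*q∣≡∣p∣*∣q∣ p q ⟩
    ℚ.∣ p ∣ ℚ.* ℚ.∣ q ∣    ≤⟨ ℚ.*-monoʳ-≤-nonNeg ℚ.∣ q ∣ {{ℚ.∣-∣-nonNeg q}} p≤B ⟩
    B ℚ.* ℚ.∣ q ∣          <⟨ ℚ.*-monoʳ-<-pos B {{ℚ.positive 0<B}} q<η ⟩
    B ℚ.* η                ∎

  quotient : ∀ C ε → 0ℚ ℚ.< C → 0ℚ ℚ.< ε → ∃ λ η → 0ℚ ℚ.< η × C ℚ.* η ≡ ε
  quotient C ε 0<C 0<ε =
    (1/C ℚ.* ε)
    , ℚ.positive⁻¹ (1/C ℚ.* ε) {{ℚ.pos*pos⇒pos 1/C {{ℚ.1/pos⇒pos C}} ε {{ℚ.positive 0<ε}}}}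
    , trans (sym (ℚ.*-assoc C 1/C ε)) (trans (cong (ℚ._* ε) (ℚ.*-inverseʳ C)) (ℚ.*-identityˡ ε))
    where
    instance
      C⁺ : ℚ.Positive C
      C⁺ = ℚ.positive 0<C
      C≢0 : ℚ.NonZero C
      C≢0 = ℚ.pos⇒nonZero C
    1/C = ℚ.1/ C

  *-cauchy : ∀ {x y} → IsCauchy x → IsCauchy y → IsCauchy (λ n → x n ℚ.* y n)
  *-cauchy {x} {y} cx cy ε 0<ε =
    let B , 0<B , N₁ , hB = cauchy⇒bounded cx
        C , 0<C , N₂ , hC = cauchy⇒bounded cy
        η , 0<η , Cη≡ε = quotient (B ℚ.+ C) ε (ℚ.+-mono-< 0<B 0<C) 0<ε
        N₃ , hx = cx η 0<η
        N₄ , hy = cy η 0<η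
        N = (N₁ ℕ.⊔ N₂) ℕ.⊔ (N₃ ℕ.⊔ N₄)
        ≤₁ = λ {m} (N≤m : N ℕ.≤ m) → ℕ.m⊔n≤o⇒m≤o N₁ N₂ (ℕ.m⊔n≤o⇒m≤o (N₁ ℕ.⊔ N₂) (N₃ ℕ.⊔ N₄) N≤m)
        ≤₂ = λ {m} (N≤m : N ℕ.≤ m) → ℕ.m⊔n≤o⇒n≤o N₁ N₂ (ℕ.m⊔n≤o⇒m≤o (N₁ ℕ.⊔ N₂) (N₃ ℕ.⊔ N₄) N≤m)
        ≤₃ = λ {m} (N≤m : N ℕ.≤ m) → ℕ.m⊔n≤o⇒m≤o N₃ N₄ (ℕ.m⊔n≤o⇒n≤o (N₁ ℕ.⊔ N₂) (N₃ ℕ.⊔ N₄) N≤m)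
        ≤₄ = λ {m} (N≤m : N ℕ.≤ m) → ℕ.m⊔n≤o⇒n≤o N₃ N₄ (ℕ.m⊔n≤o⇒n≤o (N₁ ℕ.⊔ N₂) (N₃ ℕ.⊔ N₄) N≤m)
    in N , λ m n ≤m ≤n → begin-strict
      ℚ.∣ x m ℚ.* y m ℚ.- x n ℚ.* y n ∣
        ≡⟨ cong ℚ.∣_∣ (solve 4 (λ a b c d → a :* b :- c :* d := a :* (b :- d) :+ d :* (a :- c))
                       refl (x m) (y m) (x n) (y n)) ⟩
      ℚ.∣ x m ℚ.* (y m ℚ.- y n) ℚ.+ y n ℚ.* (x m ℚ.- x n) ∣
        ≤⟨ ℚ.∣p+q∣≤∣p∣+∣q∣ (x m ℚ.* (y m ℚ.- y n)) (y n ℚ.* (x m ℚ.- x n)) ⟩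
      ℚ.∣ x m ℚ.* (y m ℚ.- y n) ∣ ℚ.+ ℚ.∣ y n ℚ.* (x m ℚ.- x n) ∣
        <⟨ ℚ.+-mono-< (∣∣*-mono {x m} {y m ℚ.- y n} (hB m (≤₁ ≤m)) 0<B (hy m n (≤₄ ≤m) (≤₄ ≤n)))
                      (∣∣*-mono {y n} {x m ℚ.- x n} (hC n (≤₂ ≤n)) 0<C (hx m n (≤₃ ≤m) (≤₃ ≤n))) ⟩
      B ℚ.* η ℚ.+ C ℚ.* η
        ≡⟨ ℚ.*-distribʳ-+ η B C ⟨
      (B ℚ.+ C) ℚ.* η
        ≡⟨ Cη≡ε ⟩
      ε ∎

-- Reciprocal extended by 0 at 0, so that it can be applied termwise.
recip : ℚ → ℚ
recip q with q ℚ.≟ 0ℚ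
... | yes _  = 0ℚ
... | no q≢0 = (ℚ.1/ q) {{ℚ.≢-nonZero q≢0}}

module _ where
  open +-*-Solver
  open ℚ.≤-Reasoning

  *-recip : ∀ {q} → q ≢ 0ℚ → q ℚ.* recip q ≡ 1ℚ
  *-recip {q} q≢0 with q ℚ.≟ 0ℚ
  ... | yes q≡0 = contradiction q≡0 q≢0
  ... | no q≢0′ = ℚ.*-inverseʳ q {{ℚ.≢-nonZero q≢0′}}

  #0⇒away : ∀ {x} → x # fromℕ 0 →
            ∃ λ δ → 0ℚ ℚ.< δ × ∃ λ N → ∀ n → N ℕ.≤ n → δ ℚ.≤ ℚ.∣ seq x n ∣
  #0⇒away {x} (lt (δ , 0<δ , N , h)) = δ , 0<δ , N , λ n ≤n → begin
    δ                              ≡⟨ solve 2 (λ a d → d := (a :+ d) :- a) refl (seq x n) δ ⟩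
    (seq x n ℚ.+ δ) ℚ.- seq x n    ≤⟨ ℚ.+-monoˡ-≤ (ℚ.- seq x n) (h n ≤n) ⟩
    0ℚ ℚ.- seq x n                 ≡⟨ ℚ.+-identityˡ (ℚ.- seq x n) ⟩
    ℚ.- seq x n                    ≤⟨ p≤∣p∣ (ℚ.- seq x n) ⟩
    ℚ.∣ ℚ.- seq x n ∣              ≡⟨ ℚ.∣-p∣≡∣p∣ (seq x n) ⟩
    ℚ.∣ seq x n ∣                  ∎
  #0⇒away {x} (gt (δ , 0<δ , N , h)) = δ , 0<δ , N , λ n ≤n → begin
    δ                ≡⟨ ℚ.+-identityˡ δ ⟨
    0ℚ ℚ.+ δ         ≤⟨ h n ≤n ⟩
    seq x n          ≤⟨ p≤∣p∣ (seq x n) ⟩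
    ℚ.∣ seq x n ∣    ∎

  recip-cauchy : ∀ {x} → IsCauchy x →
    (∃ λ δ → 0ℚ ℚ.< δ × ∃ λ N → ∀ n → N ℕ.≤ n → δ ℚ.≤ ℚ.∣ x n ∣) →
    IsCauchy (λ n → recip (x n))
  recip-cauchy {x} cx (δ , 0<δ , N , away) ε 0<ε =
    let D , 0<D , δD≡1 = quotient δ 1ℚ 0<δ (ℚ.positive⁻¹ 1ℚ)
        D²>0 = ℚ.positive⁻¹ (D ℚ.* D) {{ℚ.pos*pos⇒pos D {{ℚ.positive 0<D}} D {{ℚ.positive 0<D}}}}
        η , 0<η , D²η≡ε = quotient (D ℚ.* D) ε D²>0 0<ε
        M , hx = cx η 0<η
    in N ℕ.⊔ M , λ m n ≤m ≤n →
      let N≤m = ℕ.m⊔n≤o⇒m≤o N M ≤m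
          N≤n = ℕ.m⊔n≤o⇒m≤o N M ≤n
          u = recip (x m)
          v = recip (x n)
          um = *-recip (≢0 m N≤m)
          vn = *-recip (≢0 n N≤n)
      in begin-strict
      ℚ.∣ u ℚ.- v ∣
        ≡⟨ cong ℚ.∣_∣ (cong₂ ℚ._-_ (sym (trans (cong (u ℚ.*_) vn) (ℚ.*-identityʳ u)))
                                   (sym (trans (cong (v ℚ.*_) um) (ℚ.*-identityʳ v)))) ⟩
      ℚ.∣ u ℚ.* (x n ℚ.* v) ℚ.- v ℚ.* (x m ℚ.* u) ∣
        ≡⟨ cong ℚ.∣_∣ (solve 4 (λ u v a b → u :* (b :* v) :- v :* (a :* u) := (u :* v) :* (b :- a))
                       refl u v (x m) (x n)) ⟩
      ℚ.∣ (u ℚ.* v) ℚ.* (x n ℚ.- x m) ∣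
        <⟨ ∣∣*-mono {u ℚ.* v} {x n ℚ.- x m}
             (uv≤D² (bound D 0<D δD≡1 m N≤m) (bound D 0<D δD≡1 n N≤n) 0<D) D²>0
             (hx n m (ℕ.m⊔n≤o⇒n≤o N M ≤n) (ℕ.m⊔n≤o⇒n≤o N M ≤m)) ⟩
      (D ℚ.* D) ℚ.* η
        ≡⟨ D²η≡ε ⟩
      ε ∎
    where
    ≢0 : ∀ n → N ℕ.≤ n → x n ≢ 0ℚ
    ≢0 n ≤n eq = ℚ.<⇒≢ (ℚ.<-≤-trans 0<δ (away n ≤n)) (sym (cong ℚ.∣_∣ eq))

    bound : ∀ D → 0ℚ ℚ.< D → δ ℚ.* D ≡ 1ℚ → ∀ n → N ℕ.≤ n → ℚ.∣ recip (x n) ∣ ℚ.≤ D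
    bound D 0<D δD≡1 n ≤n = begin
      ∣u∣                            ≡⟨ trans (cong (∣u∣ ℚ.*_) δD≡1) (ℚ.*-identityʳ ∣u∣) ⟨
      ∣u∣ ℚ.* (δ ℚ.* D)              ≡⟨ solve 3 (λ u d e → u :* (d :* e) := (e :* u) :* d) refl ∣u∣ δ D ⟩
      (D ℚ.* ∣u∣) ℚ.* δ              ≤⟨ ℚ.*-monoˡ-≤-nonNeg (D ℚ.* ∣u∣) {{Du≥0}} (away n ≤n) ⟩
      (D ℚ.* ∣u∣) ℚ.* ℚ.∣ x n ∣      ≡⟨ solve 3 (λ e u a → (e :* u) :* a := e :* (a :* u)) refl D ∣u∣ ℚ.∣ x n ∣ ⟩
      D ℚ.* (ℚ.∣ x n ∣ ℚ.* ∣u∣)      ≡⟨ cong (D ℚ.*_) (ℚ.∣p*q∣≡∣p∣*∣q∣ (x n) (recip (x n))) ⟨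
      D ℚ.* ℚ.∣ x n ℚ.* recip (x n) ∣ ≡⟨ cong (λ r → D ℚ.* ℚ.∣ r ∣) (*-recip (≢0 n ≤n)) ⟩
      D ℚ.* 1ℚ                       ≡⟨ ℚ.*-identityʳ D ⟩
      D                              ∎
      where
      ∣u∣ = ℚ.∣ recip (x n) ∣
      Du≥0 : ℚ.NonNegative (D ℚ.* ∣u∣)
      Du≥0 = ℚ.nonNeg*nonNeg⇒nonNeg D {{ℚ.nonNegative (ℚ.<⇒≤ 0<D)}} ∣u∣ {{ℚ.∣-∣-nonNeg (recip (x n))}}

    uv≤D² : ∀ {u v D} → ℚ.∣ u ∣ ℚ.≤ D → ℚ.∣ v ∣ ℚ.≤ D → 0ℚ ℚ.< D → ℚ.∣ u ℚ.* v ∣ ℚ.≤ D ℚ.* D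
    uv≤D² {u} {v} {D} u≤D v≤D 0<D = begin
      ℚ.∣ u ℚ.* v ∣          ≡⟨ ℚ.∣p*q∣≡∣p∣*∣q∣ u v ⟩
      ℚ.∣ u ∣ ℚ.* ℚ.∣ v ∣    ≤⟨ ℚ.*-monoʳ-≤-nonNeg ℚ.∣ v ∣ {{ℚ.∣-∣-nonNeg v}} u≤D ⟩
      D ℚ.* ℚ.∣ v ∣          ≤⟨ ℚ.*-monoˡ-≤-nonNeg D {{ℚ.nonNegative (ℚ.<⇒≤ 0<D)}} v≤D ⟩
      D ℚ.* D                ∎

infixl 6 _+_ _-_
infixl 7 _*_ _÷_
infix  8 -_

_+_ : ℝ → ℝ → ℝ
x + y = mkℝ (λ n → seq x n ℚ.+ seq y n) (+-cauchy {seq x} {seq y} (cauchy x) (cauchy y))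

-_ : ℝ → ℝ
- x = mkℝ (λ n → ℚ.- seq x n) (neg-cauchy {seq x} (cauchy x))

_-_ : ℝ → ℝ → ℝ
x - y = x + (- y)

_*_ : ℝ → ℝ → ℝ
x * y = mkℝ (λ n → seq x n ℚ.* seq y n) (*-cauchy {seq x} {seq y} (cauchy x) (cauchy y))

∣_∣ : ℝ → ℝ
∣ x ∣ = mkℝ (λ n → ℚ.∣ seq x n ∣) (∣∣-cauchy {seq x} (cauchy x))

_÷_ : (x y : ℝ) {{_ : y # fromℕ 0}} → ℝ
_÷_ x y {{y#0}} = mkℝ (λ n → seq x n ℚ.* recip (seq y n))
  (*-cauchy {seq x} {λ n → recip (seq y n)} (cauchy x)
    (recip-cauchy {seq y} (cauchy y) (#0⇒away y#0)))

infix 4 _⟶_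
_⟶_ : (ℕ → ℝ) → ℝ → Set
a ⟶ L = ∀ ε → fromℕ 0 < ε → ∃ λ N → ∀ n → N ℕ.≤ n → ∣ a n - L ∣ < ε

leibnizTerm : ℕ → ℚ
leibnizTerm k = (-1ℤ ℤ.^ k) ℚ./ suc (2 ℕ.* k)

leibnizSum : ℕ → ℚ
leibnizSum zero    = 0ℚ
leibnizSum (suc n) = leibnizSum n ℚ.+ leibnizTerm n

module _ where
  open +-*-Solver
  open ℚ.≤-Reasoning

  odd⁻¹ : ℕ → ℚ
  odd⁻¹ k = ℤ.+ 1 ℚ./ suc (2 ℕ.* k)

  sign : ℕ → ℚ
  sign zero    = 1ℚ
  sign (suc k) = ℚ.- sign k

  sign-cases : ∀ k → (sign k ≡ 1ℚ × -1ℤ ℤ.^ k ≡ ℤ.+ 1) ⊎ (sign k ≡ ℚ.- 1ℚ × -1ℤ ℤ.^ k ≡ -1ℤ)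
  sign-cases zero = inj₁ (refl , refl)
  sign-cases (suc k) with sign-cases k
  ... | inj₁ (p , q) = inj₂ (cong ℚ.-_ p , cong (-1ℤ ℤ.*_) q)
  ... | inj₂ (p , q) = inj₁ (cong ℚ.-_ p , cong (-1ℤ ℤ.*_) q)

  leibnizTerm≡ : ∀ k → leibnizTerm k ≡ sign k ℚ.* odd⁻¹ k
  leibnizTerm≡ k with sign-cases k
  ... | inj₁ (p , q) rewrite p | q = sym (ℚ.*-identityˡ (odd⁻¹ k))
  ... | inj₂ (p , q) rewrite p | q =
    solve 1 (λ u → :- u := (:- con 1ℚ) :* u) refl (odd⁻¹ k)

  ∣sign∣ : ∀ k p → ℚ.∣ sign k ℚ.* p ∣ ≡ ℚ.∣ p ∣
  ∣sign∣ k p with sign-cases k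
  ... | inj₁ (eq , _) rewrite eq = cong ℚ.∣_∣ (ℚ.*-identityˡ p)
  ... | inj₂ (eq , _) rewrite eq = trans
    (cong ℚ.∣_∣ (solve 1 (λ p → (:- con 1ℚ) :* p := :- p) refl p)) (ℚ.∣-p∣≡∣p∣ p)

  1/suc≡ : ∀ n → ℤ.+ 1 ℚ./ suc n ≡ mkℚ (ℤ.+ 1) n (1-coprimeTo (suc n))
  1/suc≡ n = ℚ.normalize-coprime {1} {n} (1-coprimeTo (suc n))

  1/suc-anti : ∀ {m n} → m ℕ.≤ n → ℤ.+ 1 ℚ./ suc n ℚ.≤ ℤ.+ 1 ℚ./ suc m
  1/suc-anti {m} {n} m≤n = subst₂ ℚ._≤_ (sym (1/suc≡ n)) (sym (1/suc≡ m))
    (ℚ.*≤* (ℤ.+≤+ (ℕ.+-monoˡ-≤ 0 (ℕ.s≤s m≤n))))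

  odd⁻¹-anti : ∀ {m n} → m ℕ.≤ n → odd⁻¹ n ℚ.≤ odd⁻¹ m
  odd⁻¹-anti m≤n = 1/suc-anti (ℕ.*-monoʳ-≤ 2 m≤n)

  0≤odd⁻¹ : ∀ k → 0ℚ ℚ.≤ odd⁻¹ k
  0≤odd⁻¹ k = ℚ.<⇒≤ (ℚ.positive⁻¹ (odd⁻¹ k) {{ℚ.normalize-pos 1 (suc (2 ℕ.* k))}})

  -- Up to the sign of its first term, the sum of the n terms starting at k.
  tail : ℕ → ℕ → ℚ
  tail k zero    = 0ℚ
  tail k (suc n) = odd⁻¹ k ℚ.- tail (suc k) n

  tail-bounds : ∀ k n → 0ℚ ℚ.≤ tail k n × tail k n ℚ.≤ odd⁻¹ k
  tail-bounds k zero    = ℚ.≤-refl , 0≤odd⁻¹ k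
  tail-bounds k (suc n) = let lo , hi = tail-bounds (suc k) n in
    p≤q⇒0≤q-p (ℚ.≤-trans hi (odd⁻¹-anti (ℕ.n≤1+n k))) , p-q≤p lo

  leibnizSum-split : ∀ m n → leibnizSum (m ℕ.+ n) ≡ leibnizSum m ℚ.+ sign m ℚ.* tail m n
  leibnizSum-split m zero rewrite ℕ.+-identityʳ m =
    solve 2 (λ s t → s := s :+ t :* con 0ℚ) refl (leibnizSum m) (sign m)
  leibnizSum-split m (suc n) rewrite ℕ.+-suc m n =
    trans (leibnizSum-split (suc m) n)
    (trans (cong (λ t → (leibnizSum m ℚ.+ t) ℚ.+ sign (suc m) ℚ.* tail (suc m) n) (leibnizTerm≡ m))
    (solve 4 (λ s g u t → (s :+ g :* u) :+ (:- g) :* t := s :+ g :* (u :- t)) refl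
      (leibnizSum m) (sign m) (odd⁻¹ m) (tail (suc m) n)))

  leibnizSum-close : ∀ {m n} → m ℕ.≤ n → ℚ.∣ leibnizSum n ℚ.- leibnizSum m ∣ ℚ.≤ odd⁻¹ m
  leibnizSum-close {m} {n} m≤n = let lo , hi = tail-bounds m (n ℕ.∸ m) in begin
    ℚ.∣ leibnizSum n ℚ.- leibnizSum m ∣
      ≡⟨ cong (λ k → ℚ.∣ leibnizSum k ℚ.- leibnizSum m ∣) (ℕ.m+[n∸m]≡n m≤n) ⟨
    ℚ.∣ leibnizSum (m ℕ.+ (n ℕ.∸ m)) ℚ.- leibnizSum m ∣
      ≡⟨ cong (λ s → ℚ.∣ s ℚ.- leibnizSum m ∣) (leibnizSum-split m (n ℕ.∸ m)) ⟩
    ℚ.∣ (leibnizSum m ℚ.+ sign m ℚ.* tail m (n ℕ.∸ m)) ℚ.- leibnizSum m ∣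
      ≡⟨ cong ℚ.∣_∣ (solve 2 (λ s t → (s :+ t) :- s := t) refl
           (leibnizSum m) (sign m ℚ.* tail m (n ℕ.∸ m))) ⟩
    ℚ.∣ sign m ℚ.* tail m (n ℕ.∸ m) ∣
      ≡⟨ ∣sign∣ m (tail m (n ℕ.∸ m)) ⟩
    ℚ.∣ tail m (n ℕ.∸ m) ∣
      ≡⟨ ℚ.0≤p⇒∣p∣≡p lo ⟩
    tail m (n ℕ.∸ m)
      ≤⟨ hi ⟩
    odd⁻¹ m ∎

  odd⁻¹-small : ∀ ε → 0ℚ ℚ.< ε → ∃ λ N → odd⁻¹ N ℚ.< ε
  odd⁻¹-small (mkℚ ℤ.+[1+ a ] d c) _ = suc d , (begin-strict
    odd⁻¹ (suc d)             ≤⟨ 1/suc-anti (ℕ.m≤m+n (suc d) (suc d ℕ.+ 0)) ⟩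
    ℤ.+ 1 ℚ./ suc (suc d)     ≡⟨ 1/suc≡ (suc d) ⟩
    mkℚ (ℤ.+ 1) (suc d) _     <⟨ ℚ.*<* (ℤ.+<+ (ℕ.<-≤-trans
                                   (subst (ℕ._< suc (suc d)) (sym (ℕ.+-identityʳ (suc d))) ℕ.≤-refl)
                                   (ℕ.m≤m+n (suc (suc d)) (a ℕ.* suc (suc d))))) ⟩
    mkℚ ℤ.+[1+ a ] d c        ∎)
  odd⁻¹-small (mkℚ (ℤ.+ zero) d c)    (ℚ.*<* (ℤ.+<+ ()))
  odd⁻¹-small (mkℚ (ℤ.-[1+ a ]) d c)  (ℚ.*<* ())

  leibnizSum-cauchy : IsCauchy leibnizSum
  leibnizSum-cauchy ε 0<ε with odd⁻¹-small ε 0<ε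
  ... | N , small = N , close
    where
    close : ∀ m n → N ℕ.≤ m → N ℕ.≤ n → ℚ.∣ leibnizSum m ℚ.- leibnizSum n ∣ ℚ.< ε
    close m n N≤m N≤n with ℕ.≤-total m n
    ... | inj₁ m≤n = subst (ℚ._< ε) (∣p-q∣≡∣q-p∣ (leibnizSum n) (leibnizSum m))
      (ℚ.≤-<-trans (leibnizSum-close m≤n) (ℚ.≤-<-trans (odd⁻¹-anti N≤m) small))
    ... | inj₂ n≤m = ℚ.≤-<-trans (leibnizSum-close n≤m) (ℚ.≤-<-trans (odd⁻¹-anti N≤n) small)

-- π = 4 (1 - 1/3 + 1/5 - 1/7 + ⋯).
π : ℝ
π = fromℕ 4 * mkℝ leibnizSum leibnizSum-cauchy

module _ where
  open +-*-Solver
  open ℚ.≤-Reasoning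

  leibnizSum≤ : ∀ n → 3 ℕ.≤ n → leibnizSum n ℚ.≤ leibnizSum 3
  leibnizSum≤ n 3≤n = begin
    leibnizSum n                            ≡⟨ cong leibnizSum (ℕ.m+[n∸m]≡n 3≤n) ⟨
    leibnizSum (3 ℕ.+ (n ℕ.∸ 3))            ≡⟨ leibnizSum-split 3 (n ℕ.∸ 3) ⟩
    leibnizSum 3 ℚ.+ (ℚ.- 1ℚ) ℚ.* t         ≡⟨ solve 2 (λ s t → s :+ (:- con 1ℚ) :* t := s :- t) refl (leibnizSum 3) t ⟩
    leibnizSum 3 ℚ.- t                      ≤⟨ p-q≤p (proj₁ (tail-bounds 3 (n ℕ.∸ 3))) ⟩
    leibnizSum 3                            ∎
    where t = tail 3 (n ℕ.∸ 3)

  0<8-2π : fromℕ 0 < fromℕ 8 - fromℕ 2 * π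
  0<8-2π = 1ℚ , ℚ.positive⁻¹ 1ℚ , 3 , λ n 3≤n → begin
    0ℚ ℚ.+ 1ℚ
      ≤⟨ from-yes (0ℚ ℚ.+ 1ℚ ℚ.≤? 8′ ℚ.- 2′ ℚ.* (4′ ℚ.* leibnizSum 3)) ⟩
    8′ ℚ.- 2′ ℚ.* (4′ ℚ.* leibnizSum 3)
      ≤⟨ ℚ.+-monoʳ-≤ 8′ (ℚ.neg-antimono-≤ (ℚ.*-monoˡ-≤-nonNeg 2′ (ℚ.*-monoˡ-≤-nonNeg 4′ (leibnizSum≤ n 3≤n)))) ⟩
    8′ ℚ.- 2′ ℚ.* (4′ ℚ.* leibnizSum n) ∎
    where
    8′ = ℤ.+ 8 ℚ./ 1
    2′ = ℤ.+ 2 ℚ./ 1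
    4′ = ℤ.+ 4 ℚ./ 1

instance
  8-2π#0 : (fromℕ 8 - fromℕ 2 * π) # fromℕ 0
  8-2π#0 = gt 0<8-2π

{-# OPTIONS --safe #-}
-- An element q is the minimum of its block in σ ∨ ρ exactly when some nonempty interval [q, q + m) is a union of
-- blocks of both σ and ρ.  Cutting out the longest such interval decomposes pairs of partitions with a marked element,
-- and with a n = Cat n ² and g n = Σ (n + 1 - |σ ∨ ρ|) it gives Σ_{k ≤ n} a (n - k) g k = n a n.  The same argument
-- for a single partition gives the Catalan recurrence and Σ |σ| = (n + 1) Cat n / 2, so the mean in question is
-- 2 g n / (n a n) - 1 - 1/n.  Since a n / 16ⁿ decays like n⁻³, solving the convolution by a contraction argument shows
-- g n / (n a n) → 1 / M with M = Σ a n / 16ⁿ.  The partial sums of M telescope to 4 (4n + 1) w n - 4, where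
-- w n = (binom(2n, n) / 4ⁿ)², and the partial fraction expansion of Wallis' product, a weighted Leibniz series,
-- gives (4n + 1) w n → 4/π, hence M = 16/π - 4.
module Submission where

-- A join of non-crossing partitions has no convenient explicit description. Intervals serve as a
-- test for it: an interval and its complement form a non-crossing partition, so an interval is a
-- union of blocks of σ ∨ ρ as soon as it is one for σ and for ρ separately. Positions at which no
-- such interval starts are counted, rather than block minima, because they are exactly what remains
-- at the cut after the longest interval is removed; this is the source of the product formula.
--
-- Reals are Cauchy sequences of rationals, and π is given only by Leibniz partial sums. The
-- analytic half therefore replaces singularity analysis and integrals by inequalities between
-- explicit rationals, and every appearance of π comes from a finite identity followed by an error
-- estimate. The numerical bound is tight: the limit is about 0.8299, and 0.83 leaves π/4 a margin
-- of about 0.00001, for which the bare series would need some 26000 terms.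

module Combinatorics where

  open import Defs using (NC; mkNC; blocks; block; isNonCrossing; _≟ᵇ_; _∨_; _≤ᴺ_; block-mono; ∨-supremum;
    ∈-joinBlocks⁻; #blocks; allNC; ∈-allNC; allNC-unique; distance)
  open import Data.Empty using (⊥-elim)
  open import Data.Fin.Base as Fin using (Fin; toℕ; _↑ˡ_; _↑ʳ_; splitAt) renaming (zero to 0F; suc to sucF)
  open import Data.Fin.Properties as Fin using (all?; any?; toℕ-↑ˡ; toℕ-↑ʳ; splitAt-↑ˡ; splitAt-↑ʳ)
  open import Data.Fin.Subset using (Subset; _∈_)
  open import Data.Fin.Subset.Properties using (_∈?_; ⊆-antisym)
  open import Data.List.Base as List using (List; []; _∷_; length; filter; map; allFin; deduplicate;
    cartesianProduct; _++_; cartesianProductWith)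
  import Data.List.Membership.Propositional as List
  open import Data.List.Membership.Propositional.Properties using (∈-map⁺; ∈-map⁻; ∈-filter⁺; ∈-filter⁻;
    ∈-deduplicate⁺; ∈-deduplicate⁻; ∈-allFin; ∈-cartesianProduct⁺)
  open import Data.List.Membership.Propositional.Properties.WithK using (unique∧set⇒bag)
  open import Data.List.Properties using (length-map; filter-++; length-++; map-++; map-∘; filter-all)
  open import Data.List.Relation.Binary.BagAndSetEquality using (∼bag⇒↭)
  open import Data.List.Relation.Binary.Permutation.Propositional.Properties using (↭-length)
  open import Data.List.Relation.Unary.All as All using (All; []; _∷_)
  import Data.List.Relation.Unary.All.Properties as All
  open import Data.List.Relation.Unary.AllPairs using ([]; _∷_)
  open import Data.List.Relation.Unary.Any using (here; there)
  open import Data.List.Relation.Unary.Unique.Propositional using (Unique)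
  import Data.List.Relation.Unary.Unique.Propositional.Properties as Unique
  open import Data.List.Relation.Unary.Unique.DecPropositional.Properties using (deduplicate-!)
  open import Data.Nat.Base using (ℕ; zero; suc; _+_; _≤_; _<_; z≤n; s≤s; _∸_; _*_; _!)
  open import Data.Nat.Properties using (≤-refl; ≤-trans; <-trans; <-≤-trans; <⇒≤; <⇒≱; <-cmp; <-irrefl; _≤?_;
    _<?_; m≤m+n; m≤n+m; +-monoʳ-<; +-cancelˡ-<; +-assoc; +-comm; m≤n⇒m<n∨m≡n; +-identityʳ; m+[n∸m]≡n; +-suc;
    anyUpTo?; m+n≤o⇒m≤o∸n; ≤-pred; *-distribˡ-+; *-zeroʳ; +-identityˡ; *-cancelˡ-≡; +-cancelʳ-≡; *-assoc;
    *-identityˡ)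
  open import Data.Product.Base using (∃; _×_; _,_; proj₁; proj₂)
  open import Data.Sum.Base using (_⊎_; inj₁; inj₂; [_,_]′)
  open import Data.Sum.Relation.Binary.Pointwise using (Pointwise; inj₁; inj₂; ⊎-decidable; ⊎-isEquivalence)
  open import Data.Vec.Base using (Vec; lookup; tabulate; toList)
  open import Data.Vec.Properties using (lookup∘tabulate; tabulate∘lookup; tabulate-cong; []=⇒lookup; lookup⇒[]=)
  import Data.Vec.Membership.Propositional as Vec∈
  import Data.Vec.Membership.Propositional.Properties as Vec∈
  open import Function.Base using (_∘_; id)
  open import Function.Bundles using (mk⇔)
  open import Level using (0ℓ)
  open import Relation.Binary.Core using (Rel)
  open import Relation.Binary.Structures using (IsEquivalence)
  open import Relation.Binary.Definitions using (tri<; tri≈; tri>)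
  open import Relation.Binary.PropositionalEquality using (_≡_; refl; sym; trans; cong; cong₂; subst; subst₂;
    module ≡-Reasoning)
  open import Relation.Nullary.Decidable using (Dec; yes; no; does; dec-true; _×-dec_; _→-dec_; ¬?)
  open import Relation.Nullary.Negation using (¬_; contradiction)
  import Relation.Unary as U
  import Data.Vec.Relation.Unary.Any as VecAny
  import Data.Vec.Relation.Unary.Any.Properties as VecAny
  open import Data.Nat.Tactic.RingSolver using (solve-∀)
  open import Data.Integer.Base as ℤ using (ℤ)
  open import Data.Integer.Tactic.RingSolver using () renaming (solve-∀ to solveℤ-∀)
  open import Data.Nat.Induction using (<-rec)
  open import Data.Unit.Base using (tt)

  -- Non-crossing partitions as equivalence relations

  infix 4 _⊢_~_
  _⊢_~_ : ∀ {n} → NC n → Rel (Fin n) 0ℓ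
  σ ⊢ i ~ j = j ∈ block σ i

  -- An implication instead of a forbidden pattern: it pulls back directly along increasing maps,
  -- and a, b, c, d themselves represent the blocks.
  NonCrossing : ∀ {n} → Rel (Fin n) 0ℓ → Set
  NonCrossing R = ∀ {a b c d} → a Fin.< b → b Fin.< c → c Fin.< d → R a c → R b d → R a b

  module _ {n : ℕ} (σ : NC n) where

    ~-refl : ∀ {i} → σ ⊢ i ~ i
    ~-refl {i} = proj₁ (proj₁ (isNonCrossing σ)) i

    ~⇒block≡ : ∀ {i j} → σ ⊢ i ~ j → block σ j ≡ block σ i
    ~⇒block≡ {i} {j} = proj₂ (proj₁ (isNonCrossing σ)) i j

    block≡⇒~ : ∀ {i j} → block σ i ≡ block σ j → σ ⊢ i ~ j
    block≡⇒~ {i} {j} eq = subst (j ∈_) (sym eq) ~-refl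

    ~-sym : ∀ {i j} → σ ⊢ i ~ j → σ ⊢ j ~ i
    ~-sym i~j = block≡⇒~ (~⇒block≡ i~j)

    ~-trans : ∀ {i j k} → σ ⊢ i ~ j → σ ⊢ j ~ k → σ ⊢ i ~ k
    ~-trans {k = k} i~j j~k = subst (k ∈_) (~⇒block≡ i~j) j~k

    ~-isEquivalence : IsEquivalence (σ ⊢_~_)
    ~-isEquivalence = record { refl = ~-refl ; sym = ~-sym ; trans = ~-trans }

    infix 4 _~?_
    _~?_ : ∀ i j → Dec (σ ⊢ i ~ j)
    i ~? j = j ∈? block σ i

    ~-nonCrossing : NonCrossing (σ ⊢_~_)
    ~-nonCrossing {a} {b} {c} {d} a<b b<c c<d a~c b~d with block σ a ≟ᵇ block σ b
    ... | yes eq = block≡⇒~ eq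
    ... | no neq = contradiction
      (a , b , neq , a , b , c , d , (a<b , b<c , c<d) , (~-refl , a~c) , (~-refl , b~d))
      (proj₂ (isNonCrossing σ))

  blocks-injective : ∀ {n} {σ τ : NC n} → blocks σ ≡ blocks τ → σ ≡ τ
  blocks-injective {σ = mkNC p _} {mkNC .p _} refl = refl

  ~-ext : ∀ {n} {σ τ : NC n} → (∀ i j → σ ⊢ i ~ j → τ ⊢ i ~ j) → (∀ i j → τ ⊢ i ~ j → σ ⊢ i ~ j) → σ ≡ τ
  ~-ext {σ = σ} {τ} σ⇒τ τ⇒σ = blocks-injective (trans (sym (tabulate∘lookup (blocks σ)))
    (trans (tabulate-cong λ i → ⊆-antisym (σ⇒τ i _) (τ⇒σ i _)) (tabulate∘lookup (blocks τ))))

  module FromRelation {n : ℕ} (R : Rel (Fin n) 0ℓ) (R? : ∀ i j → Dec (R i j))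
                      (equiv : IsEquivalence R) (nc : NonCrossing R) where
    private
      module E = IsEquivalence equiv

      p : Vec (Subset n) n
      p = tabulate λ i → tabulate λ j → does (R? i j)

      entry : ∀ i j → lookup (lookup p i) j ≡ does (R? i j)
      entry i j = trans (cong (λ v → lookup v j) (lookup∘tabulate _ i)) (lookup∘tabulate _ j)

      ∈p⁺ : ∀ {i j} → R i j → j ∈ lookup p i
      ∈p⁺ {i} {j} r = lookup⇒[]= j _ (trans (entry i j) (dec-true (R? i j) r))

      ∈p⁻ : ∀ {i j} → j ∈ lookup p i → R i j
      ∈p⁻ {i} {j} j∈ with R? i j | trans (sym (entry i j)) ([]=⇒lookup j∈)
      ... | yes r | _ = r

      same : ∀ i j → j ∈ lookup p i → lookup p j ≡ lookup p i
      same i j j∈ = ⊆-antisym (λ k∈ → ∈p⁺ (E.trans (∈p⁻ j∈) (∈p⁻ k∈)))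
                              (λ k∈ → ∈p⁺ (E.trans (E.sym (∈p⁻ j∈)) (∈p⁻ k∈)))

    nonCrossing : NC n
    nonCrossing = mkNC p (((λ i → ∈p⁺ E.refl) , same) ,
      λ (i , j , neq , a , b , c , d , (a<b , b<c , c<d) , (a∈ , c∈) , (b∈ , d∈)) →
        -- `Crossing` names its two blocks by arbitrary elements i and j; the relations between a
        -- and c and between b and d are obtained by passing through them.
        let a~b = nc a<b b<c c<d (E.trans (E.sym (∈p⁻ a∈)) (∈p⁻ c∈)) (E.trans (E.sym (∈p⁻ b∈)) (∈p⁻ d∈))
        in neq (sym (same i j (∈p⁺ (E.trans (∈p⁻ a∈) (E.trans a~b (E.sym (∈p⁻ b∈))))))))

    ~⁺ : ∀ {i j} → R i j → nonCrossing ⊢ i ~ j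
    ~⁺ = ∈p⁺

    ~⁻ : ∀ {i j} → nonCrossing ⊢ i ~ j → R i j
    ~⁻ = ∈p⁻

  on-isEquivalence : ∀ {A B : Set} (f : A → B) {R : Rel B 0ℓ} → IsEquivalence R → IsEquivalence (λ x y → R (f x) (f y))
  on-isEquivalence f equiv = record { refl = E.refl ; sym = E.sym ; trans = E.trans }
    where module E = IsEquivalence equiv

  module Pullback {m n : ℕ} (f : Fin m → Fin n) (σ : NC n) (nc : NonCrossing (λ i j → σ ⊢ f i ~ f j)) =
    FromRelation (λ i j → σ ⊢ f i ~ f j) (λ i j → _~?_ σ (f i) (f j)) (on-isEquivalence f (~-isEquivalence σ)) nc

  monotone-nonCrossing : ∀ {m n} (f : Fin m → Fin n) → (∀ {i j} → i Fin.< j → f i Fin.< f j) →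
                         ∀ σ → NonCrossing (λ i j → σ ⊢ f i ~ f j)
  monotone-nonCrossing f mono σ a<b b<c c<d = ~-nonCrossing σ (mono a<b) (mono b<c) (mono c<d)

  -- Intervals.

  InRange : ∀ {n} → ℕ → ℕ → Fin n → Set
  InRange p l i = p ≤ toℕ i × toℕ i < p + l

  inRange? : ∀ {n} p l (i : Fin n) → Dec (InRange p l i)
  inRange? p l i = (p ≤? toℕ i) ×-dec (toℕ i <? p + l)

  -- By symmetry of the relation this one implication already makes [p, p + l) a union of blocks.
  Closed : ∀ {n} → ℕ → ℕ → NC n → Set
  Closed p l σ = ∀ i → InRange p l i → ∀ j → σ ⊢ i ~ j → InRange p l j

  closed? : ∀ {n} p l (σ : NC n) → Dec (Closed p l σ)
  closed? p l σ = all? λ i → inRange? p l i →-dec all? λ j → _~?_ σ i j →-dec inRange? p l j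

  -- The ground set is cut into consecutive stretches of lengths p, l and r. `inner` enumerates the
  -- middle one and `outer` the two ends with the gap closed up; `view` inverts both at once.
  module _ (p l r : ℕ) where

    inner : Fin l → Fin (p + (l + r))
    inner i = p ↑ʳ (i ↑ˡ r)

    outer : Fin (p + r) → Fin (p + (l + r))
    outer j = [ _↑ˡ (l + r) , (λ k → p ↑ʳ (l ↑ʳ k)) ]′ (splitAt p j)

    private
      view₂ : Fin (l + r) → Fin l ⊎ Fin (p + r)
      view₂ k = [ inj₁ , (λ d → inj₂ (p ↑ʳ d)) ]′ (splitAt l k)

    view : Fin (p + (l + r)) → Fin l ⊎ Fin (p + r)
    view i = [ (λ a → inj₂ (a ↑ˡ r)) , view₂ ]′ (splitAt p i)

    view-inner : ∀ i → view (inner i) ≡ inj₁ i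
    view-inner i rewrite splitAt-↑ʳ p (l + r) (i ↑ˡ r) | splitAt-↑ˡ l i r = refl

    view-outer : ∀ j → view (outer j) ≡ inj₂ j
    view-outer j with splitAt p j in eq
    ... | inj₁ a rewrite splitAt-↑ˡ p a (l + r) = cong inj₂ (Fin.splitAt⁻¹-↑ˡ eq)
    ... | inj₂ b rewrite splitAt-↑ʳ p (l + r) (l ↑ʳ b) | splitAt-↑ʳ l r b = cong inj₂ (Fin.splitAt⁻¹-↑ʳ eq)

    data Position : Fin (p + (l + r)) → Set where
      in-  : ∀ i → Position (inner i)
      out- : ∀ j → Position (outer j)

    outer-↑ˡ : ∀ a → outer (a ↑ˡ r) ≡ a ↑ˡ (l + r)
    outer-↑ˡ a rewrite splitAt-↑ˡ p a r = refl

    outer-↑ʳ : ∀ d → outer (p ↑ʳ d) ≡ p ↑ʳ (l ↑ʳ d)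
    outer-↑ʳ d rewrite splitAt-↑ʳ p r d = refl

    position : ∀ i → Position i
    position i with splitAt p i in eq
    ... | inj₁ a = subst Position (trans (outer-↑ˡ a) (Fin.splitAt⁻¹-↑ˡ eq)) (out- (a ↑ˡ r))
    ... | inj₂ k with splitAt l k in eq₂
    ...   | inj₁ c = subst Position (trans (cong (p ↑ʳ_) (Fin.splitAt⁻¹-↑ˡ eq₂)) (Fin.splitAt⁻¹-↑ʳ eq)) (in- c)
    ...   | inj₂ d = subst Position
      (trans (outer-↑ʳ d) (trans (cong (p ↑ʳ_) (Fin.splitAt⁻¹-↑ʳ eq₂)) (Fin.splitAt⁻¹-↑ʳ eq))) (out- (p ↑ʳ d))

    toℕ-inner : ∀ i → toℕ (inner i) ≡ p + toℕ i
    toℕ-inner i = trans (toℕ-↑ʳ p (i ↑ˡ r)) (cong (p +_) (toℕ-↑ˡ i r))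

    private
      l+[p+m]≡p+[l+m] : ∀ m → l + (p + m) ≡ p + (l + m)
      l+[p+m]≡p+[l+m] m = trans (sym (+-assoc l p m)) (trans (cong (_+ m) (+-comm l p)) (+-assoc p l m))

    toℕ-outer : ∀ j → (toℕ j < p × toℕ (outer j) ≡ toℕ j) ⊎ (p ≤ toℕ j × toℕ (outer j) ≡ l + toℕ j)
    toℕ-outer j with splitAt p j in eq
    ... | inj₁ a = inj₁ (subst (_< p) (sym ja) (Fin.toℕ<n a) , trans (toℕ-↑ˡ a (l + r)) (sym ja))
      where
      ja : toℕ j ≡ toℕ a
      ja = trans (cong toℕ (sym (Fin.splitAt⁻¹-↑ˡ eq))) (toℕ-↑ˡ a r)
    ... | inj₂ b = inj₂ (subst (p ≤_) (sym jb) (m≤m+n p (toℕ b)) ,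
        trans (trans (toℕ-↑ʳ p (l ↑ʳ b)) (cong (p +_) (toℕ-↑ʳ l b)))
        (trans (sym (l+[p+m]≡p+[l+m] (toℕ b))) (cong (l +_) (sym jb))))
      where
      jb : toℕ j ≡ p + toℕ b
      jb = trans (cong toℕ (sym (Fin.splitAt⁻¹-↑ʳ eq))) (toℕ-↑ʳ p b)

    inner-mono : ∀ {i j} → i Fin.< j → inner i Fin.< inner j
    inner-mono {i} {j} i<j = subst₂ _<_ (sym (toℕ-inner i)) (sym (toℕ-inner j)) (+-monoʳ-< p i<j)

    inner-cancel : ∀ {i j} → inner i Fin.< inner j → i Fin.< j
    inner-cancel {i} {j} lt = +-cancelˡ-< p _ _ (subst₂ _<_ (toℕ-inner i) (toℕ-inner j) lt)

    outer-mono : ∀ {i j} → i Fin.< j → outer i Fin.< outer j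
    outer-mono {i} {j} i<j with toℕ-outer i | toℕ-outer j
    ... | inj₁ (_ , ei) | inj₁ (_ , ej) = subst₂ _<_ (sym ei) (sym ej) i<j
    ... | inj₁ (_ , ei) | inj₂ (_ , ej) = subst₂ _<_ (sym ei) (sym ej) (<-≤-trans i<j (m≤n+m _ l))
    ... | inj₂ (p≤i , _) | inj₁ (j<p , _) = ⊥-elim (<⇒≱ (<-trans i<j j<p) p≤i)
    ... | inj₂ (_ , ei) | inj₂ (_ , ej) = subst₂ _<_ (sym ei) (sym ej) (+-monoʳ-< l i<j)

    outer-cancel : ∀ {i j} → outer i Fin.< outer j → i Fin.< j
    outer-cancel {i} {j} lt with Fin.<-cmp i j
    ... | tri< i<j _ _ = i<j
    ... | tri≈ _ refl _ = ⊥-elim (<-irrefl refl lt)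
    ... | tri> _ _ j<i = ⊥-elim (<-irrefl refl (<-trans lt (outer-mono j<i)))

    inner-inRange : ∀ i {m} → l ≤ m → InRange p m (inner i)
    inner-inRange i l≤m rewrite toℕ-inner i = m≤m+n p _ , +-monoʳ-< p (<-≤-trans (Fin.toℕ<n i) l≤m)

    outer-inRange⁺ : ∀ j {m} → InRange p m j → InRange p (l + m) (outer j)
    outer-inRange⁺ j {m} (p≤j , j<p+m) with toℕ-outer j
    ... | inj₁ (j<p , _) = ⊥-elim (<⇒≱ j<p p≤j)
    ... | inj₂ (_ , e) rewrite e = ≤-trans p≤j (m≤n+m _ l) ,
      subst (l + toℕ j <_) (l+[p+m]≡p+[l+m] m) (+-monoʳ-< l j<p+m)

    outer-inRange⁻ : ∀ j {m} → InRange p (l + m) (outer j) → InRange p m j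
    outer-inRange⁻ j {m} (p≤ , <p+l+m) with toℕ-outer j
    ... | inj₁ (j<p , e) rewrite e = ⊥-elim (<⇒≱ j<p p≤)
    ... | inj₂ (p≤j , e) rewrite e = p≤j ,
      +-cancelˡ-< l _ _ (subst (l + toℕ j <_) (sym (l+[p+m]≡p+[l+m] m)) <p+l+m)

    outer-notInRange : ∀ j → ¬ InRange p l (outer j)
    outer-notInRange j h with outer-inRange⁻ j {0} (subst (λ m → InRange p m (outer j)) (sym (+-identityʳ l)) h)
    ... | p≤j , j<p+0 = <⇒≱ j<p+0 (subst (_≤ toℕ j) (sym (+-identityʳ p)) p≤j)

    inner-convex : ∀ {i i′ j} → inner i Fin.< outer j → outer j Fin.< inner i′ → ∀ {A : Set} → A
    inner-convex {i} {i′} {j} i<j j<i′ = ⊥-elim (outer-notInRange j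
      (≤-trans (proj₁ (inner-inRange i ≤-refl)) (<⇒≤ i<j) , <-trans j<i′ (proj₂ (inner-inRange i′ ≤-refl))))

    module _ (α : NC l) (β : NC (p + r)) where
      private
        R : Rel (Fin (p + (l + r))) 0ℓ
        R i j = Pointwise (α ⊢_~_) (β ⊢_~_) (view i) (view j)

        R-inner⁺ : ∀ {i j} → α ⊢ i ~ j → R (inner i) (inner j)
        R-inner⁺ {i} {j} i~j rewrite view-inner i | view-inner j = inj₁ i~j

        R-outer⁺ : ∀ {i j} → β ⊢ i ~ j → R (outer i) (outer j)
        R-outer⁺ {i} {j} i~j rewrite view-outer i | view-outer j = inj₂ i~j

        R-inner⁻ : ∀ {i j} → R (inner i) (inner j) → α ⊢ i ~ j
        R-inner⁻ {i} {j} h rewrite view-inner i | view-inner j with inj₁ i~j ← h = i~j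

        R-outer⁻ : ∀ {i j} → R (outer i) (outer j) → β ⊢ i ~ j
        R-outer⁻ {i} {j} h rewrite view-outer i | view-outer j with inj₂ i~j ← h = i~j

        R-inner-outer : ∀ {i j} → ¬ R (inner i) (outer j)
        R-inner-outer {i} {j} h rewrite view-inner i | view-outer j with () ← h

        R-outer-inner : ∀ {i j} → ¬ R (outer i) (inner j)
        R-outer-inner {i} {j} h rewrite view-outer i | view-inner j with () ← h

        R-nonCrossing : NonCrossing R
        R-nonCrossing {a} {b} {c} {d} a<b b<c c<d a~c b~d with position a | position b | position c | position d
        ... | in- a | in- b | in- c | in- d = R-inner⁺ (~-nonCrossing α (inner-cancel a<b) (inner-cancel b<c)
                                                (inner-cancel c<d) (R-inner⁻ a~c) (R-inner⁻ b~d))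
        ... | out- a | out- b | out- c | out- d = R-outer⁺ (~-nonCrossing β (outer-cancel a<b) (outer-cancel b<c)
                                                (outer-cancel c<d) (R-outer⁻ a~c) (R-outer⁻ b~d))
        ... | in- _ | _ | out- _ | _ = ⊥-elim (R-inner-outer a~c)
        ... | out- _ | _ | in- _ | _ = ⊥-elim (R-outer-inner a~c)
        ... | _ | in- _ | _ | out- _ = ⊥-elim (R-inner-outer b~d)
        ... | _ | out- _ | _ | in- _ = ⊥-elim (R-outer-inner b~d)
        -- In the two remaining patterns a, c lie on one side and b, d on the other; an outer
        -- element would then sit between two inner ones, although the inner elements form an
        -- interval.
        ... | in- _ | out- _ | in- _ | out- _ = inner-convex a<b b<c
        ... | out- _ | in- _ | out- _ | in- _ = inner-convex b<c c<d

        module G = FromRelation R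
          (λ i j → ⊎-decidable (_~?_ α) (_~?_ β) (view i) (view j))
          (on-isEquivalence view (⊎-isEquivalence (~-isEquivalence α) (~-isEquivalence β)))
          R-nonCrossing

      abstract
        glue : NC (p + (l + r))
        glue = G.nonCrossing

        glue-inner⁺ : ∀ {i j} → α ⊢ i ~ j → glue ⊢ inner i ~ inner j
        glue-inner⁺ = G.~⁺ ∘ R-inner⁺

        glue-inner⁻ : ∀ {i j} → glue ⊢ inner i ~ inner j → α ⊢ i ~ j
        glue-inner⁻ = R-inner⁻ ∘ G.~⁻

        glue-outer⁺ : ∀ {i j} → β ⊢ i ~ j → glue ⊢ outer i ~ outer j
        glue-outer⁺ = G.~⁺ ∘ R-outer⁺

        glue-outer⁻ : ∀ {i j} → glue ⊢ outer i ~ outer j → β ⊢ i ~ j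
        glue-outer⁻ = R-outer⁻ ∘ G.~⁻

        glue-closed : Closed p l glue
        glue-closed i i∈ j i~j with position i | position j
        ... | in- _  | in- j  = inner-inRange j ≤-refl
        ... | in- _  | out- _ = ⊥-elim (R-inner-outer (G.~⁻ i~j))
        ... | out- i | _      = ⊥-elim (outer-notInRange i i∈)

    module _ (σ : NC (p + (l + r))) where
      private
        module I = Pullback inner σ (monotone-nonCrossing inner inner-mono σ)
        module O = Pullback outer σ (monotone-nonCrossing outer outer-mono σ)

      abstract
        cutInner : NC l
        cutInner = I.nonCrossing

        cutOuter : NC (p + r)
        cutOuter = O.nonCrossing

        cutInner⁺ : ∀ {i j} → σ ⊢ inner i ~ inner j → cutInner ⊢ i ~ j
        cutInner⁺ = I.~⁺

        cutInner⁻ : ∀ {i j} → cutInner ⊢ i ~ j → σ ⊢ inner i ~ inner j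
        cutInner⁻ = I.~⁻

        cutOuter⁺ : ∀ {i j} → σ ⊢ outer i ~ outer j → cutOuter ⊢ i ~ j
        cutOuter⁺ = O.~⁺

        cutOuter⁻ : ∀ {i j} → cutOuter ⊢ i ~ j → σ ⊢ outer i ~ outer j
        cutOuter⁻ = O.~⁻

      -- Cutting forgets only relations between the middle and the ends, and closedness says that
      -- there are none.
      glue-cut : Closed p l σ → glue cutInner cutOuter ≡ σ
      glue-cut cl = ~-ext to from
        where
        to : ∀ i j → glue cutInner cutOuter ⊢ i ~ j → σ ⊢ i ~ j
        to i j i~j with position i | position j
        ... | in- _  | in- _  = cutInner⁻ (glue-inner⁻ cutInner cutOuter i~j)
        ... | out- _ | out- _ = cutOuter⁻ (glue-outer⁻ cutInner cutOuter i~j)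
        ... | in- i  | out- j = ⊥-elim (outer-notInRange j (glue-closed cutInner cutOuter _ (inner-inRange i ≤-refl) _ i~j))
        ... | out- i | in- j  = ⊥-elim (outer-notInRange i
          (glue-closed cutInner cutOuter _ (inner-inRange j ≤-refl) _ (~-sym (glue cutInner cutOuter) i~j)))

        from : ∀ i j → σ ⊢ i ~ j → glue cutInner cutOuter ⊢ i ~ j
        from i j i~j with position i | position j
        ... | in- _  | in- _  = glue-inner⁺ cutInner cutOuter (cutInner⁺ i~j)
        ... | out- _ | out- _ = glue-outer⁺ cutInner cutOuter (cutOuter⁺ i~j)
        ... | in- i  | out- j = ⊥-elim (outer-notInRange j (cl _ (inner-inRange i ≤-refl) _ i~j))
        ... | out- i | in- j  = ⊥-elim (outer-notInRange i (cl _ (inner-inRange j ≤-refl) _ (~-sym σ i~j)))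

      -- Together with `closed-cut⁻` this translates maximality of the removed interval: a longer
      -- closed interval from p would survive as a nonempty closed interval from p in the outer
      -- part, and conversely.
      closed-cut⁺ : ∀ {m} → Closed p (l + m) σ → Closed p m cutOuter
      closed-cut⁺ cl i i∈ j i~j = outer-inRange⁻ j (cl (outer i) (outer-inRange⁺ i i∈) (outer j) (cutOuter⁻ i~j))

      closed-cut⁻ : ∀ {m} → Closed p l σ → Closed p m cutOuter → Closed p (l + m) σ
      closed-cut⁻ {m} cl clₒ i i∈ j i~j with position i | position j
      ... | _      | in- j  = inner-inRange j (m≤m+n l m)
      ... | in- i  | out- j = ⊥-elim (outer-notInRange j (cl _ (inner-inRange i ≤-refl) _ i~j))
      ... | out- i | out- j = outer-inRange⁺ j (clₒ i (outer-inRange⁻ i i∈) j (cutOuter⁺ i~j))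

    cutInner-glue : ∀ α β → cutInner (glue α β) ≡ α
    cutInner-glue α β = ~-ext (λ _ _ → glue-inner⁻ α β ∘ cutInner⁻ (glue α β)) (λ _ _ → cutInner⁺ (glue α β) ∘ glue-inner⁺ α β)

    cutOuter-glue : ∀ α β → cutOuter (glue α β) ≡ β
    cutOuter-glue α β = ~-ext (λ _ _ → glue-outer⁻ α β ∘ cutOuter⁻ (glue α β)) (λ _ _ → cutOuter⁺ (glue α β) ∘ glue-outer⁺ α β)

  -- Block minima.

  greatest : ∀ {n} {P : Fin n → Set} → U.Decidable P → ∃ P → ∃ λ j → P j × (∀ k → P k → toℕ k ≤ toℕ j)
  greatest {suc n} P? (i , pi) with any? (P? ∘ sucF)
  ... | yes w = let j , pj , h = greatest (P? ∘ sucF) w in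
    sucF j , pj , λ { 0F _ → z≤n ; (sucF k) pk → s≤s (h k pk) }
  greatest {suc n} P? (0F , p0)      | no ¬w = 0F , p0 , λ { 0F _ → z≤n ; (sucF k) pk → ⊥-elim (¬w (k , pk)) }
  greatest {suc n} P? (sucF i , pi)  | no ¬w = ⊥-elim (¬w (i , pi))

  least : ∀ {n} {P : Fin n → Set} → U.Decidable P → ∃ P → ∃ λ j → P j × (∀ k → P k → toℕ j ≤ toℕ k)
  least {suc n} P? (i , pi) with P? 0F
  ... | yes p0 = 0F , p0 , λ _ _ → z≤n
  least {suc n} P? (0F , p0)     | no ¬p0 = ⊥-elim (¬p0 p0)
  least {suc n} P? (sucF i , pi) | no ¬p0 = let j , pj , h = least (P? ∘ sucF) (i , pi) in
    sucF j , pj , λ { 0F p0 → ⊥-elim (¬p0 p0) ; (sucF k) pk → s≤s (h k pk) }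

  module _ {n : ℕ} (σ : NC n) where

    IsMin : Fin n → Set
    IsMin q = ∀ j → σ ⊢ q ~ j → q Fin.≤ j

    isMin? : U.Decidable IsMin
    isMin? q = all? λ j → _~?_ σ q j →-dec q Fin.≤? j

    isMin-unique : ∀ {i j} → IsMin i → IsMin j → σ ⊢ i ~ j → i ≡ j
    isMin-unique {i} {j} mi mj i~j = Fin.≤-antisym (mi j i~j) (mj i (~-sym σ i~j))

    block-min : ∀ i → ∃ λ q → IsMin q × σ ⊢ i ~ q
    block-min i = let q , i~q , h = least (_~?_ σ i) (i , ~-refl σ) in
      q , (λ j q~j → h j (~-trans σ i~q q~j)) , i~q

    blockMins : List (Subset n)
    blockMins = map (block σ) (filter isMin? (allFin n))

  Unique-map : ∀ {A B : Set} {f : A → B} {xs} → (∀ {x y} → x List.∈ xs → y List.∈ xs → f x ≡ f y → x ≡ y) →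
               Unique xs → Unique (map f xs)
  Unique-map {xs = []} inj [] = []
  Unique-map {f = f} {xs = x ∷ xs} inj (x∉ ∷ u) =
    All.map⁺ (All.tabulate λ y∈ fx≡fy → All.lookup x∉ y∈ (inj (here refl) (there y∈) fx≡fy))
    ∷ Unique-map (λ x∈ y∈ → inj (there x∈) (there y∈)) u

  Unique-length : ∀ {A : Set} {xs ys : List A} → Unique xs → Unique ys →
                  (∀ {z} → z List.∈ xs → z List.∈ ys) → (∀ {z} → z List.∈ ys → z List.∈ xs) → length xs ≡ length ys
  Unique-length u v to from = ↭-length (∼bag⇒↭ (unique∧set⇒bag u v (mk⇔ to from)))

  count : ∀ {A : Set} {P : A → Set} → U.Decidable P → List A → ℕ
  count P? xs = length (filter P? xs)

  -- The maps have to be mutually inverse only on the counted elements: gluing undoes cutting only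
  -- along a closed interval, and `double` undoes `dropFirst` only if 0 and 1 share a block.
  count-bijection : ∀ {A B : Set} {P : A → Set} {Q : B → Set} (P? : U.Decidable P) (Q? : U.Decidable Q) {xs ys} →
    Unique xs → Unique ys → (∀ x → x List.∈ xs) → (∀ y → y List.∈ ys) →
    (f : A → B) (g : B → A) → (∀ {x} → P x → Q (f x)) → (∀ {y} → Q y → P (g y)) →
    (∀ {x} → P x → g (f x) ≡ x) → (∀ {y} → Q y → f (g y) ≡ y) → count P? xs ≡ count Q? ys
  count-bijection P? Q? {xs} {ys} u v x∈ y∈ f g P⇒Q Q⇒P gf fg = trans (sym (length-map f (filter P? xs)))
    (Unique-length (Unique-map inj (Unique.filter⁺ P? u)) (Unique.filter⁺ Q? v) to from)
    where
    inj : ∀ {x y} → x List.∈ filter P? xs → y List.∈ filter P? xs → f x ≡ f y → x ≡ y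
    inj x∈ y∈ fx≡fy = trans (sym (gf (proj₂ (∈-filter⁻ P? {xs = xs} x∈))))
      (trans (cong g fx≡fy) (gf (proj₂ (∈-filter⁻ P? {xs = xs} y∈))))
    to : ∀ {z} → z List.∈ map f (filter P? xs) → z List.∈ filter Q? ys
    to z∈ with ∈-map⁻ f z∈
    ... | x , x∈′ , refl = ∈-filter⁺ Q? (y∈ (f x)) (P⇒Q (proj₂ (∈-filter⁻ P? {xs = xs} x∈′)))
    from : ∀ {z} → z List.∈ filter Q? ys → z List.∈ map f (filter P? xs)
    from {z} z∈ = let Qz = proj₂ (∈-filter⁻ Q? {xs = ys} z∈) in
      subst (List._∈ map f (filter P? xs)) (fg Qz) (∈-map⁺ f (∈-filter⁺ P? (x∈ (g z)) (Q⇒P Qz)))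

  -- Every block has exactly one minimum, so the blocks of the minima form a duplicate-free list
  -- with the same members as the deduplicated block map.
  #blocks≡count : ∀ {n} (σ : NC n) → #blocks σ ≡ count (isMin? σ) (allFin n)
  #blocks≡count {n} σ = trans
    (Unique-length (deduplicate-! _≟ᵇ_ (toList (blocks σ)))
      (Unique-map inj (Unique.filter⁺ (isMin? σ) (Unique.allFin⁺ n))) to from)
    (length-map (block σ) (filter (isMin? σ) (allFin n)))
    where
    inj : ∀ {i j} → i List.∈ filter (isMin? σ) (allFin n) → j List.∈ filter (isMin? σ) (allFin n) →
          block σ i ≡ block σ j → i ≡ j
    inj i∈ j∈ eq = isMin-unique σ (proj₂ (∈-filter⁻ (isMin? σ) {xs = allFin n} i∈))
      (proj₂ (∈-filter⁻ (isMin? σ) {xs = allFin n} j∈)) (block≡⇒~ σ eq)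
    to : ∀ {V} → V List.∈ deduplicate _≟ᵇ_ (toList (blocks σ)) → V List.∈ blockMins σ
    to V∈ with Vec∈.∈-toList⁻ (∈-deduplicate⁻ _≟ᵇ_ (toList (blocks σ)) V∈)
    ... | V∈′ with VecAny.index V∈′ | VecAny.lookup-index V∈′
    ...   | i | refl = let q , min , i~q = block-min σ i in
      subst (List._∈ blockMins σ) (~⇒block≡ σ i~q)
        (∈-map⁺ (block σ) (∈-filter⁺ (isMin? σ) (∈-allFin q) min))
    from : ∀ {V} → V List.∈ blockMins σ → V List.∈ deduplicate _≟ᵇ_ (toList (blocks σ))
    from V∈ with ∈-map⁻ (block σ) V∈
    ... | i , _ , refl = ∈-deduplicate⁺ _≟ᵇ_ (Vec∈.∈-toList⁺ (Vec∈.∈-lookup i (blocks σ)))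

  -- The witness is the interval from q to the greatest element j of its block; the bound on m says
  -- that it stays inside the ground set.
  isMin⇒closed : ∀ {n} (σ : NC n) q → IsMin σ q → ∃ λ m → m < n ∸ toℕ q × Closed (toℕ q) (suc m) σ
  isMin⇒closed {n} σ q min = m , m+n≤o⇒m≤o∸n (suc m) (subst (_≤ n) (+-comm (toℕ q) (suc m)) q+1+m≤n) , closed
    where
    M = greatest (_~?_ σ q) (q , ~-refl σ)
    j = proj₁ M
    q~j = proj₁ (proj₂ M)
    m = toℕ j ∸ toℕ q
    q+1+m≡1+j : toℕ q + suc m ≡ suc (toℕ j)
    q+1+m≡1+j = trans (+-suc (toℕ q) m) (cong suc (m+[n∸m]≡n (min j q~j)))
    q+1+m≤n : toℕ q + suc m ≤ n
    q+1+m≤n = subst (_≤ n) (sym q+1+m≡1+j) (Fin.toℕ<n j)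
    -- An element of [q, j] in the block of something outside would cross the block of q and j.
    within : ∀ {i k} → toℕ q ≤ toℕ i → toℕ i ≤ toℕ j → σ ⊢ i ~ k → toℕ q ≤ toℕ k × toℕ k ≤ toℕ j
    within {i} {k} q≤i i≤j i~k with m≤n⇒m<n∨m≡n q≤i | m≤n⇒m<n∨m≡n i≤j
    ... | inj₂ q≡i | _ with refl ← Fin.toℕ-injective q≡i = min k i~k , proj₂ (proj₂ M) k i~k
    ... | inj₁ _   | inj₂ i≡j with refl ← Fin.toℕ-injective i≡j =
      min k (~-trans σ q~j i~k) , proj₂ (proj₂ M) k (~-trans σ q~j i~k)
    ... | inj₁ q<i | inj₁ i<j with Fin.<-cmp k q | Fin.<-cmp j k
    ...   | tri< k<q _ _ | _ = ⊥-elim (<⇒≱ k<q (min k (~-sym σ (~-nonCrossing σ k<q q<i i<j (~-sym σ i~k) q~j))))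
    ...   | _ | tri< j<k _ _ = ⊥-elim (<⇒≱ j<k (proj₂ (proj₂ M) k (~-trans σ (~-nonCrossing σ q<i i<j j<k q~j i~k) i~k)))
    ...   | tri≈ _ refl _ | _ = ≤-refl , min j q~j
    ...   | _ | tri≈ _ refl _ = min j q~j , ≤-refl
    ...   | tri> _ _ q<k | tri> _ _ k<j = <⇒≤ q<k , <⇒≤ k<j
    closed : Closed (toℕ q) (suc m) σ
    closed i (q≤i , i<) k i~k =
      let q≤k , k≤j = within q≤i (≤-pred (subst (toℕ i <_) q+1+m≡1+j i<)) i~k
      in q≤k , subst (toℕ k <_) (sym q+1+m≡1+j) (s≤s k≤j)

  closed⇒isMin : ∀ {n} (σ : NC n) q {m} → Closed (toℕ q) (suc m) σ → IsMin σ q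
  closed⇒isMin σ q {m} cl j q~j =
    proj₁ (cl q (≤-refl , subst (toℕ q <_) (sym (+-suc (toℕ q) m)) (s≤s (m≤m+n _ m))) j q~j)

  closed-∨⁻ : ∀ {n} {σ ρ : NC n} {p l} → Closed p l (σ ∨ ρ) → Closed p l σ × Closed p l ρ
  closed-∨⁻ {σ = σ} {ρ} cl =
    (λ i i∈ j i~j → cl i i∈ j (block-mono {σ = σ} {σ ∨ ρ} (proj₁ (∨-supremum σ ρ)) i i~j)) ,
    (λ i i∈ j i~j → cl i i∈ j (block-mono {σ = ρ} {σ ∨ ρ} (proj₁ (proj₂ (∨-supremum σ ρ))) i i~j))

  -- The partition into [p, p + l) and its complement bounds σ and ρ from above.
  closed-∨⁺ : ∀ {n} {σ ρ : NC n} {p l} → Closed p l σ → Closed p l ρ → Closed p l (σ ∨ ρ)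
  closed-∨⁺ {n} {σ} {ρ} {p} {l} clσ clρ i i∈ j i~j =
    proj₁ (T.~⁻ (∈-joinBlocks⁻ σ ρ i~j T.nonCrossing (below σ clσ) (below ρ clρ))) i∈
    where
    R : Rel (Fin n) 0ℓ
    R i j = (InRange p l i → InRange p l j) × (InRange p l j → InRange p l i)
    R-isEquivalence : IsEquivalence R
    R-isEquivalence = record { refl = id , id ; sym = λ (f , g) → g , f ; trans = λ (f , g) (f′ , g′) → f′ ∘ f , g ∘ g′ }
    R-nc : NonCrossing R
    R-nc a<b b<c c<d (a⇒c , c⇒a) (b⇒d , d⇒b) =
      (λ a∈ → ≤-trans (proj₁ a∈) (<⇒≤ a<b) , <-trans b<c (proj₂ (a⇒c a∈))) ,
      (λ b∈ → c⇒a (≤-trans (proj₁ b∈) (<⇒≤ b<c) , <-trans c<d (proj₂ (b⇒d b∈))))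
    module T = FromRelation R
      (λ i j → (inRange? p l i →-dec inRange? p l j) ×-dec (inRange? p l j →-dec inRange? p l i))
      R-isEquivalence R-nc
    below : ∀ τ → Closed p l τ → τ ≤ᴺ T.nonCrossing
    below τ cl i = i , λ {k} i~k → T.~⁺ ((λ i∈ → cl i i∈ k i~k) , (λ k∈ → cl k k∈ i (~-sym τ i~k)))

  -- Doubling the first element is a bijection onto the partitions with 0 ~ 1.

  module _ {k : ℕ} where
    private
      collapse : Fin (suc (suc k)) → Fin (suc k)
      collapse 0F       = 0F
      collapse (sucF i) = i

      collapse-nonCrossing : ∀ σ → NonCrossing (λ i j → σ ⊢ collapse i ~ collapse j)
      -- The only place where `collapse` fails to be strictly increasing: a = 0 and b = 1 have the
      -- same image, so reflexivity gives the conclusion.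
      collapse-nonCrossing σ {0F} {sucF 0F} _ _ _ _ _ = ~-refl σ
      collapse-nonCrossing σ {0F} {sucF (sucF b)} {sucF c} {sucF d} _ (s≤s b<c) (s≤s c<d) =
        ~-nonCrossing σ (s≤s z≤n) b<c c<d
      collapse-nonCrossing σ {sucF a} {sucF b} {sucF c} {sucF d} (s≤s a<b) (s≤s b<c) (s≤s c<d) =
        ~-nonCrossing σ a<b b<c c<d

      module D σ = Pullback collapse σ (collapse-nonCrossing σ)
      module U′ σ = Pullback (sucF {n = suc k}) σ (monotone-nonCrossing sucF s≤s σ)

    abstract
      double : NC (suc k) → NC (suc (suc k))
      double = D.nonCrossing

      double⁺ : ∀ σ {i j} → σ ⊢ collapse i ~ collapse j → double σ ⊢ i ~ j
      double⁺ = D.~⁺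

      double⁻ : ∀ σ {i j} → double σ ⊢ i ~ j → σ ⊢ collapse i ~ collapse j
      double⁻ = D.~⁻

      dropFirst : NC (suc (suc k)) → NC (suc k)
      dropFirst = U′.nonCrossing

      dropFirst⁺ : ∀ σ {i j} → σ ⊢ sucF i ~ sucF j → dropFirst σ ⊢ i ~ j
      dropFirst⁺ = U′.~⁺

      dropFirst⁻ : ∀ σ {i j} → dropFirst σ ⊢ i ~ j → σ ⊢ sucF i ~ sucF j
      dropFirst⁻ = U′.~⁻

    double-0~1 : ∀ σ → double σ ⊢ 0F ~ sucF 0F
    double-0~1 σ = double⁺ σ (~-refl σ)

    dropFirst-double : ∀ σ → dropFirst (double σ) ≡ σ
    dropFirst-double σ = ~-ext (λ _ _ → double⁻ σ ∘ dropFirst⁻ (double σ)) (λ _ _ → dropFirst⁺ (double σ) ∘ double⁺ σ)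

    double-dropFirst : ∀ (σ : NC (suc (suc k))) → σ ⊢ 0F ~ sucF 0F → double (dropFirst σ) ≡ σ
    double-dropFirst σ 0~1 = ~-ext
      (λ i j h → ~-trans σ (~collapse i) (~-trans σ (dropFirst⁻ σ (double⁻ (dropFirst σ) h)) (~-sym σ (~collapse j))))
      (λ i j h → double⁺ (dropFirst σ) (dropFirst⁺ σ (~-trans σ (~-sym σ (~collapse i)) (~-trans σ h (~collapse j)))))
      where
      ~collapse : ∀ i → σ ⊢ i ~ sucF (collapse i)
      ~collapse 0F       = 0~1
      ~collapse (sucF i) = ~-refl σ {sucF i}

    0~1⇒¬isMin : ∀ (σ : NC (suc (suc k))) → σ ⊢ 0F ~ sucF 0F → ¬ IsMin σ (sucF 0F)
    0~1⇒¬isMin σ 0~1 min = <⇒≱ {0} {1} (s≤s z≤n) (min 0F (~-sym σ {0F} {sucF 0F} 0~1))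

    ¬isMin⇒0~1 : ∀ (σ : NC (suc (suc k))) → ¬ IsMin σ (sucF 0F) → σ ⊢ 0F ~ sucF 0F
    ¬isMin⇒0~1 σ ¬min with _~?_ σ 0F (sucF 0F)
    ... | yes 0~1 = 0~1
    ... | no ¬0~1 = ⊥-elim (¬min λ { 0F 1~0 → ⊥-elim (¬0~1 (~-sym σ {sucF 0F} {0F} 1~0)) ; (sucF j) _ → s≤s z≤n })

  -- Sums over l + r = s.

  antidiagonal : (ℕ → ℕ → ℕ) → ℕ → ℕ
  antidiagonal F zero    = F 0 0
  antidiagonal F (suc s) = F 0 (suc s) + antidiagonal (λ l r → F (suc l) r) s

  antidiagonal-cong : ∀ {F G} s → (∀ l r → l + r ≡ s → F l r ≡ G l r) → antidiagonal F s ≡ antidiagonal G s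
  antidiagonal-cong zero    F≡G = F≡G 0 0 refl
  antidiagonal-cong (suc s) F≡G = cong₂ _+_ (F≡G 0 (suc s) refl)
    (antidiagonal-cong s λ l r eq → F≡G (suc l) r (cong suc eq))

  antidiagonal-last : ∀ F s → antidiagonal F (suc s) ≡ antidiagonal (λ l r → F l (suc r)) s + F (suc s) 0
  antidiagonal-last F zero    = refl
  antidiagonal-last F (suc s) = trans (cong (F 0 (suc (suc s)) +_) (antidiagonal-last (λ l r → F (suc l) r) s))
    (sym (+-assoc (F 0 (suc (suc s))) _ _))

  antidiagonal-swap : ∀ F s → antidiagonal F s ≡ antidiagonal (λ l r → F r l) s
  antidiagonal-swap F zero    = refl
  antidiagonal-swap F (suc s) = trans (antidiagonal-last F s)
    (trans (+-comm (antidiagonal (λ l r → F l (suc r)) s) (F (suc s) 0))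
    (cong (F (suc s) 0 +_) (antidiagonal-swap (λ l r → F l (suc r)) s)))

  antidiagonal-+ : ∀ F G s → antidiagonal (λ l r → F l r + G l r) s ≡ antidiagonal F s + antidiagonal G s
  antidiagonal-+ F G zero    = refl
  antidiagonal-+ F G (suc s) = trans
    (cong (F 0 (suc s) + G 0 (suc s) +_) (antidiagonal-+ (λ l r → F (suc l) r) (λ l r → G (suc l) r) s))
    (interchange (F 0 (suc s)) _ _ _)
    where
    interchange : ∀ a b c d → a + b + (c + d) ≡ a + c + (b + d)
    interchange = solve-∀

  antidiagonal-*ˡ : ∀ c F s → antidiagonal (λ l r → c * F l r) s ≡ c * antidiagonal F s
  antidiagonal-*ˡ c F zero    = refl
  antidiagonal-*ˡ c F (suc s) = trans (cong (c * F 0 (suc s) +_) (antidiagonal-*ˡ c (λ l r → F (suc l) r) s))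
    (sym (*-distribˡ-+ c (F 0 (suc s)) _))

  antidiagonal-const : ∀ c s → antidiagonal (λ _ _ → c) s ≡ suc s * c
  antidiagonal-const c zero    = sym (+-identityʳ c)
  antidiagonal-const c (suc s) = cong (c +_) (antidiagonal-const c s)

  antidiagonal-zero : ∀ s → antidiagonal (λ _ _ → 0) s ≡ 0
  antidiagonal-zero s = trans (antidiagonal-const 0 s) (*-zeroʳ (suc s))

  -- Both sides run over p + l + r = s. The induction splits off the terms with r = 0, which form a
  -- plain antidiagonal sum in p and l that `antidiagonal-swap` can turn around.
  antidiagonal-exchange : ∀ (H : ℕ → ℕ → ℕ → ℕ) s →
    antidiagonal (λ p t → antidiagonal (λ l r → H p l r) t) s ≡
    antidiagonal (λ l t → antidiagonal (λ p r → H p l r) t) s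
  antidiagonal-exchange H zero    = refl
  antidiagonal-exchange H (suc s) = trans (peel H) (trans
    (cong₂ _+_ (antidiagonal-exchange (λ p l r → H p l (suc r)) s) (antidiagonal-swap (λ p l → H p l 0) (suc s)))
    (sym (peel (λ l p r → H p l r))))
    where
    open ≡-Reasoning
    peel : ∀ (H : ℕ → ℕ → ℕ → ℕ) → antidiagonal (λ p t → antidiagonal (H p) t) (suc s) ≡
      antidiagonal (λ p t → antidiagonal (λ l r → H p l (suc r)) t) s + antidiagonal (λ p l → H p l 0) (suc s)
    peel H = begin
      antidiagonal (λ p t → antidiagonal (H p) t) (suc s)
        ≡⟨ antidiagonal-last (λ p t → antidiagonal (H p) t) s ⟩
      antidiagonal (λ p t → antidiagonal (H p) (suc t)) s + H (suc s) 0 0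
        ≡⟨ cong (_+ H (suc s) 0 0) (antidiagonal-cong s λ p t _ → antidiagonal-last (H p) t) ⟩
      antidiagonal (λ p t → antidiagonal (λ l r → H p l (suc r)) t + H p (suc t) 0) s + H (suc s) 0 0
        ≡⟨ cong (_+ H (suc s) 0 0) (antidiagonal-+ _ (λ p t → H p (suc t) 0) s) ⟩
      antidiagonal (λ p t → antidiagonal (λ l r → H p l (suc r)) t) s + antidiagonal (λ p t → H p (suc t) 0) s + H (suc s) 0 0
        ≡⟨ +-assoc (antidiagonal (λ p t → antidiagonal (λ l r → H p l (suc r)) t) s) _ _ ⟩
      antidiagonal (λ p t → antidiagonal (λ l r → H p l (suc r)) t) s + (antidiagonal (λ p t → H p (suc t) 0) s + H (suc s) 0 0)
        ≡⟨ cong (antidiagonal (λ p t → antidiagonal (λ l r → H p l (suc r)) t) s +_) (antidiagonal-last (λ p l → H p l 0) s) ⟨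
      antidiagonal (λ p t → antidiagonal (λ l r → H p l (suc r)) t) s + antidiagonal (λ p l → H p l 0) (suc s) ∎

  -- Sums over lists.

  ∑ : ∀ {A : Set} → List A → (A → ℕ) → ℕ
  ∑ []       f = 0
  ∑ (x ∷ xs) f = f x + ∑ xs f

  ∑-cong : ∀ {A : Set} (xs : List A) {f g : A → ℕ} → (∀ x → f x ≡ g x) → ∑ xs f ≡ ∑ xs g
  ∑-cong []       f≡g = refl
  ∑-cong (x ∷ xs) f≡g = cong₂ _+_ (f≡g x) (∑-cong xs f≡g)

  ∑-antidiagonal : ∀ {A : Set} (xs : List A) (F : A → ℕ → ℕ → ℕ) s →
    ∑ xs (λ x → antidiagonal (F x) s) ≡ antidiagonal (λ l r → ∑ xs λ x → F x l r) s
  ∑-antidiagonal []       F s = sym (antidiagonal-zero s)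
  ∑-antidiagonal (x ∷ xs) F s = trans (cong (antidiagonal (F x) s +_) (∑-antidiagonal xs F s))
    (sym (antidiagonal-+ (F x) (λ l r → ∑ xs λ x → F x l r) s))

  ∑-one : ∀ {A : Set} (xs : List A) → ∑ xs (λ _ → 1) ≡ length xs
  ∑-one []       = refl
  ∑-one (x ∷ xs) = cong suc (∑-one xs)

  ⟦_⟧ : ∀ {A : Set} → Dec A → ℕ
  ⟦ yes _ ⟧ = 1
  ⟦ no  _ ⟧ = 0

  ⟦⟧-yes : ∀ {A : Set} (A? : Dec A) → A → ⟦ A? ⟧ ≡ 1
  ⟦⟧-yes (yes _) a = refl
  ⟦⟧-yes (no ¬a) a = ⊥-elim (¬a a)

  ⟦⟧-no : ∀ {A : Set} (A? : Dec A) → ¬ A → ⟦ A? ⟧ ≡ 0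
  ⟦⟧-no (yes a) ¬a = ⊥-elim (¬a a)
  ⟦⟧-no (no _)  ¬a = refl

  ⟦⟧-cong : ∀ {A B : Set} (A? : Dec A) (B? : Dec B) → (A → B) → (B → A) → ⟦ A? ⟧ ≡ ⟦ B? ⟧
  ⟦⟧-cong (yes a) B? f g = sym (⟦⟧-yes B? (f a))
  ⟦⟧-cong (no ¬a) B? f g = sym (⟦⟧-no B? (¬a ∘ g))

  ⟦⟧-¬ : ∀ {A : Set} (A? : Dec A) → ⟦ A? ⟧ + ⟦ ¬? A? ⟧ ≡ 1
  ⟦⟧-¬ (yes _) = refl
  ⟦⟧-¬ (no _)  = refl

  count-∷ : ∀ {A : Set} {P : A → Set} (P? : U.Decidable P) x xs → count P? (x ∷ xs) ≡ ⟦ P? x ⟧ + count P? xs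
  count-∷ P? x xs with P? x
  ... | yes _ = refl
  ... | no _  = refl

  count≡∑ : ∀ {A : Set} {P : A → Set} (P? : U.Decidable P) xs → count P? xs ≡ ∑ xs λ x → ⟦ P? x ⟧
  count≡∑ P? []       = refl
  count≡∑ P? (x ∷ xs) = trans (count-∷ P? x xs) (cong (⟦ P? x ⟧ +_) (count≡∑ P? xs))

  count-cartesianProduct : ∀ {A B : Set} {Q : B → Set} (Q? : U.Decidable Q) (xs : List A) ys →
    count {P = λ (z : A × B) → Q (proj₂ z)} (λ z → Q? (proj₂ z)) (cartesianProduct xs ys) ≡ length xs * count Q? ys
  count-cartesianProduct Q? []       ys = refl
  count-cartesianProduct Q? (x ∷ xs) ys = trans
    (trans (cong length (filter-++ (λ z → Q? (proj₂ z)) (map (x ,_) ys) (cartesianProduct xs ys)))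
           (length-++ (filter (λ z → Q? (proj₂ z)) (map (x ,_) ys))))
    (cong₂ _+_ (row ys) (count-cartesianProduct Q? xs ys))
    where
    row : ∀ ys → count (λ z → Q? (proj₂ z)) (map (x ,_) ys) ≡ count Q? ys
    row []       = refl
    row (y ∷ ys) = trans (count-∷ (λ z → Q? (proj₂ z)) (x , y) (map (x ,_) ys))
      (trans (cong (⟦ Q? y ⟧ +_) (row ys)) (sym (count-∷ Q? y ys)))

  -- The greatest element of a bounded decidable set

  module _ {P : ℕ → Set} (P? : U.Decidable P) where

    -- The search runs through l + 1, ..., l + r. With l + r = s fixed, `last?` therefore recognises
    -- the greatest number up to s that satisfies P.
    Later : ℕ → ℕ → Set
    Later l r = ∃ λ m → m < r × P (l + suc m)

    later? : ∀ l r → Dec (Later l r)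
    later? l r = anyUpTo? (λ m → P? (l + suc m)) r

    last? : ∀ l r → Dec (P l × ¬ Later l r)
    last? l r = P? l ×-dec ¬? (later? l r)

  antidiagonal-last?-none : ∀ {P : ℕ → Set} (P? : U.Decidable P) s → (∀ m → m ≤ s → ¬ P m) →
    antidiagonal (λ l r → ⟦ last? P? l r ⟧) s ≡ 0
  antidiagonal-last?-none P? zero    none = ⟦⟧-no (last? P? 0 0) λ (p , _) → none 0 z≤n p
  antidiagonal-last?-none P? (suc s) none = cong₂ _+_ (⟦⟧-no (last? P? 0 (suc s)) λ (p , _) → none 0 z≤n p)
    (antidiagonal-last?-none (P? ∘ suc) s λ m m≤s → none (suc m) (s≤s m≤s))

  -- A nonempty set of numbers up to s has exactly one greatest element. The induction shifts P by
  -- one: 0 is the greatest precisely if the shifted set is empty.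
  antidiagonal-last?-one : ∀ {P : ℕ → Set} (P? : U.Decidable P) s → ∃ (λ m → m ≤ s × P m) →
    antidiagonal (λ l r → ⟦ last? P? l r ⟧) s ≡ 1
  antidiagonal-last?-one P? zero    (zero , _ , p) = ⟦⟧-yes (last? P? 0 0) (p , λ ())
  antidiagonal-last?-one {P} P? (suc s) w = go w (anyUpTo? (P? ∘ suc) (suc s))
    where
    go : ∃ (λ m → m ≤ suc s × P m) → Dec (∃ λ m → m < suc s × P (suc m)) →
         antidiagonal (λ l r → ⟦ last? P? l r ⟧) (suc s) ≡ 1
    go _ (yes (k , s≤s k≤s , pk)) = cong₂ _+_
      (⟦⟧-no (last? P? 0 (suc s)) λ (_ , ¬later) → ¬later (k , s≤s k≤s , pk))
      (antidiagonal-last?-one (P? ∘ suc) s (k , k≤s , pk))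
    go (suc m , s≤s m≤s , p) (no ¬w) = ⊥-elim (¬w (m , s≤s m≤s , p))
    go (zero , _ , p)        (no ¬w) = cong₂ _+_ (⟦⟧-yes (last? P? 0 (suc s)) (p , ¬w))
      (antidiagonal-last?-none (P? ∘ suc) s λ k k≤s pk → ¬w (k , s≤s k≤s , pk))

  -- C p l x says that [p, p + l) is a closed interval of x; closed intervals can be cut out and inserted freely.

  record Species (X : ℕ → Set) : Set₁ where
    field
      elements    : ∀ n → List (X n)
      unique      : ∀ n → Unique (elements n)
      complete    : ∀ {n} (x : X n) → x List.∈ elements n
      C           : ∀ {n} → ℕ → ℕ → X n → Set
      C?          : ∀ {n} p l (x : X n) → Dec (C p l x)
      C-empty     : ∀ {n} p (x : X n) → C p 0 x
      C-full      : ∀ {n} (x : X n) → C 0 n x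
      join        : ∀ p l r → X l → X (p + r) → X (p + (l + r))
      inside      : ∀ p l r → X (p + (l + r)) → X l
      outside     : ∀ p l r → X (p + (l + r)) → X (p + r)
      join-C      : ∀ p l r y z → C p l (join p l r y z)
      join-cut    : ∀ p l r {x} → C p l x → join p l r (inside p l r x) (outside p l r x) ≡ x
      inside-join : ∀ p l r y z → inside p l r (join p l r y z) ≡ y
      outside-join : ∀ p l r y z → outside p l r (join p l r y z) ≡ z
      C-outside⁺  : ∀ p l r {m} x → C p (l + m) x → C p m (outside p l r x)
      C-outside⁻  : ∀ p l r {m} x → C p l x → C p m (outside p l r x) → C p (l + m) x

  module Counting {X : ℕ → Set} (S : Species X) where
    open Species S

    # : ℕ → ℕ
    # n = length (elements n)

    Start : ∀ {n} → ℕ → ℕ → X n → Set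
    Start p r x = ∃ λ m → m < r × C p (suc m) x

    start? : ∀ {n} p r (x : X n) → Dec (Start p r x)
    start? p r x = anyUpTo? (λ m → C? p (suc m) x) r

    -- Counts the possible outer parts left by cutting out the longest closed interval from p; a
    -- further start at p would have extended that interval.
    good : ℕ → ℕ → ℕ
    good p r = count (λ x → ¬? (start? p r x)) (elements (p + r))

    starts : ∀ {n} → X (suc n) → ℕ
    starts {n} x = antidiagonal (λ q r → ⟦ start? q (suc r) x ⟧) n

    module _ (p l r : ℕ) where
      -- By `C-outside⁺` and `C-outside⁻`, maximality of the interval becomes the absence of a start
      -- at p in the outer object, while the inner object is arbitrary; hence the product.
      count-last : count (λ x → last? (λ l → C? p l x) l r) (elements (p + (l + r))) ≡ # l * good p r
      count-last = trans
        (count-bijection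
          (λ x → last? (λ l → C? p l x) l r) (λ z → ¬? (start? p r (proj₂ z)))
          (unique (p + (l + r))) (Unique.cartesianProduct⁺ (unique l) (unique (p + r)))
          complete (λ (y , z) → ∈-cartesianProduct⁺ (complete y) (complete z))
          (λ x → inside p l r x , outside p l r x) (λ (y , z) → join p l r y z)
          (λ {x} (c , ¬later) (m , m<r , d) → ¬later (m , m<r , C-outside⁻ p l r x c d))
          (λ {(y , z)} ¬start → join-C p l r y z , λ (m , m<r , d) → ¬start (m , m<r ,
            subst (C p (suc m)) (outside-join p l r y z) (C-outside⁺ p l r (join p l r y z) d)))
          (λ (c , _) → join-cut p l r c)
          (λ {(y , z)} _ → cong₂ _,_ (inside-join p l r y z) (outside-join p l r y z)))
        (count-cartesianProduct (λ x → ¬? (start? p r x)) (elements l) (elements (p + r)))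

    #-decompose : ∀ p s → # (p + s) ≡ antidiagonal (λ l r → # l * good p r) s
    #-decompose p s = begin
      # (p + s)
        ≡⟨ ∑-one (elements (p + s)) ⟨
      ∑ (elements (p + s)) (λ _ → 1)
        -- The empty interval is closed, so each x has a longest closed interval from p, and the
        -- indicators of its possible lengths add up to 1.
        ≡⟨ ∑-cong (elements (p + s)) (λ x → antidiagonal-last?-one (λ l → C? p l x) s (0 , z≤n , C-empty p x)) ⟨
      ∑ (elements (p + s)) (λ x → antidiagonal (λ l r → ⟦ last? (λ l → C? p l x) l r ⟧) s)
        ≡⟨ ∑-antidiagonal (elements (p + s)) (λ x l r → ⟦ last? (λ l → C? p l x) l r ⟧) s ⟩
      antidiagonal (λ l r → ∑ (elements (p + s)) λ x → ⟦ last? (λ l → C? p l x) l r ⟧) s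
        ≡⟨ antidiagonal-cong s (λ { l r refl → trans (sym (count≡∑ (λ x → last? (λ l → C? p l x) l r) (elements (p + s))))
                                                 (count-last p l r) }) ⟩
      antidiagonal (λ l r → # l * good p r) s ∎
      where open ≡-Reasoning

    -- Σ (n + 1 - |x|), where |x| is the number of starting points of closed intervals of x; for noncrossing partitions
    -- n + 1 - |x| is the number of blocks of the Kreweras complement.
    goods : ℕ → ℕ
    goods zero    = 0
    goods (suc k) = antidiagonal (λ p r → good (suc p) r) k

    -- For each of the n positions from 1 to n, the sum over the length of the interval cut out
    -- there collapses to the number of all objects of size n. The term k = 0 must not contribute,
    -- which is why `goods 0` is 0 although n + 1 - |x| would be 1 at n = 0.
    goods-convolution : ∀ n → antidiagonal (λ l k → # l * goods k) n ≡ n * # n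
    goods-convolution zero    = *-zeroʳ (# 0)
    goods-convolution (suc n) = begin
      antidiagonal (λ l k → # l * goods k) (suc n)
        ≡⟨ antidiagonal-last (λ l k → # l * goods k) n ⟩
      antidiagonal (λ l k → # l * goods (suc k)) n + # (suc n) * 0
        ≡⟨ trans (cong (antidiagonal (λ l k → # l * goods (suc k)) n +_) (*-zeroʳ (# (suc n)))) (+-identityʳ _) ⟩
      antidiagonal (λ l k → # l * antidiagonal (λ p r → good (suc p) r) k) n
        ≡⟨ antidiagonal-cong n (λ l k _ → antidiagonal-*ˡ (# l) (λ p r → good (suc p) r) k) ⟨
      antidiagonal (λ l k → antidiagonal (λ p r → # l * good (suc p) r) k) n
        ≡⟨ antidiagonal-exchange (λ l p r → # l * good (suc p) r) n ⟩
      antidiagonal (λ p k → antidiagonal (λ l r → # l * good (suc p) r) k) n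
        ≡⟨ antidiagonal-cong n (λ p k _ → #-decompose (suc p) k) ⟨
      antidiagonal (λ p k → # (suc (p + k))) n
        ≡⟨ antidiagonal-cong n (λ p k eq → cong (# ∘ suc) eq) ⟩
      antidiagonal (λ p k → # (suc n)) n
        ≡⟨ antidiagonal-const (# (suc n)) n ⟩
      suc n * # (suc n) ∎
      where open ≡-Reasoning

    private
      started : ℕ → ℕ → ℕ
      started q r = count (start? q r) (elements (q + r))

      started+good : ∀ q r → started q r + good q r ≡ # (q + r)
      started+good q r = go (elements (q + r))
        where
        go : ∀ xs → count (start? q r) xs + count (λ x → ¬? (start? q r x)) xs ≡ length xs
        go []       = refl
        go (x ∷ xs) rewrite count-∷ (start? q r) x xs | count-∷ (λ x → ¬? (start? q r x)) x xs =
          trans (interchange ⟦ start? q r x ⟧ _ _ _) (cong₂ _+_ (⟦⟧-¬ (start? q r x)) (go xs))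
          where
          interchange : ∀ a b c d → a + b + (c + d) ≡ a + c + (b + d)
          interchange = solve-∀

      count-none : ∀ {A : Set} {P : A → Set} (P? : U.Decidable P) xs → (∀ x → ¬ P x) → count P? xs ≡ 0
      count-none P? []       ¬p = refl
      count-none P? (x ∷ xs) ¬p = trans (count-∷ P? x xs) (cong₂ _+_ (⟦⟧-no (P? x) (¬p x)) (count-none P? xs ¬p))

    -- Each object divides the positions 0, ..., k + 1 into starts and non-starts. `starts` omits
    -- the last position, where no nonempty interval fits, and `goods` omits position 0, where the
    -- full interval starts; restoring these zero terms gives two sums over the same range.
    starts+goods : ∀ k → ∑ (elements (suc k)) starts + goods (suc k) ≡ suc (suc k) * # (suc k)
    starts+goods k = begin
      ∑ (elements (suc k)) starts + goods (suc k)
        ≡⟨ cong₂ _+_ (trans starts≡ (sym (+-identityʳ _))) (sym (+-identityˡ _)) ⟩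
      antidiagonal (λ q r → started q (suc r)) k + 0 + (0 + goods (suc k))
        ≡⟨ cong₂ (λ u v → antidiagonal (λ q r → started q (suc r)) k + u + (v + goods (suc k)))
             (count-none (start? (suc k) 0) (elements (suc k + 0)) λ _ ())
             (count-none (λ x → ¬? (start? 0 (suc k) x)) (elements (suc k)) λ x ¬start → ¬start (k , ≤-refl , C-full x)) ⟨
      antidiagonal (λ q r → started q (suc r)) k + started (suc k) 0 + (good 0 (suc k) + goods (suc k))
        ≡⟨ cong (_+ antidiagonal good (suc k)) (antidiagonal-last started k) ⟨
      antidiagonal started (suc k) + antidiagonal good (suc k)
        ≡⟨ antidiagonal-+ started good (suc k) ⟨
      antidiagonal (λ q r → started q r + good q r) (suc k)
        ≡⟨ antidiagonal-cong (suc k) (λ q r eq → trans (started+good q r) (cong # eq)) ⟩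
      antidiagonal (λ _ _ → # (suc k)) (suc k)
        ≡⟨ antidiagonal-const (# (suc k)) (suc k) ⟩
      suc (suc k) * # (suc k) ∎
      where
      open ≡-Reasoning
      starts≡ : ∑ (elements (suc k)) starts ≡ antidiagonal (λ q r → started q (suc r)) k
      starts≡ = trans (∑-antidiagonal (elements (suc k)) (λ x q r → ⟦ start? q (suc r) x ⟧) k)
        (antidiagonal-cong k λ { q r refl → trans
          (sym (count≡∑ (start? q (suc r)) (elements (suc (q + r)))))
          (cong (λ n → count (start? q (suc r)) (elements n)) (sym (+-suc q r))) })

  -- Non-crossing partitions and pairs of them as species

  open Species

  ncSpecies : Species NC
  ncSpecies = record
    { elements     = allNC
    ; unique       = allNC-unique
    ; complete     = ∈-allNC
    ; C            = Closed
    ; C?           = closed?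
    ; C-empty      = λ p σ i (p≤i , i<p+0) → ⊥-elim (<⇒≱ i<p+0 (subst (_≤ toℕ i) (sym (+-identityʳ p)) p≤i))
    ; C-full       = λ σ i _ j _ → z≤n , Fin.toℕ<n j
    ; join         = glue
    ; inside       = cutInner
    ; outside      = cutOuter
    ; join-C       = glue-closed
    ; join-cut     = λ p l r {σ} → glue-cut p l r σ
    ; inside-join  = cutInner-glue
    ; outside-join = cutOuter-glue
    ; C-outside⁺   = λ p l r σ → closed-cut⁺ p l r σ
    ; C-outside⁻   = λ p l r σ → closed-cut⁻ p l r σ
    }

  -- For pairs of partitions the closed intervals are those of the join, by `closed-∨⁻` and
  -- `closed-∨⁺`; their starts thus count the blocks of σ ∨ ρ.
  pairSpecies : ∀ {X} → Species X → Species (λ n → X n × X n)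
  pairSpecies S = record
    { elements     = λ n → cartesianProduct (elements S n) (elements S n)
    ; unique       = λ n → Unique.cartesianProduct⁺ (unique S n) (unique S n)
    ; complete     = λ (x , y) → ∈-cartesianProduct⁺ (complete S x) (complete S y)
    ; C            = λ p l (x , y) → C S p l x × C S p l y
    ; C?           = λ p l (x , y) → C? S p l x ×-dec C? S p l y
    ; C-empty      = λ p (x , y) → C-empty S p x , C-empty S p y
    ; C-full       = λ (x , y) → C-full S x , C-full S y
    ; join         = λ p l r (x , y) (z , w) → join S p l r x z , join S p l r y w
    ; inside       = λ p l r (x , y) → inside S p l r x , inside S p l r y
    ; outside      = λ p l r (x , y) → outside S p l r x , outside S p l r y
    ; join-C       = λ p l r (x , y) (z , w) → join-C S p l r x z , join-C S p l r y w
    ; join-cut     = λ p l r (c , d) → cong₂ _,_ (join-cut S p l r c) (join-cut S p l r d)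
    ; inside-join  = λ p l r (x , y) (z , w) → cong₂ _,_ (inside-join S p l r x z) (inside-join S p l r y w)
    ; outside-join = λ p l r (x , y) (z , w) → cong₂ _,_ (outside-join S p l r x z) (outside-join S p l r y w)
    ; C-outside⁺   = λ p l r (x , y) (c , d) → C-outside⁺ S p l r x c , C-outside⁺ S p l r y d
    ; C-outside⁻   = λ p l r (x , y) (c , d) (c′ , d′) → C-outside⁻ S p l r x c c′ , C-outside⁻ S p l r y d d′
    }

  module One = Counting ncSpecies
  module Two = Counting (pairSpecies ncSpecies)

  count-tabulate : ∀ {A : Set} {P : A → Set} (P? : U.Decidable P) n (g : Fin (suc n) → A) (f : ℕ → ℕ → ℕ) →
    (∀ i → ⟦ P? (g i) ⟧ ≡ f (toℕ i) (suc n ∸ toℕ i)) → count P? (List.tabulate g) ≡ antidiagonal (λ q r → f q (suc r)) n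
  count-tabulate P? zero    g f eq = trans (count-∷ P? (g 0F) []) (trans (+-identityʳ _) (eq 0F))
  count-tabulate P? (suc n) g f eq = trans (count-∷ P? (g 0F) (List.tabulate (g ∘ sucF)))
    (cong₂ _+_ (eq 0F) (count-tabulate P? n (g ∘ sucF) (f ∘ suc) (eq ∘ sucF)))

  #blocks≡starts₁ : ∀ {n} (σ : NC (suc n)) → #blocks σ ≡ One.starts σ
  #blocks≡starts₁ {n} σ = trans (#blocks≡count σ)
    (count-tabulate (isMin? σ) n id (λ q r → ⟦ One.start? q r σ ⟧) λ q →
      ⟦⟧-cong (isMin? σ q) (One.start? (toℕ q) (suc n ∸ toℕ q) σ) (isMin⇒closed σ q)
        (λ (_ , _ , cl) → closed⇒isMin σ q cl))

  #blocks≡starts₂ : ∀ {n} (σ ρ : NC (suc n)) → #blocks (σ ∨ ρ) ≡ Two.starts (σ , ρ)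
  #blocks≡starts₂ {n} σ ρ = trans (#blocks≡count (σ ∨ ρ))
    (count-tabulate (isMin? (σ ∨ ρ)) n id (λ q r → ⟦ Two.start? q r (σ , ρ) ⟧) λ q →
      ⟦⟧-cong (isMin? (σ ∨ ρ) q) (Two.start? (toℕ q) (suc n ∸ toℕ q) (σ , ρ))
        (λ min → let m , m< , cl = isMin⇒closed (σ ∨ ρ) q min in m , m< , closed-∨⁻ {σ = σ} {ρ} cl)
        (λ (_ , _ , cl₁ , cl₂) → closed⇒isMin (σ ∨ ρ) q (closed-∨⁺ {σ = σ} {ρ} cl₁ cl₂)))

  length-cartesianProduct : ∀ {A B : Set} (xs : List A) (ys : List B) → length (cartesianProduct xs ys) ≡ length xs * length ys
  length-cartesianProduct []       ys = refl
  length-cartesianProduct (x ∷ xs) ys = trans (length-++ (map (x ,_) ys))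
    (cong₂ _+_ (length-map (x ,_) ys) (length-cartesianProduct xs ys))

  allPairs : ∀ n → List (NC n × NC n)
  allPairs n = cartesianProduct (allNC n) (allNC n)

  -- Catalan numbers and the convolution identities

  abstract

    -- Opaque, so that later computations cannot unfold the enumeration of all block maps; `cat-0`
    -- and `cat-1` fix the initial values.
    cat : ℕ → ℕ
    cat n = length (allNC n)

    length-allNC : ∀ n → length (allNC n) ≡ cat n
    length-allNC n = refl

    cat-0 : cat 0 ≡ 1
    cat-0 = refl

    cat-1 : cat 1 ≡ 1
    cat-1 = refl

    length-allPairs : ∀ n → length (allPairs n) ≡ cat n * cat n
    length-allPairs n = length-cartesianProduct (allNC n) (allNC n)

    -- The element 1 starts no closed interval exactly if it shares the block of 0, and dropping 0
    -- then leaves an arbitrary partition. For r = 0 the position 1 lies beyond the ground set, and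
    -- the single partition of one point is counted.
    good-1 : ∀ r → One.good 1 r ≡ cat r
    good-1 zero    = refl
    good-1 (suc k) = trans
      (count-bijection (λ σ → ¬? (One.start? 1 (suc k) σ)) (λ _ → yes tt)
        (allNC-unique (suc (suc k))) (allNC-unique (suc k)) ∈-allNC ∈-allNC dropFirst double
        (λ _ → tt)
        (λ {σ} _ (m , _ , cl) → 0~1⇒¬isMin (double σ) (double-0~1 σ) (closed⇒isMin (double σ) (sucF 0F) cl))
        (λ {σ} ¬start → double-dropFirst σ (¬isMin⇒0~1 σ (¬start ∘ isMin⇒closed σ (sucF 0F))))
        (λ {σ} _ → dropFirst-double σ))
      (cong length (filter-all (λ _ → yes tt) (All.universal (λ _ → tt) (allNC (suc k)))))

    cat-convolution : ∀ n → cat (suc n) ≡ antidiagonal (λ l r → cat l * cat r) n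
    cat-convolution n = trans (One.#-decompose 1 n)
      (antidiagonal-cong n λ l r _ → cong (cat l *_) (good-1 r))

    goods₁ : ℕ → ℕ
    goods₁ = One.goods

    goods₁-0 : goods₁ 0 ≡ 0
    goods₁-0 = refl

    goods₁-convolution : ∀ n → antidiagonal (λ l k → cat l * goods₁ k) n ≡ n * cat n
    goods₁-convolution = One.goods-convolution

    ∑#blocks+goods₁ : ∀ n → ∑ (allNC (suc n)) #blocks + goods₁ (suc n) ≡ (2 + n) * cat (suc n)
    ∑#blocks+goods₁ n = trans (cong (_+ goods₁ (suc n)) (∑-cong (allNC (suc n)) #blocks≡starts₁)) (One.starts+goods n)

    goods₂ : ℕ → ℕ
    goods₂ = Two.goods

    goods₂-convolution : ∀ n → antidiagonal (λ l k → cat l * cat l * goods₂ k) n ≡ n * (cat n * cat n)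
    goods₂-convolution n = trans
      (antidiagonal-cong n λ l k _ → cong (_* goods₂ k) (sym (length-allPairs l)))
      (trans (Two.goods-convolution n) (cong (n *_) (length-allPairs n)))

    ∑#blocks∨+goods₂ : ∀ n → ∑ (allPairs (suc n)) (λ (σ , ρ) → #blocks (σ ∨ ρ)) + goods₂ (suc n) ≡
      (2 + n) * (cat (suc n) * cat (suc n))
    ∑#blocks∨+goods₂ n = trans
      (cong (_+ goods₂ (suc n)) (∑-cong (allPairs (suc n)) λ (σ , ρ) → #blocks≡starts₂ σ ρ))
      (trans (Two.starts+goods n) (cong ((2 + n) *_) (length-allPairs (suc n))))

  private
    -- Symmetrising in l and r replaces the weight 2 (l + 1) by (l + 1) + (r + 1) = n + 2.
    weighted : ∀ n → 2 * antidiagonal (λ l r → suc l * (cat l * cat r)) n ≡ (2 + n) * cat (suc n)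
    weighted n = begin
      2 * W
        ≡⟨ cong (W +_) (trans (+-identityʳ W) (antidiagonal-swap (λ l r → suc l * (cat l * cat r)) n)) ⟩
      W + antidiagonal (λ l r → suc r * (cat r * cat l)) n
        ≡⟨ antidiagonal-+ _ _ n ⟨
      antidiagonal (λ l r → suc l * (cat l * cat r) + suc r * (cat r * cat l)) n
        ≡⟨ antidiagonal-cong n (λ { l r refl → collect l r (cat l) (cat r) }) ⟩
      antidiagonal (λ l r → (2 + n) * (cat l * cat r)) n
        ≡⟨ antidiagonal-*ˡ (2 + n) (λ l r → cat l * cat r) n ⟩
      (2 + n) * antidiagonal (λ l r → cat l * cat r) n
        ≡⟨ cong ((2 + n) *_) (cat-convolution n) ⟨
      (2 + n) * cat (suc n) ∎
      where
      open ≡-Reasoning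
      W = antidiagonal (λ l r → suc l * (cat l * cat r)) n
      collect : ∀ l r a b → suc l * (a * b) + suc r * (b * a) ≡ (2 + (l + r)) * (a * b)
      collect = solve-∀

  -- Extracts the first-order recurrence from the quadratic one. In `weighted (suc n)` the induction
  -- hypothesis replaces (l + 2) `cat (suc l)` by (4l + 2) `cat l`, which leads back to the weighted
  -- and the plain convolution one size lower.
  cat-recurrence : ∀ n → (2 + n) * cat (suc n) ≡ (2 + 4 * n) * cat n
  cat-recurrence = <-rec (λ n → (2 + n) * cat (suc n) ≡ (2 + 4 * n) * cat n) step
    where
    open ≡-Reasoning
    step : ∀ n → (∀ {m} → m < n → (2 + m) * cat (suc m) ≡ (2 + 4 * m) * cat m) →
           (2 + n) * cat (suc n) ≡ (2 + 4 * n) * cat n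
    step zero    _   = cong (2 *_) (trans cat-1 (sym cat-0))
    step (suc n) rec = begin
      (3 + n) * cat (2 + n)
        ≡⟨ weighted (suc n) ⟨
      2 * (1 * (cat 0 * cat (suc n)) + antidiagonal (λ l r → (2 + l) * (cat (suc l) * cat r)) n)
        ≡⟨ cong (λ u → 2 * (1 * (u * cat (suc n)) + antidiagonal (λ l r → (2 + l) * (cat (suc l) * cat r)) n)) cat-0 ⟩
      2 * (1 * (1 * cat (suc n)) + antidiagonal (λ l r → (2 + l) * (cat (suc l) * cat r)) n)
        ≡⟨ cong (λ u → 2 * (1 * (1 * cat (suc n)) + u)) (antidiagonal-cong n λ l r eq → begin
             (2 + l) * (cat (suc l) * cat r)   ≡⟨ *-assoc (2 + l) (cat (suc l)) (cat r) ⟨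
             (2 + l) * cat (suc l) * cat r     ≡⟨ cong (_* cat r) (rec (s≤s (subst (l ≤_) eq (m≤m+n l r)))) ⟩
             (2 + 4 * l) * cat l * cat r       ≡⟨ regroup l (cat l) (cat r) ⟩
             2 * (suc l * (cat l * cat r)) + 2 * (l * (cat l * cat r)) ∎) ⟩
      2 * (1 * (1 * cat (suc n)) + antidiagonal (λ l r → 2 * (suc l * (cat l * cat r)) + 2 * (l * (cat l * cat r))) n)
        ≡⟨ cong (λ u → 2 * (1 * (1 * cat (suc n)) + u)) (trans (antidiagonal-+ _ _ n)
             (cong₂ _+_ (antidiagonal-*ˡ 2 _ n) (antidiagonal-*ˡ 2 _ n))) ⟩
      2 * (1 * (1 * cat (suc n)) + (2 * V + 2 * W))
        ≡⟨ arith (cat (suc n)) V W ⟩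
      2 * (2 * V) + (2 * cat (suc n) + 2 * (2 * W))
        -- Subtraction is avoided by adding 4 `cat (suc n)` to both sides, which completes `W` to
        -- `V` so that `weighted n` applies.
        ≡⟨ +-cancelʳ-≡ (2 * (2 * cat (suc n))) _ _ final ⟩
      (2 + 4 * suc n) * cat (suc n) ∎
      where
      V = antidiagonal (λ l r → suc l * (cat l * cat r)) n
      W = antidiagonal (λ l r → l * (cat l * cat r)) n
      regroup : ∀ l a b → (2 + 4 * l) * a * b ≡ 2 * (suc l * (a * b)) + 2 * (l * (a * b))
      regroup = solve-∀
      arith : ∀ c v w → 2 * (1 * (1 * c) + (2 * v + 2 * w)) ≡ 2 * (2 * v) + (2 * c + 2 * (2 * w))
      arith = solve-∀
      V≡W+ : V ≡ cat (suc n) + W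
      V≡W+ = trans (antidiagonal-+ (λ l r → cat l * cat r) (λ l r → l * (cat l * cat r)) n)
        (cong (_+ W) (sym (cat-convolution n)))
      final : 2 * (2 * V) + (2 * cat (suc n) + 2 * (2 * W)) + 2 * (2 * cat (suc n)) ≡
              (2 + 4 * suc n) * cat (suc n) + 2 * (2 * cat (suc n))
      final = begin
        2 * (2 * V) + (2 * cat (suc n) + 2 * (2 * W)) + 2 * (2 * cat (suc n))
          ≡⟨ s₁ V W (cat (suc n)) ⟩
        2 * (2 * V) + 2 * (2 * (cat (suc n) + W)) + 2 * cat (suc n)
          ≡⟨ cong (λ u → 2 * (2 * V) + 2 * (2 * u) + 2 * cat (suc n)) V≡W+ ⟨
        2 * (2 * V) + 2 * (2 * V) + 2 * cat (suc n)
          ≡⟨ cong (λ u → 2 * u + 2 * u + 2 * cat (suc n)) (weighted n) ⟩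
        2 * ((2 + n) * cat (suc n)) + 2 * ((2 + n) * cat (suc n)) + 2 * cat (suc n)
          ≡⟨ s₂ n (cat (suc n)) ⟩
        (2 + 4 * suc n) * cat (suc n) + 2 * (2 * cat (suc n)) ∎
        where
        s₁ : ∀ v w c → 2 * (2 * v) + (2 * c + 2 * (2 * w)) + 2 * (2 * c) ≡ 2 * (2 * v) + 2 * (2 * (c + w)) + 2 * c
        s₁ = solve-∀
        s₂ : ∀ n c → 2 * ((2 + n) * c) + 2 * ((2 + n) * c) + 2 * c ≡ (2 + 4 * (1 + n)) * c + 2 * (2 * c)
        s₂ = solve-∀

  cat-factorial : ∀ n → cat n * (n ! * suc n !) ≡ (2 * n) !
  cat-factorial zero    = cong (_* 1) cat-0
  cat-factorial (suc n) = begin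
    cat (suc n) * ((1 + n) * n ! * ((2 + n) * (suc n) !))
      ≡⟨ s₁ n (cat (suc n)) (n !) (suc n !) ⟩
    (2 + n) * cat (suc n) * ((1 + n) * (n ! * suc n !))
      ≡⟨ cong (_* ((1 + n) * (n ! * suc n !))) (cat-recurrence n) ⟩
    (2 + 4 * n) * cat n * ((1 + n) * (n ! * suc n !))
      ≡⟨ s₂ n (cat n) (n ! * suc n !) ⟩
    (2 + 2 * n) * ((1 + 2 * n) * (cat n * (n ! * suc n !)))
      ≡⟨ cong (λ u → (2 + 2 * n) * ((1 + 2 * n) * u)) (cat-factorial n) ⟩
    (2 + 2 * n) * ((1 + 2 * n) * (2 * n) !)
      ≡⟨ cong _! (s₃ n) ⟨
    (2 * suc n) ! ∎
    where
    open ≡-Reasoning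
    s₁ : ∀ n c a b → c * ((1 + n) * a * ((2 + n) * b)) ≡ (2 + n) * c * ((1 + n) * (a * b))
    s₁ = solve-∀
    s₂ : ∀ n c a → (2 + 4 * n) * c * ((1 + n) * a) ≡ (2 + 2 * n) * ((1 + 2 * n) * (c * a))
    s₂ = solve-∀
    s₃ : ∀ n → 2 * (1 + n) ≡ 2 + 2 * n
    s₃ = solve-∀

  -- Since `cat 0` is 1, the term with l = 0 isolates the value at n, and all other terms involve
  -- smaller indices.
  convolution-cancel : ∀ (f g : ℕ → ℕ) →
    (∀ n → antidiagonal (λ l k → cat l * f k) n ≡ antidiagonal (λ l k → cat l * g k) n) → ∀ n → f n ≡ g n
  convolution-cancel f g eq = <-rec (λ n → f n ≡ g n) step
    where
    cat0* : ∀ m → cat 0 * m ≡ m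
    cat0* m = trans (cong (_* m) cat-0) (*-identityˡ m)
    step : ∀ n → (∀ {m} → m < n → f m ≡ g m) → f n ≡ g n
    step zero    _   = trans (sym (cat0* (f 0))) (trans (eq 0) (cat0* (g 0)))
    step (suc n) rec = trans (sym (cat0* (f (suc n)))) (trans
      (+-cancelʳ-≡ (antidiagonal (λ l k → cat (suc l) * g k) n) _ _ (trans
        (cong (cat 0 * f (suc n) +_) (sym (antidiagonal-cong n λ l k l+k≡n →
          cong (cat (suc l) *_) (rec (s≤s (subst (k ≤_) l+k≡n (m≤n+m k l)))))))
        (eq (suc n))))
      (cat0* (g (suc n))))

  -- Both sides have the convolution 2 n `cat n` with `cat`: the left one by `goods₁-convolution`,
  -- the right one by `weighted` and the recurrence.
  2*goods₁ : ∀ n → 2 * goods₁ (suc n) ≡ (2 + n) * cat (suc n)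
  2*goods₁ n = convolution-cancel (λ k → 2 * goods₁ k) half conv (suc n)
    where
    open ≡-Reasoning
    half : ℕ → ℕ
    half zero    = 0
    half (suc k) = (2 + k) * cat (suc k)
    double-* : ∀ a b → a * (2 * b) ≡ 2 * (a * b)
    double-* = solve-∀
    rearrange : ∀ a b c → a * (b * c) ≡ b * (c * a)
    rearrange = solve-∀
    conv : ∀ n → antidiagonal (λ l k → cat l * (2 * goods₁ k)) n ≡ antidiagonal (λ l k → cat l * half k) n
    conv zero    = cong (λ m → cat 0 * (2 * m)) goods₁-0
    conv (suc n) = trans lhs (sym rhs)
      where
      lhs : antidiagonal (λ l k → cat l * (2 * goods₁ k)) (suc n) ≡ 2 * (suc n * cat (suc n))
      lhs = trans (antidiagonal-cong (suc n) λ l k _ → double-* (cat l) (goods₁ k))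
        (trans (antidiagonal-*ˡ 2 (λ l k → cat l * goods₁ k) (suc n)) (cong (2 *_) (goods₁-convolution (suc n))))
      S = antidiagonal (λ l k → cat l * ((2 + k) * cat (suc k))) n
      -- `half` is 0 at 0 to match `goods₁`, whereas (k + 1) `cat k` is 1 there; `full` is the sum
      -- with that term restored, to which `weighted` applies.
      full : 2 * (S + cat (suc n) * 1) ≡ (6 + 4 * n) * cat (suc n)
      full = begin
        2 * (S + cat (suc n) * 1)
          ≡⟨ cong (λ u → 2 * (S + cat (suc n) * (u + 0))) cat-0 ⟨
        2 * (S + cat (suc n) * (1 * cat 0))
          ≡⟨ cong (2 *_) (antidiagonal-last (λ l k → cat l * (suc k * cat k)) n) ⟨
        2 * antidiagonal (λ l k → cat l * (suc k * cat k)) (suc n)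
          ≡⟨ cong (2 *_) (antidiagonal-swap (λ l k → cat l * (suc k * cat k)) (suc n)) ⟩
        2 * antidiagonal (λ l k → cat k * (suc l * cat l)) (suc n)
          ≡⟨ cong (2 *_) (antidiagonal-cong (suc n) λ l k _ → rearrange (cat k) (suc l) (cat l)) ⟩
        2 * antidiagonal (λ l k → suc l * (cat l * cat k)) (suc n)
          ≡⟨ weighted (suc n) ⟩
        (3 + n) * cat (2 + n)
          ≡⟨ cat-recurrence (suc n) ⟩
        (2 + 4 * suc n) * cat (suc n)
          ≡⟨ cong (_* cat (suc n)) (s n) ⟩
        (6 + 4 * n) * cat (suc n) ∎
        where
        s : ∀ n → 2 + 4 * (1 + n) ≡ 6 + 4 * n
        s = solve-∀
      rhs : antidiagonal (λ l k → cat l * half k) (suc n) ≡ 2 * (suc n * cat (suc n))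
      rhs = trans (antidiagonal-last (λ l k → cat l * half k) n)
        (trans (cong (S +_) (*-zeroʳ (cat (suc n)))) (trans (+-identityʳ S)
        (*-cancelˡ-≡ S (2 * (suc n * cat (suc n))) 2 (+-cancelʳ-≡ (2 * (cat (suc n) * 1)) _ _
          (trans (sym (*-distribˡ-+ 2 S (cat (suc n) * 1))) (trans full (s n (cat (suc n)))))))))
        where
        s : ∀ n c → (6 + 4 * n) * c ≡ 2 * (2 * ((1 + n) * c)) + 2 * (c * 1)
        s = solve-∀

  2*∑#blocks : ∀ n → 2 * ∑ (allNC (suc n)) #blocks ≡ (2 + n) * cat (suc n)
  2*∑#blocks n = +-cancelʳ-≡ ((2 + n) * cat (suc n)) _ _ (begin
    2 * ∑ (allNC (suc n)) #blocks + (2 + n) * cat (suc n)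
      ≡⟨ cong (2 * ∑ (allNC (suc n)) #blocks +_) (2*goods₁ n) ⟨
    2 * ∑ (allNC (suc n)) #blocks + 2 * goods₁ (suc n)
      ≡⟨ *-distribˡ-+ 2 (∑ (allNC (suc n)) #blocks) _ ⟨
    2 * (∑ (allNC (suc n)) #blocks + goods₁ (suc n))
      ≡⟨ cong (2 *_) (∑#blocks+goods₁ n) ⟩
    2 * ((2 + n) * cat (suc n))
      ≡⟨ cong ((2 + n) * cat (suc n) +_) (+-identityʳ _) ⟩
    (2 + n) * cat (suc n) + (2 + n) * cat (suc n) ∎)
    where open ≡-Reasoning

  -- The sum of all distances

  ∑-++ : ∀ {A : Set} (xs ys : List A) f → ∑ (xs ++ ys) f ≡ ∑ xs f + ∑ ys f
  ∑-++ []       ys f = refl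
  ∑-++ (x ∷ xs) ys f = trans (cong (f x +_) (∑-++ xs ys f)) (sym (+-assoc (f x) _ _))

  ∑-map : ∀ {A B : Set} (g : B → A) xs f → ∑ (map g xs) f ≡ ∑ xs (f ∘ g)
  ∑-map g []       f = refl
  ∑-map g (x ∷ xs) f = cong (f (g x) +_) (∑-map g xs f)

  ∑-+const : ∀ {A : Set} (xs : List A) c f → ∑ xs (λ x → c + f x) ≡ length xs * c + ∑ xs f
  ∑-+const []       c f = refl
  ∑-+const (x ∷ xs) c f = trans (cong (c + f x +_) (∑-+const xs c f)) (s c (f x) _ _)
    where
    s : ∀ a b c d → a + b + (c + d) ≡ a + c + (b + d)
    s = solve-∀

  ∑-cartesianProduct : ∀ {A : Set} (xs ys : List A) f g →
    ∑ (cartesianProduct xs ys) (λ (x , y) → f x + g y) ≡ length ys * ∑ xs f + length xs * ∑ ys g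
  ∑-cartesianProduct []       ys f g = sym (trans (+-identityʳ _) (*-zeroʳ (length ys)))
  ∑-cartesianProduct (x ∷ xs) ys f g = trans (∑-++ (map (x ,_) ys) _ _) (trans
    (cong₂ _+_ (trans (∑-map (x ,_) ys _) (∑-+const ys (f x) g)) (∑-cartesianProduct xs ys f g))
    (s (length ys) (f x) (∑ ys g) (∑ xs f) (length xs)))
    where
    s : ∀ m a b c k → m * a + b + (m * c + k * b) ≡ m * (a + c) + (b + k * b)
    s = solve-∀

  cartesianProductWith≡map : ∀ {A B D : Set} (f : A → B → D) xs ys →
    cartesianProductWith f xs ys ≡ map (λ (x , y) → f x y) (cartesianProduct xs ys)
  cartesianProductWith≡map f []       ys = refl
  cartesianProductWith≡map f (x ∷ xs) ys = trans
    (cong₂ _++_ (map-∘ ys) (cartesianProductWith≡map f xs ys))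
    (sym (map-++ (λ (x , y) → f x y) (map (x ,_) ys) (cartesianProduct xs ys)))

  sum-map : ∀ {A : Set} (d : A → ℤ) (f h : A → ℕ) → (∀ x → d x ≡ ℤ.+ f x ℤ.- ℤ.+ 2 ℤ.* ℤ.+ h x) →
    ∀ xs → Defs.sum (map d xs) ≡ ℤ.+ ∑ xs f ℤ.- ℤ.+ 2 ℤ.* ℤ.+ ∑ xs h
  sum-map d f h eq []       = refl
  sum-map d f h eq (x ∷ xs) = trans (cong₂ ℤ._+_ (eq x) (sum-map d f h eq xs))
    (s (ℤ.+ f x) (ℤ.+ h x) (ℤ.+ ∑ xs f) (ℤ.+ ∑ xs h))
    where
    s : ∀ a b u v → a ℤ.- ℤ.+ 2 ℤ.* b ℤ.+ (u ℤ.- ℤ.+ 2 ℤ.* v) ≡ a ℤ.+ u ℤ.- ℤ.+ 2 ℤ.* (b ℤ.+ v)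
    s = solveℤ-∀

  -- With t = (n + 2) `cat (suc n)` squared, the sum of |σ| + |ρ| is t because |σ| averages (n + 2)
  -- / 2, and the sum j of |σ ∨ ρ| together with g = `goods₂ (suc n)` is t as well. Hence t - 2j =
  -- 2g - t.
  ∑distance : ∀ n → Defs.sum (cartesianProductWith distance (allNC (suc n)) (allNC (suc n))) ≡
    ℤ.+ 2 ℤ.* ℤ.+ goods₂ (suc n) ℤ.- ℤ.+ ((2 + n) * (cat (suc n) * cat (suc n)))
  ∑distance n = begin
    Defs.sum (cartesianProductWith distance (allNC (suc n)) (allNC (suc n)))
      ≡⟨ cong Defs.sum (cartesianProductWith≡map distance (allNC (suc n)) (allNC (suc n))) ⟩
    Defs.sum (map (λ (σ , ρ) → distance σ ρ) pairs)
      ≡⟨ sum-map (λ (σ , ρ) → distance σ ρ) (λ (σ , ρ) → #blocks σ + #blocks ρ) joins (λ _ → refl) pairs ⟩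
    ℤ.+ ∑ pairs (λ (σ , ρ) → #blocks σ + #blocks ρ) ℤ.- ℤ.+ 2 ℤ.* ℤ.+ ∑ pairs joins
      ≡⟨ cong (λ u → ℤ.+ u ℤ.- ℤ.+ 2 ℤ.* ℤ.+ ∑ pairs joins) pairSum ⟩
    ℤ.+ ((2 + n) * (cat (suc n) * cat (suc n))) ℤ.- ℤ.+ 2 ℤ.* ℤ.+ ∑ pairs joins
      ≡⟨ arith (ℤ.+ ((2 + n) * (cat (suc n) * cat (suc n)))) (ℤ.+ ∑ pairs joins) (ℤ.+ goods₂ (suc n)) (cong ℤ.+_ (∑#blocks∨+goods₂ n)) ⟩
    ℤ.+ 2 ℤ.* ℤ.+ goods₂ (suc n) ℤ.- ℤ.+ ((2 + n) * (cat (suc n) * cat (suc n))) ∎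
    where
    open ≡-Reasoning
    pairs = allPairs (suc n)
    joins : NC (suc n) × NC (suc n) → ℕ
    joins (σ , ρ) = #blocks (σ ∨ ρ)
    pairSum : ∑ pairs (λ (σ , ρ) → #blocks σ + #blocks ρ) ≡ (2 + n) * (cat (suc n) * cat (suc n))
    pairSum = begin
      ∑ pairs (λ (σ , ρ) → #blocks σ + #blocks ρ)
        ≡⟨ ∑-cartesianProduct (allNC (suc n)) (allNC (suc n)) #blocks #blocks ⟩
      length (allNC (suc n)) * ∑ (allNC (suc n)) #blocks + length (allNC (suc n)) * ∑ (allNC (suc n)) #blocks
        ≡⟨ cong (λ c → c * ∑ (allNC (suc n)) #blocks + c * ∑ (allNC (suc n)) #blocks) (length-allNC (suc n)) ⟩
      cat (suc n) * ∑ (allNC (suc n)) #blocks + cat (suc n) * ∑ (allNC (suc n)) #blocks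
        ≡⟨ s (cat (suc n)) (∑ (allNC (suc n)) #blocks) ⟩
      cat (suc n) * (2 * ∑ (allNC (suc n)) #blocks)
        ≡⟨ cong (cat (suc n) *_) (2*∑#blocks n) ⟩
      cat (suc n) * ((2 + n) * cat (suc n))
        ≡⟨ s′ (cat (suc n)) (2 + n) ⟩
      (2 + n) * (cat (suc n) * cat (suc n)) ∎
      where
      s : ∀ a b → a * b + a * b ≡ a * (2 * b)
      s = solve-∀
      s′ : ∀ a b → a * (b * a) ≡ b * (a * a)
      s′ = solve-∀
    arith : ∀ t j g → j ℤ.+ g ≡ t → t ℤ.- ℤ.+ 2 ℤ.* j ≡ ℤ.+ 2 ℤ.* g ℤ.- t
    arith _ j g refl = s j g
      where
      s : ∀ j g → j ℤ.+ g ℤ.- ℤ.+ 2 ℤ.* j ≡ ℤ.+ 2 ℤ.* g ℤ.- (j ℤ.+ g)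
      s = solveℤ-∀

-- Asymptotics over the rationals

module Analysis where

  open Combinatorics using (antidiagonal; cat; cat-0; cat-recurrence; cat-factorial; goods₂; goods₂-convolution; ∑distance)
  open import Defs using (p≤q⇒0≤q-p; p≤∣p∣; odd⁻¹; odd⁻¹-small; 1/suc≡; sign; ∣sign∣; leibnizTerm; leibnizTerm≡;
    leibnizSum; leibnizSum-close; quotient; 0≤odd⁻¹; odd⁻¹-anti; recip; *-recip)
  import Data.Integer.Base as ℤ
  import Data.Integer.Properties as ℤ
  open import Data.Nat.Base as ℕ using (ℕ; zero; suc; z≤n; s≤s; _!)
  import Data.Nat.Properties as ℕ
  open import Data.Nat.Coprimality using (1-coprimeTo) renaming (sym to coprime-sym)
  open import Data.Product.Base using (∃; _×_; _,_; proj₁; proj₂)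
  open import Data.Rational.Base
  open import Data.Rational.Properties
  open import Data.Sum.Base using (inj₁; inj₂)
  open import Level using (0ℓ)
  open import Relation.Binary.PropositionalEquality using (_≡_; refl; sym; trans; cong; cong₂; subst; subst₂;
    module ≡-Reasoning)
  open import Relation.Nullary.Decidable using (dec⇒maybe; from-yes)
  open import Tactic.RingSolver using (solve-∀)
  open import Tactic.RingSolver.Core.AlmostCommutativeRing using (AlmostCommutativeRing; fromCommutativeRing)
  import Data.Integer.Tactic.RingSolver as ℤSolver
  import Data.Rational.Unnormalised.Base as ℚᵘ
  open import Data.List.Base using (cartesianProductWith)

  ring : AlmostCommutativeRing 0ℓ 0ℓ
  ring = fromCommutativeRing +-*-commutativeRing (λ x → dec⇒maybe (0ℚ ≟ x))

  2ℚ 4ℚ 8ℚ 16ℚ ¼ : ℚ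
  2ℚ  = ℤ.+ 2 / 1
  4ℚ  = ℤ.+ 4 / 1
  8ℚ  = ℤ.+ 8 / 1
  16ℚ = ℤ.+ 16 / 1
  ¼   = ½ * ½

  -- Ordered field lemmas.

  0≤+ : ∀ {p q} → 0ℚ ≤ p → 0ℚ ≤ q → 0ℚ ≤ p + q
  0≤+ = +-mono-≤

  0≤* : ∀ {p q} → 0ℚ ≤ p → 0ℚ ≤ q → 0ℚ ≤ p * q
  0≤* {p} {q} 0≤p 0≤q = nonNegative⁻¹ (p * q) {{nonNeg*nonNeg⇒nonNeg p {{nonNegative 0≤p}} q {{nonNegative 0≤q}}}}

  0<* : ∀ {p q} → 0ℚ < p → 0ℚ < q → 0ℚ < p * q
  0<* {p} {q} 0<p 0<q = positive⁻¹ (p * q) {{pos*pos⇒pos p {{positive 0<p}} q {{positive 0<q}}}}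

  -- The standard move for inequalities below: the difference is displayed as a visibly nonnegative
  -- `r`, and a ring identity does the rest.
  ≤-by : ∀ {p q} r → 0ℚ ≤ r → q ≡ p + r → p ≤ q
  ≤-by {p} {q} r 0≤r eq = begin
    p        ≡⟨ +-identityʳ p ⟨
    p + 0ℚ   ≤⟨ +-monoʳ-≤ p 0≤r ⟩
    p + r    ≡⟨ eq ⟨
    q        ∎
    where open ≤-Reasoning

  *-monoʳ : ∀ {a p q} → 0ℚ ≤ a → p ≤ q → a * p ≤ a * q
  *-monoʳ {a} 0≤a p≤q = *-monoˡ-≤-nonNeg a {{nonNegative 0≤a}} p≤q

  *-monoˡ : ∀ {a p q} → 0ℚ ≤ a → p ≤ q → p * a ≤ q * a
  *-monoˡ {a} 0≤a p≤q = *-monoʳ-≤-nonNeg a {{nonNegative 0≤a}} p≤q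

  *-mono : ∀ {p q r s} → 0ℚ ≤ p → 0ℚ ≤ s → p ≤ q → r ≤ s → p * r ≤ q * s
  *-mono 0≤p 0≤s p≤q r≤s = ≤-trans (*-monoʳ 0≤p r≤s) (*-monoˡ 0≤s p≤q)

  *-cancelˡ-≤ : ∀ {c p q} → 0ℚ < c → c * p ≤ c * q → p ≤ q
  *-cancelˡ-≤ {c} 0<c = *-cancelˡ-≤-pos c {{positive 0<c}}

  *-cancelˡ-≡ : ∀ {c p q} → 0ℚ < c → c * p ≡ c * q → p ≡ q
  *-cancelˡ-≡ 0<c eq = ≤-antisym (*-cancelˡ-≤ 0<c (≤-reflexive eq)) (*-cancelˡ-≤ 0<c (≤-reflexive (sym eq)))

  ∣∣-bound : ∀ {p r} → p ≤ r → - p ≤ r → ∣ p ∣ ≤ r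
  ∣∣-bound {p} {r} p≤r -p≤r with ∣p∣≡p∨∣p∣≡-p p
  ... | inj₁ eq = subst (_≤ r) (sym eq) p≤r
  ... | inj₂ eq = subst (_≤ r) (sym eq) -p≤r

  ∣∣-*-bound : ∀ {p q r} → ∣ q ∣ ≤ r → ∣ p * q ∣ ≤ ∣ p ∣ * r
  ∣∣-*-bound {p} {q} q≤r = subst (_≤ _) (sym (∣p*q∣≡∣p∣*∣q∣ p q)) (*-monoʳ (0≤∣p∣ p) q≤r)

  p≤1⇒p*q≤q : ∀ {p q} → p ≤ 1ℚ → 0ℚ ≤ q → p * q ≤ q
  p≤1⇒p*q≤q {p} {q} p≤1 0≤q = subst (p * q ≤_) (*-identityˡ q) (*-monoˡ 0≤q p≤1)

  -- Natural numbers as rationals.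

  -- Recursive, so that `ι (suc n)` unfolds to `1ℚ + ι n` and successors become polynomials for the
  -- ring solver.
  ι : ℕ → ℚ
  ι zero    = 0ℚ
  ι (suc n) = 1ℚ + ι n

  ι-+ : ∀ m n → ι (m ℕ.+ n) ≡ ι m + ι n
  ι-+ zero    n = sym (+-identityˡ (ι n))
  ι-+ (suc m) n = trans (cong (1ℚ +_) (ι-+ m n)) (sym (+-assoc 1ℚ (ι m) (ι n)))

  ι-* : ∀ m n → ι (m ℕ.* n) ≡ ι m * ι n
  ι-* zero    n = sym (*-zeroˡ (ι n))
  ι-* (suc m) n = trans (ι-+ n (m ℕ.* n)) (trans (cong (ι n +_) (ι-* m n)) (s (ι m) (ι n)))
    where
    s : ∀ m n → n + m * n ≡ (1ℚ + m) * n
    s = solve-∀ ring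

  0≤1 : 0ℚ ≤ 1ℚ
  0≤1 = from-yes (0ℚ ≤? 1ℚ)

  0≤ι : ∀ n → 0ℚ ≤ ι n
  0≤ι zero    = ≤-refl
  0≤ι (suc n) = 0≤+ 0≤1 (0≤ι n)

  0<ι : ∀ n → 0ℚ < ι (suc n)
  0<ι n = +-mono-<-≤ (positive⁻¹ 1ℚ) (0≤ι n)

  ι-mono : ∀ {m n} → m ℕ.≤ n → ι m ≤ ι n
  ι-mono {n = n} z≤n   = 0≤ι n
  ι-mono (s≤s m≤n) = +-monoʳ-≤ 1ℚ (ι-mono m≤n)

  integer : ℤ.ℤ → ℚ
  integer z = mkℚ z 0 (coprime-sym (1-coprimeTo _))

  /1≡integer : ∀ n → ℤ.+ n / 1 ≡ integer (ℤ.+ n)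
  /1≡integer n = normalize-coprime {n} {0} (coprime-sym (1-coprimeTo n))

  ι≡/1 : ∀ n → ι n ≡ ℤ.+ n / 1
  ι≡/1 zero    = refl
  ι≡/1 (suc n) = trans (cong (1ℚ +_) (trans (ι≡/1 n) (/1≡integer n)))
    (cong (λ z → (ℤ.+ 1 ℤ.+ z) / 1) (ℤ.*-identityʳ (ℤ.+ n)))

  inv : ℕ → ℚ
  inv n = ℤ.+ 1 / suc n

  ι*inv : ∀ n → ι (suc n) * inv n ≡ 1ℚ
  ι*inv n = trans (cong₂ _*_ (trans (ι≡/1 (suc n)) (/1≡integer (suc n))) (1/suc≡ n)) (*-inverseʳ (integer ℤ.+[1+ n ]))

  0≤inv : ∀ n → 0ℚ ≤ inv n
  0≤inv n = nonNegative⁻¹ (inv n) {{pos⇒nonNeg (inv n) {{normalize-pos 1 (suc n)}}}}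

  inv≤1 : ∀ n → inv n ≤ 1ℚ
  inv≤1 n = subst (inv n ≤_) (ι*inv n) (≤-by (ι n * inv n) (0≤* (0≤ι n) (0≤inv n)) (s (ι n) (inv n)))
    where
    s : ∀ n i → (1ℚ + n) * i ≡ i + n * i
    s = solve-∀ ring

  ≤*inv : ∀ {p q} n → ι (suc n) * p ≤ q → p ≤ q * inv n
  ≤*inv {p} {q} n h = subst₂ _≤_
    (trans (*-comm (inv n) _) (trans (s (ι (suc n)) p (inv n)) (trans (cong (_* p) (ι*inv n)) (*-identityˡ p))))
    (*-comm (inv n) q) (*-monoʳ (0≤inv n) h)
    where
    s : ∀ a p i → a * p * i ≡ a * i * p
    s = solve-∀ ring

  -- Null sequences.

  Null : (ℕ → ℚ) → Set
  Null f = ∀ ε → 0ℚ < ε → ∃ λ N → ∀ n → N ℕ.≤ n → ∣ f n ∣ ≤ ε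

  Null-inv : Null inv
  Null-inv ε 0<ε with odd⁻¹-small ε 0<ε
  ... | N , small = 2 ℕ.* N , λ n N≤n → begin
    ∣ inv n ∣   ≡⟨ 0≤p⇒∣p∣≡p (0≤inv n) ⟩
    inv n       ≤⟨ Defs.1/suc-anti N≤n ⟩
    odd⁻¹ N     ≤⟨ <⇒≤ small ⟩
    ε           ∎
    where open ≤-Reasoning

  Null-squeeze : ∀ {f g : ℕ → ℚ} → Null g → (∃ λ N → ∀ n → N ℕ.≤ n → ∣ f n ∣ ≤ ∣ g n ∣) → Null f
  Null-squeeze ng (M , f≤g) ε 0<ε with ng ε 0<ε
  ... | N , h = M ℕ.⊔ N , λ n ≤n → ≤-trans (f≤g n (ℕ.m⊔n≤o⇒m≤o M N ≤n)) (h n (ℕ.m⊔n≤o⇒n≤o M N ≤n))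

  Null-cong : ∀ {f g} → Null g → (∀ n → f n ≡ g n) → Null f
  Null-cong ng eq = Null-squeeze ng (0 , λ n _ → ≤-reflexive (cong ∣_∣ (eq n)))

  Null-+ : ∀ {f g} → Null f → Null g → Null (λ n → f n + g n)
  Null-+ {f} {g} nf ng ε 0<ε with nf (½ * ε) (*-monoʳ-<-pos ½ 0<ε) | ng (½ * ε) (*-monoʳ-<-pos ½ 0<ε)
  ... | M , hf | N , hg = M ℕ.⊔ N , λ n ≤n → begin
    ∣ f n + g n ∣       ≤⟨ ∣p+q∣≤∣p∣+∣q∣ (f n) (g n) ⟩
    ∣ f n ∣ + ∣ g n ∣   ≤⟨ +-mono-≤ (hf n (ℕ.m⊔n≤o⇒m≤o M N ≤n)) (hg n (ℕ.m⊔n≤o⇒n≤o M N ≤n)) ⟩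
    ½ * ε + ½ * ε       ≡⟨ s ε ⟩
    ε                   ∎
    where
    open ≤-Reasoning
    s : ∀ e → ½ * e + ½ * e ≡ e
    s = solve-∀ ring

  Null-* : ∀ {f g : ℕ → ℚ} C → 0ℚ < C → (∃ λ N → ∀ n → N ℕ.≤ n → ∣ f n ∣ ≤ C) → Null g → Null (λ n → f n * g n)
  Null-* {f} {g} C 0<C (M , f≤C) ng ε 0<ε with quotient C ε 0<C 0<ε
  ... | η , 0<η , Cη≡ε with ng η 0<η
  ...   | N , h = M ℕ.⊔ N , λ n ≤n → begin
    ∣ f n * g n ∣      ≡⟨ ∣p*q∣≡∣p∣*∣q∣ (f n) (g n) ⟩
    ∣ f n ∣ * ∣ g n ∣  ≤⟨ *-mono (0≤∣p∣ (f n)) (<⇒≤ 0<η) (f≤C n (ℕ.m⊔n≤o⇒m≤o M N ≤n)) (h n (ℕ.m⊔n≤o⇒n≤o M N ≤n)) ⟩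
    C * η              ≡⟨ Cη≡ε ⟩
    ε                  ∎
    where open ≤-Reasoning

  -- For two-parameter estimates: a cut-off K is fixed, n goes to infinity, and an error of order 1
  -- / K remains.
  Null-by-inv : ∀ {f : ℕ → ℚ} C → 0ℚ < C → (∀ K → ∃ λ N → ∀ n → N ℕ.≤ n → ∣ f n ∣ ≤ C * inv K) → Null f
  Null-by-inv {f} C 0<C h ε 0<ε with quotient C ε 0<C 0<ε
  ... | η , 0<η , Cη≡ε with Null-inv η 0<η
  ...   | K , small = let N , hN = h K in N , λ n N≤n → begin
    ∣ f n ∣     ≤⟨ hN n N≤n ⟩
    C * inv K   ≤⟨ *-monoʳ (<⇒≤ 0<C) (≤-trans (p≤∣p∣ (inv K)) (small K ℕ.≤-refl)) ⟩
    C * η       ≡⟨ Cη≡ε ⟩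
    ε           ∎
    where open ≤-Reasoning

  -- Finite sums.

  ∑< : ℕ → (ℕ → ℚ) → ℚ
  ∑< zero    f = 0ℚ
  ∑< (suc n) f = f 0 + ∑< n (λ i → f (suc i))

  ∑<-last : ∀ n f → ∑< (suc n) f ≡ ∑< n f + f n
  ∑<-last zero    f = +-comm (f 0) 0ℚ
  ∑<-last (suc n) f = trans (cong (f 0 +_) (∑<-last n (λ i → f (suc i)))) (sym (+-assoc (f 0) _ _))

  ∑<-cong : ∀ n {f g} → (∀ i → i ℕ.< n → f i ≡ g i) → ∑< n f ≡ ∑< n g
  ∑<-cong zero    eq = refl
  ∑<-cong (suc n) eq = cong₂ _+_ (eq 0 (s≤s z≤n)) (∑<-cong n λ i i<n → eq (suc i) (s≤s i<n))

  ∑<-mono : ∀ n {f g} → (∀ i → i ℕ.< n → f i ≤ g i) → ∑< n f ≤ ∑< n g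
  ∑<-mono zero    le = ≤-refl
  ∑<-mono (suc n) le = +-mono-≤ (le 0 (s≤s z≤n)) (∑<-mono n λ i i<n → le (suc i) (s≤s i<n))

  ∑<-nonneg : ∀ n {f} → (∀ i → 0ℚ ≤ f i) → 0ℚ ≤ ∑< n f
  ∑<-nonneg zero    h = ≤-refl
  ∑<-nonneg (suc n) h = 0≤+ (h 0) (∑<-nonneg n λ i → h (suc i))

  ∑<-+ : ∀ n f g → ∑< n (λ i → f i + g i) ≡ ∑< n f + ∑< n g
  ∑<-+ zero    f g = refl
  ∑<-+ (suc n) f g = trans (cong (f 0 + g 0 +_) (∑<-+ n (λ i → f (suc i)) (λ i → g (suc i)))) (s (f 0) (g 0) _ _)
    where
    s : ∀ a b c d → a + b + (c + d) ≡ a + c + (b + d)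
    s = solve-∀ ring

  ∑<-* : ∀ n c f → ∑< n (λ i → c * f i) ≡ c * ∑< n f
  ∑<-* zero    c f = sym (*-zeroʳ c)
  ∑<-* (suc n) c f = trans (cong (c * f 0 +_) (∑<-* n c (λ i → f (suc i)))) (sym (*-distribˡ-+ c (f 0) _))

  ∑<-split : ∀ m n f → ∑< (m ℕ.+ n) f ≡ ∑< m f + ∑< n (λ i → f (m ℕ.+ i))
  ∑<-split zero    n f = sym (+-identityˡ _)
  ∑<-split (suc m) n f = trans (cong (f 0 +_) (∑<-split m n (λ i → f (suc i)))) (sym (+-assoc (f 0) _ _))

  ∑<-∣∣ : ∀ n f → ∣ ∑< n f ∣ ≤ ∑< n (λ i → ∣ f i ∣)
  ∑<-∣∣ zero    f = ≤-refl
  ∑<-∣∣ (suc n) f = ≤-trans (∣p+q∣≤∣p∣+∣q∣ (f 0) _) (+-monoʳ-≤ ∣ f 0 ∣ (∑<-∣∣ n (λ i → f (suc i))))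

  ∑<-telescope : ∀ n f → ∑< n (λ i → f (suc i) - f i) ≡ f n - f 0
  ∑<-telescope zero    f = sym (+-inverseʳ (f 0))
  ∑<-telescope (suc n) f = trans (cong (f 1 - f 0 +_) (∑<-telescope n (λ i → f (suc i)))) (s (f 1) (f 0) (f (suc n)))
    where
    s : ∀ a b c → a - b + (c - a) ≡ c - b
    s = solve-∀ ring

  ∑<-reverse : ∀ n f → ∑< (suc n) f ≡ ∑< (suc n) (λ i → f (n ℕ.∸ i))
  ∑<-reverse zero    f = refl
  ∑<-reverse (suc n) f = trans (∑<-last (suc n) f) (trans (+-comm (∑< (suc n) f) (f (suc n)))
    (cong (f (suc n) +_) (∑<-reverse n f)))

  -- The Wallis products w n = (binom(2n, n) / 4ⁿ)².

  w : ℕ → ℚ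
  w zero    = 1ℚ
  w (suc n) = (ι n + ½) * (ι n + ½) * w n * (inv n * inv n)

  w-step : ∀ n → ι (suc n) * ι (suc n) * w (suc n) ≡ (ι n + ½) * (ι n + ½) * w n
  w-step n = trans (s (ι (suc n)) ((ι n + ½) * (ι n + ½) * w n) (inv n))
    (trans (cong₂ (λ u v → (ι n + ½) * (ι n + ½) * w n * (u * v)) (ι*inv n) (ι*inv n)) (*-identityʳ _))
    where
    s : ∀ a c i → a * a * (c * (i * i)) ≡ c * ((a * i) * (a * i))
    s = solve-∀ ring

  0≤½ : 0ℚ ≤ ½
  0≤½ = from-yes (0ℚ ≤? ½)

  0<2n+1 : ∀ n → 0ℚ < 1ℚ + 2ℚ * ι n
  0<2n+1 n = +-mono-<-≤ (positive⁻¹ 1ℚ) (0≤* (from-yes (0ℚ ≤? 2ℚ)) (0≤ι n))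

  0≤w : ∀ n → 0ℚ ≤ w n
  0≤w zero    = 0≤1
  0≤w (suc n) = 0≤* (0≤* (0≤* 0≤n+½ 0≤n+½) (0≤w n)) (0≤* (0≤inv n) (0≤inv n))
    where 0≤n+½ = 0≤+ (0≤ι n) 0≤½

  -- (1 + 2n) w n decreases, with ratio (2n + 1)(2n + 3) / (2n + 2)² of neighbours, while (1 + 4n) w
  -- n increases in `w-lower`. Both start at 1, which traps w n between 1 / (4n + 1) and 1 / (2n +
  -- 1).
  w-upper : ∀ n → (1ℚ + 2ℚ * ι n) * w n ≤ 1ℚ
  w-upper zero    = from-yes ((1ℚ + 2ℚ * 0ℚ) * 1ℚ ≤? 1ℚ)
  w-upper (suc n) = ≤-trans (*-cancelˡ-≤ (0<* (0<ι n) (0<ι n)) (begin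
    ι (suc n) * ι (suc n) * ((1ℚ + 2ℚ * ι (suc n)) * w (suc n))
      ≡⟨ s (ι (suc n)) (1ℚ + 2ℚ * ι (suc n)) (w (suc n)) ⟩
    (1ℚ + 2ℚ * ι (suc n)) * (ι (suc n) * ι (suc n) * w (suc n))
      ≡⟨ cong ((1ℚ + 2ℚ * ι (suc n)) *_) (w-step n) ⟩
    (1ℚ + 2ℚ * ι (suc n)) * ((ι n + ½) * (ι n + ½) * w n)
      ≤⟨ ≤-by ((½ * ι n + ¼) * w n) (0≤* (0≤+ (0≤* 0≤½ (0≤ι n)) (from-yes (0ℚ ≤? ¼))) (0≤w n)) (t (ι n) (w n)) ⟩
    ι (suc n) * ι (suc n) * ((1ℚ + 2ℚ * ι n) * w n) ∎))
    (w-upper n)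
    where
    open ≤-Reasoning
    s : ∀ a c w → a * a * (c * w) ≡ c * (a * a * w)
    s = solve-∀ ring
    t : ∀ n w → (1ℚ + n) * (1ℚ + n) * ((1ℚ + 2ℚ * n) * w) ≡
        (1ℚ + 2ℚ * (1ℚ + n)) * ((n + ½) * (n + ½) * w) + (½ * n + ¼) * w
    t = solve-∀ ring

  w-lower : ∀ n → 1ℚ ≤ (1ℚ + 4ℚ * ι n) * w n
  w-lower zero    = from-yes (1ℚ ≤? (1ℚ + 4ℚ * 0ℚ) * 1ℚ)
  w-lower (suc n) = ≤-trans (w-lower n) (*-cancelˡ-≤ (0<* (0<ι n) (0<ι n)) (begin
    ι (suc n) * ι (suc n) * ((1ℚ + 4ℚ * ι n) * w n)
      ≤⟨ ≤-by (¼ * w n) (0≤* (from-yes (0ℚ ≤? ¼)) (0≤w n)) (t (ι n) (w n)) ⟩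
    (1ℚ + 4ℚ * ι (suc n)) * ((ι n + ½) * (ι n + ½) * w n)
      ≡⟨ cong ((1ℚ + 4ℚ * ι (suc n)) *_) (w-step n) ⟨
    (1ℚ + 4ℚ * ι (suc n)) * (ι (suc n) * ι (suc n) * w (suc n))
      ≡⟨ s (ι (suc n)) (1ℚ + 4ℚ * ι (suc n)) (w (suc n)) ⟨
    ι (suc n) * ι (suc n) * ((1ℚ + 4ℚ * ι (suc n)) * w (suc n)) ∎))
    where
    open ≤-Reasoning
    s : ∀ a c w → a * a * (c * w) ≡ c * (a * a * w)
    s = solve-∀ ring
    t : ∀ n w → (1ℚ + 4ℚ * (1ℚ + n)) * ((n + ½) * (n + ½) * w) ≡
        (1ℚ + n) * (1ℚ + n) * ((1ℚ + 4ℚ * n) * w) + ¼ * w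
    t = solve-∀ ring

  -- r n m = n!² / ((n - m)! (n + m)!).

  r : ℕ → ℕ → ℚ
  r n zero    = 1ℚ
  r n (suc m) = r n m * (ι n - ι m) * inv (n ℕ.+ m)

  -- Origin of the weights: (1/x) times the product of k² / (k² - x²) over k from 1 to n has residue
  -- (-1)^m r n |m| at x = -m. At x = 1/2 the poles -m and m + 1 both contribute multiples of 1 /
  -- (2m + 1), so their coefficients r n m and r n (m + 1) add up.
  ρ : ℕ → ℕ → ℚ
  ρ n m = r n m + r n (suc m)

  r-step : ∀ n m → (ι n + ι (suc m)) * r n (suc m) ≡ (ι n - ι m) * r n m
  r-step n m = trans (s (ι n) (ι m) (r n m) (inv (n ℕ.+ m)))
    (trans (cong (λ u → (ι n - ι m) * r n m * ((1ℚ + u) * inv (n ℕ.+ m))) (sym (ι-+ n m)))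
    (trans (cong ((ι n - ι m) * r n m *_) (ι*inv (n ℕ.+ m))) (*-identityʳ _)))
    where
    s : ∀ n m r i → (n + (1ℚ + m)) * (r * (n - m) * i) ≡ (n - m) * r * ((1ℚ + (n + m)) * i)
    s = solve-∀ ring

  -- Cross-multiplied so that m > n is included, where n + 1 - m may vanish. The induction on m
  -- cancels only n + 1 + m, which is positive.
  r-lift : ∀ n m → (ι (suc n) - ι m) * (ι (suc n) + ι m) * r (suc n) m ≡ ι (suc n) * ι (suc n) * r n m
  r-lift n zero    = s (ι (suc n))
    where
    s : ∀ n → (n - 0ℚ) * (n + 0ℚ) * 1ℚ ≡ n * n * 1ℚ
    s = solve-∀ ring
  r-lift n (suc m) = *-cancelˡ-≡ (subst (0ℚ <_) (trans (cong (1ℚ +_) (ι-+ n m)) (+-comm₁ (ι n) (ι m))) (0<ι (n ℕ.+ m))) (begin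
    (N + ι m) * ((N - ι (suc m)) * (N + ι (suc m)) * r (suc n) (suc m))
      ≡⟨ s₁ N (ι m) (r (suc n) (suc m)) ⟩
    (N + ι m) * (N - ι (suc m)) * ((N + ι (suc m)) * r (suc n) (suc m))
      ≡⟨ cong ((N + ι m) * (N - ι (suc m)) *_) (r-step (suc n) m) ⟩
    (N + ι m) * (N - ι (suc m)) * ((N - ι m) * r (suc n) m)
      ≡⟨ s₂ (ι n) (ι m) (r (suc n) m) ⟩
    (ι n - ι m) * ((N - ι m) * (N + ι m) * r (suc n) m)
      ≡⟨ cong ((ι n - ι m) *_) (r-lift n m) ⟩
    (ι n - ι m) * (N * N * r n m)
      ≡⟨ s₃ (ι n - ι m) N (r n m) ⟩
    N * N * ((ι n - ι m) * r n m)
      ≡⟨ cong (N * N *_) (r-step n m) ⟨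
    N * N * ((ι n + ι (suc m)) * r n (suc m))
      ≡⟨ s₄ (ι n) (ι m) (r n (suc m)) ⟩
    (N + ι m) * (N * N * r n (suc m)) ∎)
    where
    open ≡-Reasoning
    N = ι (suc n)
    +-comm₁ : ∀ n m → 1ℚ + (n + m) ≡ (1ℚ + n) + m
    +-comm₁ = solve-∀ ring
    s₁ : ∀ N m r → (N + m) * ((N - (1ℚ + m)) * (N + (1ℚ + m)) * r) ≡ (N + m) * (N - (1ℚ + m)) * ((N + (1ℚ + m)) * r)
    s₁ = solve-∀ ring
    s₂ : ∀ n m r → ((1ℚ + n) + m) * ((1ℚ + n) - (1ℚ + m)) * (((1ℚ + n) - m) * r) ≡
         (n - m) * (((1ℚ + n) - m) * ((1ℚ + n) + m) * r)
    s₂ = solve-∀ ring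
    s₃ : ∀ a N r → a * (N * N * r) ≡ N * N * (a * r)
    s₃ = solve-∀ ring
    s₄ : ∀ n m r → (1ℚ + n) * (1ℚ + n) * ((n + (1ℚ + m)) * r) ≡ ((1ℚ + n) + m) * ((1ℚ + n) * (1ℚ + n) * r)
    s₄ = solve-∀ ring

  r-zero : ∀ n m → n ℕ.< m → r n m ≡ 0ℚ
  r-zero n (suc m) (s≤s n≤m) with ℕ.m≤n⇒m<n∨m≡n n≤m
  ... | inj₁ n<m  = trans (cong (λ u → u * (ι n - ι m) * inv (n ℕ.+ m)) (r-zero n m n<m)) (s (ι n - ι m) (inv (n ℕ.+ m)))
    where
    s : ∀ a i → 0ℚ * a * i ≡ 0ℚ
    s = solve-∀ ring
  ... | inj₂ refl = s (r n n) (ι n) (inv (n ℕ.+ n))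
    where
    s : ∀ r n i → r * (n - n) * i ≡ 0ℚ
    s = solve-∀ ring

  0≤r : ∀ n m → 0ℚ ≤ r n m
  0≤r n zero    = 0≤1
  0≤r n (suc m) with ℕ.≤-total m n
  ... | inj₁ m≤n = 0≤* (0≤* (0≤r n m) (p≤q⇒0≤q-p (ι-mono m≤n))) (0≤inv (n ℕ.+ m))
  ... | inj₂ n≤m = ≤-reflexive (sym (r-zero n (suc m) (s≤s n≤m)))

  r-drop : ∀ n m → r n m ≡ r n (suc m) + (1ℚ + 2ℚ * ι m) * (r n m * inv (n ℕ.+ m))
  r-drop n m = trans (sym (trans (cong (r n m *_) (ι*inv (n ℕ.+ m))) (*-identityʳ (r n m))))
    (trans (cong (λ u → r n m * ((1ℚ + u) * inv (n ℕ.+ m))) (ι-+ n m)) (s (r n m) (ι n) (ι m) (inv (n ℕ.+ m))))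
    where
    s : ∀ r n m i → r * ((1ℚ + (n + m)) * i) ≡ r * (n - m) * i + (1ℚ + 2ℚ * m) * (r * i)
    s = solve-∀ ring

  r-anti : ∀ n m → r n (suc m) ≤ r n m
  r-anti n m = ≤-by _ (0≤* (<⇒≤ (0<2n+1 m)) (0≤* (0≤r n m) (0≤inv (n ℕ.+ m)))) (r-drop n m)

  r≤1 : ∀ n m → r n m ≤ 1ℚ
  r≤1 n zero    = ≤-refl
  r≤1 n (suc m) = ≤-trans (r-anti n m) (r≤1 n m)

  -- By `r-drop` each step from m to m + 1 loses at most (2m + 1) / (n + 1), and the odd numbers sum
  -- to squares.
  1-r≤ : ∀ n m → 1ℚ - r n m ≤ ι m * ι m * inv n
  1-r≤ n zero    = ≤-reflexive (sym (s (inv n)))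
    where
    s : ∀ i → 0ℚ * 0ℚ * i ≡ 0ℚ
    s = solve-∀ ring
  1-r≤ n (suc m) = begin
    1ℚ - r n (suc m)
      ≡⟨ trans (s₁ (r n m) (r n (suc m)) drop (r-drop n m)) (+-comm drop _) ⟩
    (1ℚ - r n m) + drop
      ≤⟨ +-mono-≤ (1-r≤ n m) (*-monoʳ (<⇒≤ (0<2n+1 m)) (≤-trans (p≤1⇒p*q≤q (r≤1 n m) (0≤inv (n ℕ.+ m))) (Defs.1/suc-anti (ℕ.m≤m+n n m)))) ⟩
    ι m * ι m * inv n + (1ℚ + 2ℚ * ι m) * inv n
      ≡⟨ s₂ (ι m) (inv n) ⟩
    ι (suc m) * ι (suc m) * inv n ∎
    where
    open ≤-Reasoning
    drop = (1ℚ + 2ℚ * ι m) * (r n m * inv (n ℕ.+ m))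
    s₁ : ∀ a b d → a ≡ b + d → 1ℚ - b ≡ d + (1ℚ - a)
    s₁ _ b d refl = s b d
      where
      s : ∀ b d → 1ℚ - b ≡ d + (1ℚ - (b + d))
      s = solve-∀ ring
    s₂ : ∀ m i → m * m * i + (1ℚ + 2ℚ * m) * i ≡ (1ℚ + m) * (1ℚ + m) * i
    s₂ = solve-∀ ring

  odd*odd⁻¹ : ∀ m → (1ℚ + 2ℚ * ι m) * odd⁻¹ m ≡ 1ℚ
  odd*odd⁻¹ m = trans (cong (λ u → (1ℚ + u) * odd⁻¹ m) (sym (ι-* 2 m))) (ι*inv (2 ℕ.* m))

  -- Partial fractions of the Wallis product; r weights the terms of the Leibniz series.

  wallisSum : ℕ → ℕ → ℚ
  wallisSum n M = ∑< M λ m → leibnizTerm m * ρ n m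

  private
    -- Creative telescoping: the summand of the recurrence in n is a difference in m of multiples of
    -- σ m r. Here N is n + 1, σ the sign, o the value 1 / (2m + 1), while r, r′ and a, a′ are the
    -- values of `r` at m and m + 1 for n + 1 and for n.
    certificate : ∀ N m σ o r r′ a a′ → (1ℚ + 2ℚ * m) * o ≡ 1ℚ →
      (N - m) * (N + m) * r ≡ N * N * a → (N - (1ℚ + m)) * (N + (1ℚ + m)) * r′ ≡ N * N * a′ →
      (N + (1ℚ + m)) * r′ ≡ (N - m) * r →
      N * ((2ℚ * N - 1ℚ) * (2ℚ * N + 1ℚ) * (σ * o * (r + r′)) - 4ℚ * (N * N) * (σ * o * (a + a′))) ≡
      (2ℚ * N - 1ℚ) * ((- ((- σ) * (1ℚ + m) * r′)) - (- (σ * m * r)))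
    certificate N m σ o r r′ a a′ o≡ a≡ a′≡ r′≡ = begin
      N * ((2ℚ * N - 1ℚ) * (2ℚ * N + 1ℚ) * (σ * o * (r + r′)) - 4ℚ * (N * N) * (σ * o * (a + a′)))
        ≡⟨ s₁ N σ o r r′ a a′ ⟩
      N * ((2ℚ * N - 1ℚ) * (2ℚ * N + 1ℚ) * (σ * o * (r + r′)) - 4ℚ * (σ * o) * (N * N * a + N * N * a′))
        ≡⟨ cong₂ (λ u v → N * ((2ℚ * N - 1ℚ) * (2ℚ * N + 1ℚ) * (σ * o * (r + r′)) - 4ℚ * (σ * o) * (u + v))) (sym a≡) (sym a′≡) ⟩
      N * ((2ℚ * N - 1ℚ) * (2ℚ * N + 1ℚ) * (σ * o * (r + r′)) -
           4ℚ * (σ * o) * ((N - m) * (N + m) * r + (N - (1ℚ + m)) * (N + (1ℚ + m)) * r′))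
        ≡⟨ s₂ N m σ o r r′ ⟩
      N * σ * ((2ℚ * m - 1ℚ) * r + (2ℚ * m + (2ℚ + 1ℚ)) * r′) * ((1ℚ + 2ℚ * m) * o)
        ≡⟨ cong (N * σ * ((2ℚ * m - 1ℚ) * r + (2ℚ * m + (2ℚ + 1ℚ)) * r′) *_) o≡ ⟩
      N * σ * ((2ℚ * m - 1ℚ) * r + (2ℚ * m + (2ℚ + 1ℚ)) * r′) * 1ℚ
        ≡⟨ s₃ N m σ r r′ ⟩
      (2ℚ * N - 1ℚ) * ((- ((- σ) * (1ℚ + m) * r′)) - (- (σ * m * r))) + σ * ((N + (1ℚ + m)) * r′ - (N - m) * r)
        ≡⟨ cong (λ u → (2ℚ * N - 1ℚ) * ((- ((- σ) * (1ℚ + m) * r′)) - (- (σ * m * r))) + σ * (u - (N - m) * r)) r′≡ ⟩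
      (2ℚ * N - 1ℚ) * ((- ((- σ) * (1ℚ + m) * r′)) - (- (σ * m * r))) + σ * ((N - m) * r - (N - m) * r)
        ≡⟨ s₄ _ σ ((N - m) * r) ⟩
      (2ℚ * N - 1ℚ) * ((- ((- σ) * (1ℚ + m) * r′)) - (- (σ * m * r))) ∎
      where
      open ≡-Reasoning
      s₁ : ∀ N σ o r r′ a a′ →
        N * ((2ℚ * N - 1ℚ) * (2ℚ * N + 1ℚ) * (σ * o * (r + r′)) - 4ℚ * (N * N) * (σ * o * (a + a′))) ≡
        N * ((2ℚ * N - 1ℚ) * (2ℚ * N + 1ℚ) * (σ * o * (r + r′)) - 4ℚ * (σ * o) * (N * N * a + N * N * a′))
      s₁ = solve-∀ ring
      s₂ : ∀ N m σ o r r′ →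
        N * ((2ℚ * N - 1ℚ) * (2ℚ * N + 1ℚ) * (σ * o * (r + r′)) -
             4ℚ * (σ * o) * ((N - m) * (N + m) * r + (N - (1ℚ + m)) * (N + (1ℚ + m)) * r′)) ≡
        N * σ * ((2ℚ * m - 1ℚ) * r + (2ℚ * m + (2ℚ + 1ℚ)) * r′) * ((1ℚ + 2ℚ * m) * o)
      s₂ = solve-∀ ring
      s₃ : ∀ N m σ r r′ → N * σ * ((2ℚ * m - 1ℚ) * r + (2ℚ * m + (2ℚ + 1ℚ)) * r′) * 1ℚ ≡
        (2ℚ * N - 1ℚ) * ((- ((- σ) * (1ℚ + m) * r′)) - (- (σ * m * r))) + σ * ((N + (1ℚ + m)) * r′ - (N - m) * r)
      s₃ = solve-∀ ring
      s₄ : ∀ a σ x → a + σ * (x - x) ≡ a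
      s₄ = solve-∀ ring

  -- Summing `certificate` leaves only boundary terms: `H 0` vanishes by its factor `ι 0`, and `H M`
  -- by `r-zero`. Both sums are taken with n + 2 terms; for n the extra weight is zero.
  wallisSum-step : ∀ n → (1ℚ + 2ℚ * ι n) * (1ℚ + 2ℚ * ι (suc n)) * wallisSum (suc n) (suc (suc n)) ≡
    4ℚ * (ι (suc n) * ι (suc n)) * wallisSum n (suc n)
  wallisSum-step n = trans (s₀ (ι n) (wallisSum (suc n) M)) (trans (zero-diff (*-cancelˡ-≡ (0<ι n) (begin
    N * ((2ℚ * N - 1ℚ) * (2ℚ * N + 1ℚ) * wallisSum (suc n) M - 4ℚ * (N * N) * wallisSum n M)
      ≡⟨ cong (N *_) (cong₂ _-_ (sym (∑<-* M P F)) (sym (∑<-* M Q G))) ⟩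
    N * (∑< M (λ m → P * F m) - ∑< M (λ m → Q * G m))
      ≡⟨ cong (N *_) (trans (cong (∑< M (λ m → P * F m) +_) (neg≡ (∑< M (λ m → Q * G m))))
         (trans (cong (∑< M (λ m → P * F m) +_) (sym (∑<-* M (- 1ℚ) λ m → Q * G m))) (sym (∑<-+ M (λ m → P * F m) λ m → (- 1ℚ) * (Q * G m))))) ⟩
    N * ∑< M (λ m → P * F m + (- 1ℚ) * (Q * (leibnizTerm m * ρ n m)))
      ≡⟨ ∑<-* M N (λ m → P * F m + (- 1ℚ) * (Q * G m)) ⟨
    ∑< M (λ m → N * (P * F m + (- 1ℚ) * (Q * G m)))
      ≡⟨ ∑<-cong M (λ m _ → term m) ⟩
    ∑< M (λ m → (2ℚ * N - 1ℚ) * (H (suc m) - H m))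
      ≡⟨ trans (∑<-* M (2ℚ * N - 1ℚ) λ m → H (suc m) - H m) (cong ((2ℚ * N - 1ℚ) *_) (∑<-telescope M H)) ⟩
    (2ℚ * N - 1ℚ) * (H M - H 0)
      ≡⟨ cong (λ u → (2ℚ * N - 1ℚ) * ((- (sign M * ι M * u)) - H 0)) (r-zero (suc n) M ℕ.≤-refl) ⟩
    (2ℚ * N - 1ℚ) * ((- (sign M * ι M * 0ℚ)) - H 0)
      ≡⟨ s₁ (2ℚ * N - 1ℚ) (sign M * ι M) N ⟩
    N * 0ℚ ∎)))
    (cong (4ℚ * (N * N) *_) last))
    where
    open ≡-Reasoning
    M = suc (suc n)
    N = ι (suc n)
    P = (2ℚ * N - 1ℚ) * (2ℚ * N + 1ℚ)
    Q = 4ℚ * (N * N)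
    F G H : ℕ → ℚ
    F m = leibnizTerm m * ρ (suc n) m
    G m = leibnizTerm m * ρ n m
    H m = - (sign m * ι m * r (suc n) m)
    neg≡ : ∀ x → - x ≡ (- 1ℚ) * x
    neg≡ = solve-∀ ring
    s₀ : ∀ n x → (1ℚ + 2ℚ * n) * (1ℚ + 2ℚ * (1ℚ + n)) * x ≡ (2ℚ * (1ℚ + n) - 1ℚ) * (2ℚ * (1ℚ + n) + 1ℚ) * x
    s₀ = solve-∀ ring
    s₁ : ∀ a b N → a * ((- (b * 0ℚ)) - (- (1ℚ * 0ℚ * 1ℚ))) ≡ N * 0ℚ
    s₁ = solve-∀ ring
    zero-diff : ∀ {x y} → x - y ≡ 0ℚ → x ≡ y
    zero-diff {x} {y} eq = trans (s x y) (trans (cong (_+ y) eq) (+-identityˡ y))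
      where
      s : ∀ x y → x ≡ (x - y) + y
      s = solve-∀ ring
    term : ∀ m → N * (P * F m + (- 1ℚ) * (Q * G m)) ≡
      (2ℚ * N - 1ℚ) * (H (suc m) - H m)
    term m = trans (cong (λ t → N * (P * (t * ρ (suc n) m) + (- 1ℚ) * (Q * (t * ρ n m)))) (leibnizTerm≡ m))
      (trans (cong (λ u → N * (P * (sign m * odd⁻¹ m * ρ (suc n) m) + u)) (sym (neg≡ (Q * (sign m * odd⁻¹ m * ρ n m)))))
      (certificate N (ι m) (sign m) (odd⁻¹ m) (r (suc n) m) (r (suc n) (suc m)) (r n m) (r n (suc m))
        (odd*odd⁻¹ m) (r-lift n m) (r-lift n (suc m)) (r-step (suc n) m)))
    last : wallisSum n M ≡ wallisSum n (suc n)
    last = trans (∑<-last (suc n) G) (trans (cong (λ u → wallisSum n (suc n) + leibnizTerm (suc n) * u)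
      (cong₂ _+_ (r-zero n (suc n) ℕ.≤-refl) (r-zero n (suc (suc n)) (ℕ.m≤n⇒m≤1+n ℕ.≤-refl))))
      (s (wallisSum n (suc n)) (leibnizTerm (suc n))))
      where
      s : ∀ a t → a + t * (0ℚ + 0ℚ) ≡ a
      s = solve-∀ ring

  wallis : ∀ n → (1ℚ + 2ℚ * ι n) * w n * wallisSum n (suc n) ≡ 1ℚ
  wallis zero    = refl
  wallis (suc n) = *-cancelˡ-≡ (0<2n+1 n) (begin
    o * (o′ * w (suc n) * wallisSum (suc n) (suc (suc n)))
      ≡⟨ s₁ o o′ (w (suc n)) (wallisSum (suc n) (suc (suc n))) ⟩
    w (suc n) * (o * o′ * wallisSum (suc n) (suc (suc n)))
      ≡⟨ cong (w (suc n) *_) (wallisSum-step n) ⟩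
    w (suc n) * (4ℚ * (ι (suc n) * ι (suc n)) * wallisSum n (suc n))
      ≡⟨ s₂ (w (suc n)) (ι (suc n)) (wallisSum n (suc n)) ⟩
    4ℚ * (ι (suc n) * ι (suc n) * w (suc n)) * wallisSum n (suc n)
      ≡⟨ cong (λ u → 4ℚ * u * wallisSum n (suc n)) (w-step n) ⟩
    4ℚ * ((ι n + ½) * (ι n + ½) * w n) * wallisSum n (suc n)
      ≡⟨ s₃ (ι n) (w n) (wallisSum n (suc n)) ⟩
    o * (o * w n * wallisSum n (suc n))
      ≡⟨ cong (o *_) (wallis n) ⟩
    o * 1ℚ ∎)
    where
    open ≡-Reasoning
    o  = 1ℚ + 2ℚ * ι n
    o′ = 1ℚ + 2ℚ * ι (suc n)
    s₁ : ∀ o o′ w A → o * (o′ * w * A) ≡ w * (o * o′ * A)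
    s₁ = solve-∀ ring
    s₂ : ∀ w N A → w * (4ℚ * (N * N) * A) ≡ 4ℚ * (N * N * w) * A
    s₂ = solve-∀ ring
    s₃ : ∀ n w A → 4ℚ * ((n + ½) * (n + ½) * w) * A ≡ (1ℚ + 2ℚ * n) * ((1ℚ + 2ℚ * n) * w * A)
    s₃ = solve-∀ ring

  sign-+ : ∀ m n → sign (m ℕ.+ n) ≡ sign m * sign n
  sign-+ zero    n = sym (*-identityˡ (sign n))
  sign-+ (suc m) n = trans (cong -_ (sign-+ m n)) (s (sign m) (sign n))
    where
    s : ∀ a b → - (a * b) ≡ (- a) * b
    s = solve-∀ ring

  alternating : ∀ n f → (∀ i → 0ℚ ≤ f i) → (∀ i → f (suc i) ≤ f i) →
    0ℚ ≤ ∑< n (λ i → sign i * f i) × ∑< n (λ i → sign i * f i) ≤ f 0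
  alternating zero    f 0≤f anti = ≤-refl , 0≤f 0
  alternating (suc n) f 0≤f anti = subst (λ u → 0ℚ ≤ u × u ≤ f 0) (sym split)
    (p≤q⇒0≤q-p (≤-trans (proj₂ ih) (anti 0)) , Defs.p-q≤p (proj₁ ih))
    where
    s : ∀ x → (- 1ℚ) * x ≡ - x
    s = solve-∀ ring
    s′ : ∀ a b → (- a) * b ≡ (- 1ℚ) * (a * b)
    s′ = solve-∀ ring
    ih = alternating n (λ i → f (suc i)) (λ i → 0≤f (suc i)) (λ i → anti (suc i))
    split : ∑< (suc n) (λ i → sign i * f i) ≡ f 0 - ∑< n (λ i → sign i * f (suc i))
    split = cong₂ _+_ (*-identityˡ (f 0)) (trans (∑<-cong n λ i _ → s′ (sign i) (f (suc i)))
      (trans (∑<-* n (- 1ℚ) _) (s _)))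

  alternating-tail : ∀ K n f → (∀ i → 0ℚ ≤ f i) → (∀ i → f (suc i) ≤ f i) →
    ∣ ∑< n (λ i → sign (K ℕ.+ i) * f (K ℕ.+ i)) ∣ ≤ f K
  alternating-tail K n f 0≤f anti = begin
    ∣ ∑< n (λ i → sign (K ℕ.+ i) * f (K ℕ.+ i)) ∣
      ≡⟨ cong ∣_∣ (trans (∑<-cong n λ i _ → trans (cong (_* f (K ℕ.+ i)) (sign-+ K i)) (*-assoc (sign K) (sign i) _)) (∑<-* n (sign K) _)) ⟩
    ∣ sign K * ∑< n (λ i → sign i * f (K ℕ.+ i)) ∣
      ≡⟨ trans (∣sign∣ K _) (0≤p⇒∣p∣≡p (proj₁ bounds)) ⟩
    ∑< n (λ i → sign i * f (K ℕ.+ i))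
      ≤⟨ proj₂ bounds ⟩
    f (K ℕ.+ 0)
      ≡⟨ cong f (ℕ.+-identityʳ K) ⟩
    f K ∎
    where
    open ≤-Reasoning
    bounds = alternating n (λ i → f (K ℕ.+ i)) (λ i → 0≤f (K ℕ.+ i))
      (λ i → subst (λ k → f k ≤ f (K ℕ.+ i)) (sym (ℕ.+-suc K i)) (anti (K ℕ.+ i)))

  ∣leibnizTerm∣≤1 : ∀ m → ∣ leibnizTerm m ∣ ≤ 1ℚ
  ∣leibnizTerm∣≤1 m = subst (_≤ 1ℚ) (sym (trans (cong ∣_∣ (leibnizTerm≡ m))
    (trans (∣sign∣ m (odd⁻¹ m)) (0≤p⇒∣p∣≡p (0≤odd⁻¹ m))))) (inv≤1 (2 ℕ.* m))

  leibnizSum≡∑ : ∀ n → leibnizSum n ≡ ∑< n leibnizTerm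
  leibnizSum≡∑ zero    = refl
  leibnizSum≡∑ (suc n) = trans (cong (_+ leibnizTerm n) (leibnizSum≡∑ n)) (sym (∑<-last n leibnizTerm))

  -- Split at K. Each of the first K weights falls short of 2 by at most 2 K² / (n + 1). Beyond K
  -- both series alternate with decreasing terms, so each tail is bounded by its first term.
  wallisSum-close : ∀ K d → let n = K ℕ.+ d in
    ∣ wallisSum n (suc n) - 2ℚ * leibnizSum n ∣ ≤ 2ℚ * (ι K * ι K * ι K) * inv n + 4ℚ * inv K
  wallisSum-close K d = begin
    ∣ wallisSum n (suc n) - 2ℚ * leibnizSum n ∣
      ≡⟨ cong ∣_∣ (trans (cong (_- 2ℚ * leibnizSum n) split) (s₁ head tail′ (leibnizSum n) (leibnizSum K))) ⟩
    ∣ (head + (- 2ℚ) * leibnizSum K) + (tail′ + (- 2ℚ) * (leibnizSum n - leibnizSum K)) ∣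
      ≤⟨ ∣p+q∣≤∣p∣+∣q∣ (head + (- 2ℚ) * leibnizSum K) _ ⟩
    ∣ head + (- 2ℚ) * leibnizSum K ∣ + ∣ tail′ + (- 2ℚ) * (leibnizSum n - leibnizSum K) ∣
      ≤⟨ +-mono-≤ head≤ (≤-trans (∣p+q∣≤∣p∣+∣q∣ tail′ _) (+-mono-≤ tail≤ (∣∣-*-bound {p = - 2ℚ} (leibnizSum-close (ℕ.m≤m+n K d))))) ⟩
    ι K * ((ι K * ι K + ι K * ι K) * inv n) + (odd⁻¹ K * 2ℚ + 2ℚ * odd⁻¹ K)
      ≡⟨ s₂ (ι K) (inv n) (odd⁻¹ K) ⟩
    2ℚ * (ι K * ι K * ι K) * inv n + 4ℚ * odd⁻¹ K
      ≤⟨ +-monoʳ-≤ (2ℚ * (ι K * ι K * ι K) * inv n) (*-monoʳ (from-yes (0ℚ ≤? 4ℚ)) (Defs.1/suc-anti (ℕ.m≤m+n K (K ℕ.+ 0)))) ⟩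
    2ℚ * (ι K * ι K * ι K) * inv n + 4ℚ * inv K ∎
    where
    open ≤-Reasoning
    n = K ℕ.+ d
    head  = ∑< K λ m → leibnizTerm m * ρ n m
    tail′ = ∑< (suc d) λ i → leibnizTerm (K ℕ.+ i) * ρ n (K ℕ.+ i)
    split : wallisSum n (suc n) ≡ head + tail′
    split = trans (cong (wallisSum n) (sym (ℕ.+-suc K d))) (∑<-split K (suc d) λ m → leibnizTerm m * ρ n m)
    s₁ : ∀ a b x y → a + b - 2ℚ * x ≡ (a + (- 2ℚ) * y) + (b + (- 2ℚ) * (x - y))
    s₁ = solve-∀ ring
    s₂ : ∀ k i o → k * ((k * k + k * k) * i) + (o * 2ℚ + 2ℚ * o) ≡ 2ℚ * (k * k * k) * i + 4ℚ * o
    s₂ = solve-∀ ring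
    ρ≤2 : ∀ m → ρ n m ≤ 2ℚ
    ρ≤2 m = +-mono-≤ (r≤1 n m) (r≤1 n (suc m))
    0≤ρ : ∀ m → 0ℚ ≤ ρ n m
    0≤ρ m = 0≤+ (0≤r n m) (0≤r n (suc m))
    tail≤ : ∣ tail′ ∣ ≤ odd⁻¹ K * 2ℚ
    tail≤ = begin
      ∣ tail′ ∣
        ≡⟨ cong ∣_∣ (∑<-cong (suc d) λ i _ → trans (cong (_* ρ n (K ℕ.+ i)) (leibnizTerm≡ (K ℕ.+ i))) (*-assoc (sign (K ℕ.+ i)) _ _)) ⟩
      ∣ ∑< (suc d) (λ i → sign (K ℕ.+ i) * (odd⁻¹ (K ℕ.+ i) * ρ n (K ℕ.+ i))) ∣
        ≤⟨ alternating-tail K (suc d) (λ m → odd⁻¹ m * ρ n m) (λ m → 0≤* (0≤odd⁻¹ m) (0≤ρ m))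
             (λ m → *-mono (0≤odd⁻¹ (suc m)) (0≤ρ m) (odd⁻¹-anti (ℕ.n≤1+n m)) (+-mono-≤ (r-anti n m) (r-anti n (suc m)))) ⟩
      odd⁻¹ K * ρ n K
        ≤⟨ *-monoʳ (0≤odd⁻¹ K) (ρ≤2 K) ⟩
      odd⁻¹ K * 2ℚ ∎
    deficit : ∀ m → m ℕ.< K → ∣ leibnizTerm m * ρ n m + (- 2ℚ) * leibnizTerm m ∣ ≤ (ι K * ι K + ι K * ι K) * inv n
    deficit m m<K = begin
      ∣ leibnizTerm m * ρ n m + (- 2ℚ) * leibnizTerm m ∣
        ≡⟨ cong ∣_∣ (s (leibnizTerm m) (r n m) (r n (suc m))) ⟩
      ∣ (- leibnizTerm m) * ((1ℚ - r n m) + (1ℚ - r n (suc m))) ∣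
        ≡⟨ trans (∣p*q∣≡∣p∣*∣q∣ (- leibnizTerm m) _) (cong₂ _*_ (∣-p∣≡∣p∣ (leibnizTerm m)) (0≤p⇒∣p∣≡p 0≤gap)) ⟩
      ∣ leibnizTerm m ∣ * ((1ℚ - r n m) + (1ℚ - r n (suc m)))
        ≤⟨ p≤1⇒p*q≤q (∣leibnizTerm∣≤1 m) 0≤gap ⟩
      (1ℚ - r n m) + (1ℚ - r n (suc m))
        ≤⟨ +-mono-≤ (gap m (ℕ.<⇒≤ m<K)) (gap (suc m) m<K) ⟩
      ι K * ι K * inv n + ι K * ι K * inv n
        ≡⟨ *-distribʳ-+ (inv n) (ι K * ι K) (ι K * ι K) ⟨
      (ι K * ι K + ι K * ι K) * inv n ∎
      where
      0≤gap = 0≤+ (p≤q⇒0≤q-p (r≤1 n m)) (p≤q⇒0≤q-p (r≤1 n (suc m)))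
      gap : ∀ m → m ℕ.≤ K → 1ℚ - r n m ≤ ι K * ι K * inv n
      gap m m≤K = ≤-trans (1-r≤ n m) (*-monoˡ (0≤inv n) (*-mono (0≤ι m) (0≤ι K) (ι-mono m≤K) (ι-mono m≤K)))
      s : ∀ t a b → t * (a + b) + (- 2ℚ) * t ≡ (- t) * ((1ℚ - a) + (1ℚ - b))
      s = solve-∀ ring
    ∑<-const : ∀ n c → ∑< n (λ _ → c) ≡ ι n * c
    ∑<-const zero    c = sym (*-zeroˡ c)
    ∑<-const (suc n) c = trans (cong (c +_) (∑<-const n c)) (s (ι n) c)
      where
      s : ∀ n c → c + n * c ≡ (1ℚ + n) * c
      s = solve-∀ ring
    head≤ : ∣ head + (- 2ℚ) * leibnizSum K ∣ ≤ ι K * ((ι K * ι K + ι K * ι K) * inv n)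
    head≤ = begin
      ∣ head + (- 2ℚ) * leibnizSum K ∣
        ≡⟨ cong ∣_∣ (trans (cong (λ u → head + (- 2ℚ) * u) (leibnizSum≡∑ K))
           (trans (cong (head +_) (sym (∑<-* K (- 2ℚ) leibnizTerm))) (sym (∑<-+ K _ _)))) ⟩
      ∣ ∑< K (λ m → leibnizTerm m * ρ n m + (- 2ℚ) * leibnizTerm m) ∣
        ≤⟨ ∑<-∣∣ K _ ⟩
      ∑< K (λ m → ∣ leibnizTerm m * ρ n m + (- 2ℚ) * leibnizTerm m ∣)
        ≤⟨ ∑<-mono K deficit ⟩
      ∑< K (λ m → (ι K * ι K + ι K * ι K) * inv n)
        ≡⟨ ∑<-const K _ ⟩
      ι K * ((ι K * ι K + ι K * ι K) * inv n) ∎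

  wallisSum-null : Null (λ n → wallisSum n (suc n) - 2ℚ * leibnizSum n)
  wallisSum-null = Null-by-inv (1ℚ + 4ℚ) (from-yes (0ℚ <? 1ℚ + 4ℚ)) λ K →
    -- From this N on, the first error term 2 K³ / (n + 1) is at most 1 / (K + 1).
    let N = suc K ℕ.* (2 ℕ.* (K ℕ.* K ℕ.* K)) in
    K ℕ.+ N , λ n ≤n → begin
      ∣ wallisSum n (suc n) - 2ℚ * leibnizSum n ∣
        ≤⟨ subst (λ n → ∣ wallisSum n (suc n) - 2ℚ * leibnizSum n ∣ ≤ 2ℚ * (ι K * ι K * ι K) * inv n + 4ℚ * inv K)
             (ℕ.m+[n∸m]≡n (ℕ.≤-trans (ℕ.m≤m+n K N) ≤n)) (wallisSum-close K (n ℕ.∸ K)) ⟩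
      2ℚ * (ι K * ι K * ι K) * inv n + 4ℚ * inv K
        ≤⟨ +-monoˡ-≤ (4ℚ * inv K) (≤*inv K (begin
             ι (suc K) * (2ℚ * (ι K * ι K * ι K) * inv n)
               ≡⟨ *-assoc (ι (suc K)) (2ℚ * (ι K * ι K * ι K)) (inv n) ⟨
             ι (suc K) * (2ℚ * (ι K * ι K * ι K)) * inv n
               ≡⟨ cong (_* inv n) (trans (ι-* (suc K) (2 ℕ.* (K ℕ.* K ℕ.* K))) (cong (ι (suc K) *_)
                    (trans (ι-* 2 (K ℕ.* K ℕ.* K)) (cong (2ℚ *_) (trans (ι-* (K ℕ.* K) K) (cong (_* ι K) (ι-* K K))))))) ⟨
             ι N * inv n
               ≤⟨ *-monoˡ (0≤inv n) (ι-mono (ℕ.≤-trans (ℕ.≤-trans (ℕ.m≤n+m N K) ≤n) (ℕ.n≤1+n n))) ⟩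
             ι (suc n) * inv n
               ≡⟨ ι*inv n ⟩
             1ℚ ∎)) ⟩
      1ℚ * inv K + 4ℚ * inv K
        ≡⟨ *-distribʳ-+ (inv K) 1ℚ 4ℚ ⟨
      (1ℚ + 4ℚ) * inv K ∎
    where open ≤-Reasoning

  -- The normalised squared Catalan numbers b n = (Cat n / 4ⁿ)² and u n = n b n.

  b : ℕ → ℚ
  b n = w n * (inv n * inv n)

  u : ℕ → ℚ
  u n = ι n * b n

  0≤b : ∀ n → 0ℚ ≤ b n
  0≤b n = 0≤* (0≤w n) (0≤* (0≤inv n) (0≤inv n))

  0≤u : ∀ n → 0ℚ ≤ u n
  0≤u n = 0≤* (0≤ι n) (0≤b n)

  b*≡w : ∀ n → ι (suc n) * ι (suc n) * b n ≡ w n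
  b*≡w n = trans (s (ι (suc n)) (w n) (inv n)) (trans (cong₂ (λ x y → w n * (x * y)) (ι*inv n) (ι*inv n)) (*-identityʳ (w n)))
    where
    s : ∀ a w i → a * a * (w * (i * i)) ≡ w * ((a * i) * (a * i))
    s = solve-∀ ring

  -- Polynomial decay costs only a bounded factor when the index at most doubles: 4 from comparing
  -- 4n + 1 with 2k + 1 in the bounds on `w`, and 4 from (n + 1)² against (k + 1)².
  b-double : ∀ {j k} → j ℕ.≤ k → b k ≤ 16ℚ * b (j ℕ.+ k)
  b-double {j} {k} j≤k = *-cancelˡ-≤ 0<c (begin
    c * b k
      ≡⟨ trans (*-assoc o (K * K) (b k)) (cong (o *_) (b*≡w k)) ⟩
    o * w k
      ≤⟨ ≤-trans (w-upper k) (w-lower n) ⟩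
    (1ℚ + 4ℚ * ι n) * w n
      ≡⟨ cong ((1ℚ + 4ℚ * ι n) *_) (b*≡w n) ⟨
    (1ℚ + 4ℚ * ι n) * (ι (suc n) * ι (suc n) * b n)
      ≤⟨ *-mono 0≤1+4n (0≤* (0≤* 0≤2K 0≤2K) (0≤b n)) o-mono (*-monoˡ (0≤b n) (*-mono (0≤ι (suc n)) 0≤2K N-mono N-mono)) ⟩
    (4ℚ * o) * ((2ℚ * K) * (2ℚ * K) * b n)
      ≡⟨ s o K (b n) ⟩
    c * (16ℚ * b n) ∎)
    where
    open ≤-Reasoning
    n = j ℕ.+ k
    K = ι (suc k)
    o = 1ℚ + 2ℚ * ι k
    c = o * (K * K)
    0<c : 0ℚ < c
    0<c = 0<* (0<2n+1 k) (0<* (0<ι k) (0<ι k))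
    0≤2K : 0ℚ ≤ 2ℚ * K
    0≤2K = 0≤* (from-yes (0ℚ ≤? 2ℚ)) (0≤ι (suc k))
    0≤1+4n : 0ℚ ≤ 1ℚ + 4ℚ * ι n
    0≤1+4n = 0≤+ 0≤1 (0≤* (from-yes (0ℚ ≤? 4ℚ)) (0≤ι n))
    gap : 0ℚ ≤ ι k - ι j
    gap = p≤q⇒0≤q-p (ι-mono j≤k)
    s : ∀ o K b → (4ℚ * o) * ((2ℚ * K) * (2ℚ * K) * b) ≡ o * (K * K) * (16ℚ * b)
    s = solve-∀ ring
    o-mono : 1ℚ + 4ℚ * ι n ≤ 4ℚ * o
    o-mono = ≤-by ((2ℚ + 1ℚ) + 4ℚ * (ι k - ι j)) (0≤+ (from-yes (0ℚ ≤? 2ℚ + 1ℚ)) (0≤* (from-yes (0ℚ ≤? 4ℚ)) gap))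
      (trans (t (ι j) (ι k)) (cong (λ x → 1ℚ + 4ℚ * x + ((2ℚ + 1ℚ) + 4ℚ * (ι k - ι j))) (sym (ι-+ j k))))
      where
      t : ∀ j k → 4ℚ * (1ℚ + 2ℚ * k) ≡ 1ℚ + 4ℚ * (j + k) + ((2ℚ + 1ℚ) + 4ℚ * (k - j))
      t = solve-∀ ring
    N-mono : ι (suc n) ≤ 2ℚ * K
    N-mono = ≤-by (1ℚ + (ι k - ι j)) (0≤+ 0≤1 gap)
      (trans (t (ι j) (ι k)) (cong (λ x → 1ℚ + x + (1ℚ + (ι k - ι j))) (sym (ι-+ j k))))
      where
      t : ∀ j k → 2ℚ * (1ℚ + k) ≡ 1ℚ + (j + k) + (1ℚ + (k - j))
      t = solve-∀ ring

  -- The larger index is at least half of j + k, so `b-double` applies to that factor. Convolutions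
  -- are thereby dominated by terms in which one index is small.
  b*b≤ : ∀ j k → b j * b k ≤ 16ℚ * b (j ℕ.+ k) * (b j + b k)
  b*b≤ j k with ℕ.≤-total j k
  ... | inj₁ j≤k = ≤-trans (*-monoʳ (0≤b j) (b-double j≤k))
    (≤-by (16ℚ * b (j ℕ.+ k) * b k) (0≤* (0≤* (from-yes (0ℚ ≤? 16ℚ)) (0≤b (j ℕ.+ k))) (0≤b k)) (s (b (j ℕ.+ k)) (b j) (b k)))
    where
    s : ∀ n j k → 16ℚ * n * (j + k) ≡ j * (16ℚ * n) + 16ℚ * n * k
    s = solve-∀ ring
  ... | inj₂ k≤j = ≤-trans (*-monoˡ (0≤b k) (subst (λ n → b j ≤ 16ℚ * b n) (ℕ.+-comm k j) (b-double k≤j)))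
    (≤-by (16ℚ * b (j ℕ.+ k) * b j) (0≤* (0≤* (from-yes (0ℚ ≤? 16ℚ)) (0≤b (j ℕ.+ k))) (0≤b j)) (s (b (j ℕ.+ k)) (b j) (b k)))
    where
    s : ∀ n j k → 16ℚ * n * (j + k) ≡ 16ℚ * n * k + 16ℚ * n * j
    s = solve-∀ ring

  inv-diff : ∀ k → inv k - inv (suc k) ≡ inv k * inv (suc k)
  inv-diff k = *-cancelˡ-≡ (0<* (0<ι k) (0<ι (suc k))) (trans
    (s₁ (ι (suc k)) (ι (suc (suc k))) (inv k) (inv (suc k)))
    (trans (cong₂ (λ x y → x * ι (suc (suc k)) - ι (suc k) * y) (ι*inv k) (ι*inv (suc k)))
    (trans (s₂ (ι k)) (trans (sym (cong₂ _*_ (ι*inv k) (ι*inv (suc k))))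
    (s₃ (ι (suc k)) (ι (suc (suc k))) (inv k) (inv (suc k)))))))
    where
    s₁ : ∀ a c i j → a * c * (i - j) ≡ (a * i) * c - a * (c * j)
    s₁ = solve-∀ ring
    s₂ : ∀ k → 1ℚ * (1ℚ + (1ℚ + k)) - (1ℚ + k) * 1ℚ ≡ 1ℚ * 1ℚ
    s₂ = solve-∀ ring
    s₃ : ∀ a c i j → (a * i) * (c * j) ≡ a * c * (i * j)
    s₃ = solve-∀ ring

  -- As w (k + 1) is at most 1 / (2 (k + 1)), u (k + 1) lies below 1 / (2 (k + 1)(k + 2)), whose
  -- sums telescope.
  u≤step : ∀ k → u (suc k) ≤ ½ * (inv k - inv (suc k))
  u≤step k = begin
    N * (w (suc k) * (i′ * i′))
      ≤⟨ ≤-by (w (suc k) * i′ * i′) (0≤* (0≤* (0≤w (suc k)) (0≤inv (suc k))) (0≤inv (suc k))) (s₁ N (w (suc k)) i′) ⟩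
    (w (suc k) * i′) * (ι (suc (suc k)) * i′)
      ≡⟨ trans (cong (w (suc k) * i′ *_) (ι*inv (suc k))) (*-identityʳ _) ⟩
    w (suc k) * i′
      ≤⟨ *-monoˡ (0≤inv (suc k)) w≤ ⟩
    ½ * inv k * i′
      ≡⟨ trans (*-assoc ½ (inv k) i′) (cong (½ *_) (sym (inv-diff k))) ⟩
    ½ * (inv k - inv (suc k)) ∎
    where
    open ≤-Reasoning
    N = ι (suc k)
    i′ = inv (suc k)
    s₁ : ∀ N w i → (w * i) * ((1ℚ + N) * i) ≡ N * (w * (i * i)) + w * i * i
    s₁ = solve-∀ ring
    s₂ : ∀ N w → (1ℚ + 2ℚ * N) * w ≡ N * (2ℚ * w) + w
    s₂ = solve-∀ ring
    s₃ : ∀ w → w ≡ ½ * (2ℚ * w)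
    s₃ = solve-∀ ring
    w≤ : w (suc k) ≤ ½ * inv k
    w≤ = begin
      w (suc k)           ≡⟨ s₃ (w (suc k)) ⟩
      ½ * (2ℚ * w (suc k)) ≤⟨ *-monoʳ 0≤½ (≤*inv k (≤-trans (≤-by (w (suc k)) (0≤w (suc k)) (s₂ N (w (suc k)))) (w-upper (suc k)))) ⟩
      ½ * (1ℚ * inv k)    ≡⟨ cong (½ *_) (*-identityˡ (inv k)) ⟩
      ½ * inv k           ∎

  b≤step : ∀ k → b (suc k) ≤ ½ * (inv k - inv (suc k))
  b≤step k = ≤-trans (≤-by (ι k * b (suc k)) (0≤* (0≤ι k) (0≤b (suc k))) (s (ι k) (b (suc k)))) (u≤step k)
    where
    s : ∀ k b → (1ℚ + k) * b ≡ b + k * b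
    s = solve-∀ ring

  -- The tail estimate for `b` and `u`. In `β≤` it is applied from J = 1, giving 1/4, and b 1 = 1/16
  -- is added exactly: hence 5/16.
  ∑step≤ : ∀ J M (f : ℕ → ℚ) → (∀ k → f (suc k) ≤ ½ * (inv k - inv (suc k))) →
    ∑< M (λ i → f (suc (J ℕ.+ i))) ≤ ½ * inv J
  ∑step≤ J zero    f f≤ = 0≤* 0≤½ (0≤inv J)
  ∑step≤ J (suc M) f f≤ = begin
    f (suc (J ℕ.+ 0)) + ∑< M (λ i → f (suc (J ℕ.+ suc i)))
      ≡⟨ cong₂ _+_ (cong (λ k → f (suc k)) (ℕ.+-identityʳ J)) (∑<-cong M λ i _ → cong (λ k → f (suc k)) (ℕ.+-suc J i)) ⟩
    f (suc J) + ∑< M (λ i → f (suc (suc J ℕ.+ i)))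
      ≤⟨ +-mono-≤ (f≤ J) (∑step≤ (suc J) M f f≤) ⟩
    ½ * (inv J - inv (suc J)) + ½ * inv (suc J)
      ≡⟨ s (inv J) (inv (suc J)) ⟩
    ½ * inv J ∎
    where
    open ≤-Reasoning
    s : ∀ a c → ½ * (a - c) + ½ * c ≡ ½ * a
    s = solve-∀ ring

  ∑u≤½ : ∀ M → ∑< (suc M) u ≤ ½
  ∑u≤½ M = begin
    u 0 + ∑< M (λ i → u (suc i))   ≡⟨ cong (_+ ∑< M (λ i → u (suc i))) (*-zeroˡ (b 0)) ⟩
    0ℚ + ∑< M (λ i → u (suc i))    ≡⟨ +-identityˡ _ ⟩
    ∑< M (λ i → u (suc i))         ≤⟨ ∑step≤ 0 M u u≤step ⟩
    ½ * inv 0                      ≡⟨⟩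
    ½                              ∎
    where open ≤-Reasoning

  -- Starts at b 1, because b 0 = 1 is the coefficient of the unknown γ n itself in the convolution.
  β : ℕ → ℚ
  β J = ∑< J λ l → b (suc l)

  0≤β : ∀ J → 0ℚ ≤ β J
  0≤β J = ∑<-nonneg J λ l → 0≤b (suc l)

  -- With the factor u (n - l) / u n ≤ 3/2, a bound ≤ 1/3 makes the recursion for y below contract by 1/2.
  β≤ : ∀ J → β J ≤ ℤ.+ 5 / 16
  β≤ zero    = from-yes (0ℚ ≤? ℤ.+ 5 / 16)
  β≤ (suc J) = ≤-trans (+-monoʳ-≤ (b 1) (∑step≤ 1 J b b≤step)) (from-yes (b 1 + ½ * inv 1 ≤? ℤ.+ 5 / 16))

  -- u n is of order 1 / n². Growth of n (n + 1) u n, together with the decrease of u in `u-anti`,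
  -- confines the ratio of u (n - l) to u n for bounded l.
  u-grow : ∀ n → ι n * ι (suc n) * u n ≤ ι (suc n) * ι (suc (suc n)) * u (suc n)
  u-grow n = *-cancelˡ-≤ (0<ι (suc n)) (begin
    ι (suc (suc n)) * (ι n * ι (suc n) * (ι n * b n))
      ≤⟨ ≤-by ((1ℚ + ¼) * ι n * (ι (suc n) * b n) + ¼ * (ι (suc n) * b n)) (0≤+ (0≤* (0≤* (from-yes (0ℚ ≤? 1ℚ + ¼)) (0≤ι n)) 0≤Nb) (0≤* (from-yes (0ℚ ≤? ¼)) 0≤Nb)) (s₁ (ι n) (b n)) ⟩
    (ι n + ½) * (ι n + ½) * (ι (suc n) * ι (suc n) * b n)
      ≡⟨ cong ((ι n + ½) * (ι n + ½) *_) (b*≡w n) ⟩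
    (ι n + ½) * (ι n + ½) * w n
      ≡⟨ w-step n ⟨
    ι (suc n) * ι (suc n) * w (suc n)
      ≡⟨ cong (ι (suc n) * ι (suc n) *_) (b*≡w (suc n)) ⟨
    ι (suc n) * ι (suc n) * (ι (suc (suc n)) * ι (suc (suc n)) * b (suc n))
      ≡⟨ s₂ (ι (suc n)) (ι (suc (suc n))) (b (suc n)) ⟩
    ι (suc (suc n)) * (ι (suc n) * ι (suc (suc n)) * u (suc n)) ∎)
    where
    open ≤-Reasoning
    0≤Nb = 0≤* (0≤ι (suc n)) (0≤b n)
    s₁ : ∀ n b → (n + ½) * (n + ½) * ((1ℚ + n) * (1ℚ + n) * b) ≡
      (1ℚ + (1ℚ + n)) * (n * (1ℚ + n) * (n * b)) + ((1ℚ + ¼) * n * ((1ℚ + n) * b) + ¼ * ((1ℚ + n) * b))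
    s₁ = solve-∀ ring
    s₂ : ∀ N M b → N * N * (M * M * b) ≡ M * (N * M * (N * b))
    s₂ = solve-∀ ring

  u-anti : ∀ n → u (suc (suc n)) ≤ u (suc n)
  u-anti n = *-cancelˡ-≤ (0<* (0<* (0<ι (suc n)) (0<ι (suc (suc n)))) (0<ι (suc (suc n)))) (begin
    N′ * N″ * N″ * (N′ * b (suc (suc n)))
      ≡⟨ s₁ N′ N″ (b (suc (suc n))) ⟩
    N′ * N′ * (N″ * N″ * b (suc (suc n)))
      ≡⟨ cong (N′ * N′ *_) (b*≡w (suc (suc n))) ⟩
    N′ * N′ * w (suc (suc n))
      ≡⟨ w-step (suc n) ⟩
    (N + ½) * (N + ½) * w (suc n)
      ≡⟨ cong ((N + ½) * (N + ½) *_) (b*≡w (suc n)) ⟨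
    (N + ½) * (N + ½) * (N′ * N′ * b (suc n))
      ≤⟨ ≤-by ((2ℚ * N * N + ((2ℚ + ½ + ¼) * ι n + (2ℚ + ½))) * (N′ * b (suc n)))
           (0≤* (0≤+ (0≤* (0≤* (from-yes (0ℚ ≤? 2ℚ)) (0≤ι (suc n))) (0≤ι (suc n)))
                     (0≤+ (0≤* (from-yes (0ℚ ≤? 2ℚ + ½ + ¼)) (0≤ι n)) (from-yes (0ℚ ≤? 2ℚ + ½))))
                (0≤* (0≤ι (suc (suc n))) (0≤b (suc n))))
           (s₂ (ι n) (b (suc n))) ⟩
    N′ * N″ * N″ * (N * b (suc n)) ∎)
    where
    open ≤-Reasoning
    N  = ι (suc n)
    N′ = ι (suc (suc n))
    N″ = ι (suc (suc (suc n)))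
    s₁ : ∀ a c b → a * c * c * (a * b) ≡ a * a * (c * c * b)
    s₁ = solve-∀ ring
    s₂ : ∀ n b → (1ℚ + (1ℚ + n)) * (1ℚ + (1ℚ + (1ℚ + n))) * (1ℚ + (1ℚ + (1ℚ + n))) * ((1ℚ + n) * b) ≡
      ((1ℚ + n) + ½) * ((1ℚ + n) + ½) * ((1ℚ + (1ℚ + n)) * (1ℚ + (1ℚ + n)) * b) +
      (2ℚ * (1ℚ + n) * (1ℚ + n) + ((2ℚ + ½ + ¼) * n + (2ℚ + ½))) * ((1ℚ + (1ℚ + n)) * b)
    s₂ = solve-∀ ring

  u-antitone : ∀ k j → u (suc k ℕ.+ j) ≤ u (suc k)
  u-antitone k zero    = ≤-reflexive (cong (λ n → u (suc n)) (ℕ.+-identityʳ k))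
  u-antitone k (suc j) = ≤-trans (≤-reflexive (cong (λ n → u (suc n)) (ℕ.+-suc k j)))
    (≤-trans (u-anti (k ℕ.+ j)) (u-antitone k j))

  u-monotone : ∀ k j → ι k * ι (suc k) * u k ≤ ι (k ℕ.+ j) * ι (suc (k ℕ.+ j)) * u (k ℕ.+ j)
  u-monotone k zero    = ≤-reflexive (cong (λ n → ι n * ι (suc n) * u n) (sym (ℕ.+-identityʳ k)))
  u-monotone k (suc j) = ≤-trans (u-monotone k j) (≤-trans (u-grow (k ℕ.+ j))
    (≤-reflexive (cong (λ n → ι n * ι (suc n) * u n) (sym (ℕ.+-suc k j)))))

  -- Put x = k + 1. By `u-monotone` the excess of u x over u (x + j), relative to the latter, is at
  -- most j (2x + j + 1) / (x (x + 1)). As j ≤ x this is at most 3j / x, and the hypothesis bounds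
  -- it by 1 / (t + 1).
  u-close : ∀ k j t → 3 ℕ.* (j ℕ.* suc t) ℕ.≤ suc k → u (suc k) - u (suc k ℕ.+ j) ≤ u (suc k ℕ.+ j) * inv t
  u-close k j t h = ≤*inv t (*-cancelˡ-≤ (0<* (0<ι k) (0<ι (suc k))) (begin
    x * ι (suc (suc k)) * (T * (U - V))
      ≡⟨ s₁ x T U V ⟩
    T * (x * ι (suc (suc k)) * U) - T * (x * (1ℚ + x) * V)
      ≤⟨ +-monoˡ-≤ (- (T * (x * (1ℚ + x) * V))) (*-monoʳ (0≤ι (suc t)) (u-monotone (suc k) j)) ⟩
    T * (ι (suc k ℕ.+ j) * ι (suc (suc k ℕ.+ j)) * V) - T * (x * (1ℚ + x) * V)
      ≡⟨ cong (λ z → T * (z * (1ℚ + z) * V) - T * (x * (1ℚ + x) * V)) (ι-+ (suc k) j) ⟩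
    T * ((x + y) * (1ℚ + (x + y)) * V) - T * (x * (1ℚ + x) * V)
      ≡⟨ s₂ x y T V ⟩
    (T * y) * (1ℚ + (2ℚ * x + y)) * V
      ≤⟨ *-monoˡ (0≤u (suc k ℕ.+ j)) bound ⟩
    x * ι (suc (suc k)) * V ∎))
    where
    open ≤-Reasoning
    x = ι (suc k)
    y = ι j
    T = ι (suc t)
    U = u (suc k)
    V = u (suc k ℕ.+ j)
    3ℚ = 1ℚ + 2ℚ
    s₁ : ∀ x T U V → x * (1ℚ + x) * (T * (U - V)) ≡ T * (x * (1ℚ + x) * U) - T * (x * (1ℚ + x) * V)
    s₁ = solve-∀ ring
    s₂ : ∀ x y T V → T * ((x + y) * (1ℚ + (x + y)) * V) - T * (x * (1ℚ + x) * V) ≡ (T * y) * (1ℚ + (2ℚ * x + y)) * V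
    s₂ = solve-∀ ring
    3Ty≤x : 3ℚ * (T * y) ≤ x
    3Ty≤x = subst (_≤ x) (trans (ι-* 3 (j ℕ.* suc t)) (cong (3ℚ *_) (trans (ι-* j (suc t)) (*-comm y T)))) (ι-mono h)
    y≤x : y ≤ x
    y≤x = ι-mono (ℕ.≤-trans (ℕ.≤-trans (ℕ.m≤m*n j (suc t)) (ℕ.m≤n*m (j ℕ.* suc t) 3)) h)
    bound : (T * y) * (1ℚ + (2ℚ * x + y)) ≤ x * ι (suc (suc k))
    bound = *-cancelˡ-≤ {3ℚ} (from-yes (0ℚ <? 3ℚ)) (begin
      3ℚ * ((T * y) * (1ℚ + (2ℚ * x + y)))
        ≡⟨ *-assoc 3ℚ (T * y) _ ⟨
      3ℚ * (T * y) * (1ℚ + (2ℚ * x + y))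
        ≤⟨ *-mono (0≤* (from-yes (0ℚ ≤? 3ℚ)) (0≤* (0≤ι (suc t)) (0≤ι j))) (0≤* (from-yes (0ℚ ≤? 3ℚ)) (0≤ι (suc (suc k)))) 3Ty≤x
             (≤-by (2ℚ + (x - y)) (0≤+ (from-yes (0ℚ ≤? 2ℚ)) (p≤q⇒0≤q-p y≤x)) (t₁ x y)) ⟩
      x * (3ℚ * ι (suc (suc k)))
        ≡⟨ t₂ x ⟩
      3ℚ * (x * ι (suc (suc k))) ∎)
      where
      t₁ : ∀ x y → (1ℚ + 2ℚ) * (1ℚ + x) ≡ 1ℚ + (2ℚ * x + y) + (2ℚ + (x - y))
      t₁ = solve-∀ ring
      t₂ : ∀ x → x * ((1ℚ + 2ℚ) * (1ℚ + x)) ≡ (1ℚ + 2ℚ) * (x * (1ℚ + x))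
      t₂ = solve-∀ ring

  ∑b : ∀ n → ∑< n b ≡ 4ℚ * ((1ℚ + 4ℚ * ι n) * w n) - 4ℚ
  ∑b zero    = refl
  ∑b (suc n) = trans (∑<-last n b) (trans (cong (_+ b n) (∑b n)) (*-cancelˡ-≡ (0<* (0<ι n) (0<ι n)) (begin
    N * N * (4ℚ * ((1ℚ + 4ℚ * ι n) * w n) - 4ℚ + b n)
      ≡⟨ s₁ N (ι n) (w n) (b n) ⟩
    N * N * (4ℚ * ((1ℚ + 4ℚ * ι n) * w n) - 4ℚ) + N * N * b n
      ≡⟨ cong (N * N * (4ℚ * ((1ℚ + 4ℚ * ι n) * w n) - 4ℚ) +_) (b*≡w n) ⟩
    N * N * (4ℚ * ((1ℚ + 4ℚ * ι n) * w n) - 4ℚ) + w n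
      ≡⟨ s₂ (ι n) (w n) ⟩
    4ℚ * (1ℚ + 4ℚ * N) * ((ι n + ½) * (ι n + ½) * w n) - N * N * 4ℚ
      ≡⟨ cong (λ z → 4ℚ * (1ℚ + 4ℚ * N) * z - N * N * 4ℚ) (w-step n) ⟨
    4ℚ * (1ℚ + 4ℚ * N) * (N * N * w (suc n)) - N * N * 4ℚ
      ≡⟨ s₃ N (w (suc n)) ⟩
    N * N * (4ℚ * ((1ℚ + 4ℚ * N) * w (suc n)) - 4ℚ) ∎)))
    where
    open ≡-Reasoning
    N = ι (suc n)
    s₁ : ∀ N n w b → N * N * (4ℚ * ((1ℚ + 4ℚ * n) * w) - 4ℚ + b) ≡ N * N * (4ℚ * ((1ℚ + 4ℚ * n) * w) - 4ℚ) + N * N * b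
    s₁ = solve-∀ ring
    s₂ : ∀ n w → (1ℚ + n) * (1ℚ + n) * (4ℚ * ((1ℚ + 4ℚ * n) * w) - 4ℚ) + w ≡
      4ℚ * (1ℚ + 4ℚ * (1ℚ + n)) * ((n + ½) * (n + ½) * w) - (1ℚ + n) * (1ℚ + n) * 4ℚ
    s₂ = solve-∀ ring
    s₃ : ∀ N w → 4ℚ * (1ℚ + 4ℚ * N) * (N * N * w) - N * N * 4ℚ ≡ N * N * (4ℚ * ((1ℚ + 4ℚ * N) * w) - 4ℚ)
    s₃ = solve-∀ ring

  -- If zM′(z) = M(z)g(z) for the generating function M of b, then the coefficients of g are asymptotic to u n / M(1).

  module Quotient (γ : ℕ → ℚ) (0≤γ : ∀ n → 0ℚ ≤ γ n)
                  (conv : ∀ n → ∑< (suc n) (λ l → b l * γ (n ℕ.∸ l)) ≡ u n) where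

    γ≤u : ∀ n → γ n ≤ u n
    γ≤u n = ≤-by (∑< n (λ l → b (suc l) * γ (n ℕ.∸ suc l)))
      (∑<-nonneg n λ l → 0≤* (0≤b (suc l)) (0≤γ (n ℕ.∸ suc l)))
      (trans (sym (conv n)) (cong (_+ ∑< n (λ l → b (suc l) * γ (n ℕ.∸ suc l))) (*-identityˡ (γ n))))

    -- The error of γ n ≈ u n / M, multiplied by M, with M truncated to its terms up to b J. Fixing
    -- J makes the recursion look back a bounded distance while n grows.
    y : ℕ → ℕ → ℚ
    y J n = (1ℚ + β J) * γ n - u n

    private
      module Step (K M : ℕ) where
        n = suc K ℕ.+ M
        m = 1ℚ + β K

        earlier : (ℕ → ℚ) → ℚ
        earlier f = ∑< K λ l → b (suc l) * f (n ℕ.∸ suc l)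

        remainder : ℚ
        remainder = ∑< (suc M) λ i → b (suc K ℕ.+ i) * γ (n ℕ.∸ (suc K ℕ.+ i))

        expand : u n ≡ γ n + earlier γ + remainder
        expand = trans (sym (conv n))
          (trans (cong (λ k → ∑< k (λ l → b l * γ (n ℕ.∸ l))) (sym (ℕ.+-suc (suc K) M)))
          (trans (∑<-split (suc K) (suc M) (λ l → b l * γ (n ℕ.∸ l)))
          (cong (λ z → z + earlier γ + remainder) (*-identityˡ (γ n)))))

        0≤remainder : 0ℚ ≤ remainder
        0≤remainder = ∑<-nonneg (suc M) λ i → 0≤* (0≤b (suc K ℕ.+ i)) (0≤γ (n ℕ.∸ (suc K ℕ.+ i)))

        -- By `γ≤u` and `b*b≤` each product is at most 16 b n times n b j + u (n - j). The b j with
        -- j > K sum to at most 1 / (2 (K + 1)) and the u to at most 1/2; since n > K, that 1/2 is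
        -- at most n / (2 (K + 1)) too.
        remainder≤ : remainder ≤ 16ℚ * u n * inv K
        remainder≤ = begin
          remainder
            ≤⟨ ∑<-mono (suc M) (λ i i≤M → term (suc K ℕ.+ i) (subst (suc K ℕ.+ i ℕ.≤_) refl (ℕ.+-monoʳ-≤ (suc K) (ℕ.≤-pred i≤M)))) ⟩
          ∑< (suc M) (λ i → 16ℚ * b n * (ι n * b (suc K ℕ.+ i) + u (n ℕ.∸ (suc K ℕ.+ i))))
            ≡⟨ trans (∑<-* (suc M) (16ℚ * b n) λ i → ι n * b (suc K ℕ.+ i) + u (n ℕ.∸ (suc K ℕ.+ i)))
               (cong (16ℚ * b n *_) (trans (∑<-+ (suc M) (λ i → ι n * b (suc K ℕ.+ i)) λ i → u (n ℕ.∸ (suc K ℕ.+ i)))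
               (cong₂ _+_ (∑<-* (suc M) (ι n) λ i → b (suc K ℕ.+ i))
                 (trans (∑<-cong (suc M) λ i _ → cong u (ℕ.[m+n]∸[m+o]≡n∸o (suc K) M i)) (sym (∑<-reverse M u)))))) ⟩
          16ℚ * b n * (ι n * ∑< (suc M) (λ i → b (suc (K ℕ.+ i))) + ∑< (suc M) u)
            ≤⟨ *-monoʳ (0≤* (from-yes (0ℚ ≤? 16ℚ)) (0≤b n)) (+-mono-≤ (*-monoʳ (0≤ι n) (∑step≤ K (suc M) b b≤step)) (∑u≤½ M)) ⟩
          16ℚ * b n * (ι n * (½ * inv K) + ½)
            ≡⟨ s₁ (b n) (ι n) (inv K) ⟩
          8ℚ * u n * inv K + 8ℚ * (b n * 1ℚ)
            ≡⟨ cong (λ z → 8ℚ * u n * inv K + 8ℚ * (b n * z)) (ι*inv (K ℕ.+ M)) ⟨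
          8ℚ * u n * inv K + 8ℚ * (b n * (ι n * inv (K ℕ.+ M)))
            ≤⟨ +-monoʳ-≤ (8ℚ * u n * inv K) (*-monoʳ (from-yes (0ℚ ≤? 8ℚ)) (*-monoʳ (0≤b n) (*-monoʳ (0≤ι n) (Defs.1/suc-anti (ℕ.m≤m+n K M))))) ⟩
          8ℚ * u n * inv K + 8ℚ * (b n * (ι n * inv K))
            ≡⟨ s₂ (b n) (ι n) (inv K) ⟩
          16ℚ * u n * inv K ∎
          where
          open ≤-Reasoning
          s₁ : ∀ b n i → 16ℚ * b * (n * (½ * i) + ½) ≡ 8ℚ * (n * b) * i + 8ℚ * (b * 1ℚ)
          s₁ = solve-∀ ring
          s₂ : ∀ b n i → 8ℚ * (n * b) * i + 8ℚ * (b * (n * i)) ≡ 16ℚ * (n * b) * i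
          s₂ = solve-∀ ring
          term : ∀ j → j ℕ.≤ n → b j * γ (n ℕ.∸ j) ≤ 16ℚ * b n * (ι n * b j + u (n ℕ.∸ j))
          term j j≤n = begin
            b j * γ k                              ≤⟨ *-monoʳ (0≤b j) (γ≤u k) ⟩
            b j * (ι k * b k)                      ≡⟨ t₁ (b j) (ι k) (b k) ⟩
            ι k * (b j * b k)                      ≤⟨ *-monoʳ (0≤ι k) (subst (λ n → b j * b k ≤ 16ℚ * b n * (b j + b k)) (ℕ.m+[n∸m]≡n j≤n) (b*b≤ j k)) ⟩
            ι k * (16ℚ * b n * (b j + b k))        ≡⟨ t₂ (ι k) (b n) (b j) (b k) ⟩
            16ℚ * b n * (ι k * b j + ι k * b k)    ≤⟨ *-monoʳ (0≤* (from-yes (0ℚ ≤? 16ℚ)) (0≤b n)) (+-monoˡ-≤ (u k) (*-monoˡ (0≤b j) (ι-mono (ℕ.m∸n≤m n j)))) ⟩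
            16ℚ * b n * (ι n * b j + u k)          ∎
            where
            k = n ℕ.∸ j
            t₁ : ∀ a c d → a * (c * d) ≡ c * (a * d)
            t₁ = solve-∀ ring
            t₂ : ∀ k n x y → k * (16ℚ * n * (x + y)) ≡ 16ℚ * n * (k * x + k * y)
            t₂ = solve-∀ ring

        -- Solving the convolution for γ n leaves three errors: the earlier values of y weighted by
        -- b, the variation of u over the last K indices, and the tail beyond K.
        y-expand : y K n ≡ (- earlier (y K)) + ((- earlier (λ k → u k - u n)) + (- (m * remainder)))
        y-expand = trans (cong (λ z → (1ℚ + β K) * z - u n) (solve-γ expand))
          (trans (s (u n) (β K) (earlier γ) (earlier u) remainder)
          (cong₂ (λ p q → (- p) + ((- q) + (- (m * remainder)))) (sym earlier-y) (sym earlier-u)))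
          where
          solve-γ : ∀ {a g e r} → a ≡ g + e + r → g ≡ a - e - r
          solve-γ {g = g} {e} {r} refl = t g e r
            where
            t : ∀ g e r → g ≡ g + e + r - e - r
            t = solve-∀ ring
          s : ∀ a β e v r → (1ℚ + β) * (a - e - r) - a ≡
            (- ((1ℚ + β) * e + (- 1ℚ) * v)) + ((- (v + (- a) * β)) + (- ((1ℚ + β) * r)))
          s = solve-∀ ring
          earlier-y : earlier (y K) ≡ m * earlier γ + (- 1ℚ) * earlier u
          earlier-y = trans (∑<-cong K λ l _ → t m (b (suc l)) (γ (n ℕ.∸ suc l)) (u (n ℕ.∸ suc l)))
            (trans (∑<-+ K (λ l → m * (b (suc l) * γ (n ℕ.∸ suc l))) λ l → (- 1ℚ) * (b (suc l) * u (n ℕ.∸ suc l)))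
            (cong₂ _+_ (∑<-* K m λ l → b (suc l) * γ (n ℕ.∸ suc l)) (∑<-* K (- 1ℚ) λ l → b (suc l) * u (n ℕ.∸ suc l))))
            where
            t : ∀ m b g u → b * (m * g - u) ≡ m * (b * g) + (- 1ℚ) * (b * u)
            t = solve-∀ ring
          earlier-u : earlier (λ k → u k - u n) ≡ earlier u + (- u n) * β K
          earlier-u = trans (∑<-cong K λ l _ → t (b (suc l)) (u (n ℕ.∸ suc l)) (u n))
            (trans (∑<-+ K (λ l → b (suc l) * u (n ℕ.∸ suc l)) λ l → (- u n) * b (suc l))
            (cong (earlier u +_) (∑<-* K (- u n) λ l → b (suc l))))
            where
            t : ∀ b x c → b * (x - c) ≡ b * x + (- c) * b
            t = solve-∀ ring

        earlier-bound : ∀ f C → (∀ l → l ℕ.< K → ∣ f (n ℕ.∸ suc l) ∣ ≤ C) → ∣ earlier f ∣ ≤ C * β K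
        earlier-bound f C f≤C = begin
          ∣ earlier f ∣
            ≤⟨ ∑<-∣∣ K (λ l → b (suc l) * f (n ℕ.∸ suc l)) ⟩
          ∑< K (λ l → ∣ b (suc l) * f (n ℕ.∸ suc l) ∣)
            ≤⟨ ∑<-mono K (λ l l<K → begin
                 ∣ b (suc l) * f (n ℕ.∸ suc l) ∣       ≡⟨ ∣p*q∣≡∣p∣*∣q∣ (b (suc l)) (f (n ℕ.∸ suc l)) ⟩
                 ∣ b (suc l) ∣ * ∣ f (n ℕ.∸ suc l) ∣   ≡⟨ cong (_* ∣ f (n ℕ.∸ suc l) ∣) (0≤p⇒∣p∣≡p (0≤b (suc l))) ⟩
                 b (suc l) * ∣ f (n ℕ.∸ suc l) ∣       ≤⟨ *-monoʳ (0≤b (suc l)) (f≤C l l<K) ⟩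
                 b (suc l) * C                         ≡⟨ *-comm (b (suc l)) C ⟩
                 C * b (suc l)                         ∎) ⟩
          ∑< K (λ l → C * b (suc l))
            ≡⟨ ∑<-* K C (λ l → b (suc l)) ⟩
          C * β K ∎
          where open ≤-Reasoning

        module _ (far : 3 ℕ.* (K ℕ.* suc K) ℕ.≤ M) where

          recent : ∀ l → l ℕ.< K → 0ℚ ≤ u (n ℕ.∸ suc l) - u n × u (n ℕ.∸ suc l) - u n ≤ u n * inv K
          recent l l<K = subst (λ k → 0ℚ ≤ u k - u n × u k - u n ≤ u n * inv K) (sym k≡)
            (p≤q⇒0≤q-p (subst (λ n → u n ≤ u (suc p)) sum≡ (u-antitone p (suc l))) ,
             subst (λ n → u (suc p) - u n ≤ u n * inv K) sum≡ (u-close p (suc l) K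
               (ℕ.≤-trans (ℕ.*-monoʳ-≤ 3 (ℕ.*-monoˡ-≤ (suc K) l<K)) (ℕ.≤-trans far (ℕ.≤-trans (ℕ.m≤n+m M (K ℕ.∸ suc l)) (ℕ.n≤1+n p))))))
            where
            p = (K ℕ.∸ suc l) ℕ.+ M
            sum≡ : suc p ℕ.+ suc l ≡ n
            sum≡ = cong suc (trans (ℕ.+-comm p (suc l)) (trans (sym (ℕ.+-assoc (suc l) (K ℕ.∸ suc l) M))
              (cong (ℕ._+ M) (ℕ.m+[n∸m]≡n l<K))))
            k≡ : n ℕ.∸ suc l ≡ suc p
            k≡ = trans (cong (ℕ._∸ suc l) (sym sum≡)) (ℕ.m+n∸n≡m (suc p) (suc l))

          -- The constant 33 is 1 + 2 · 16: the variation of u costs `u n * inv K`, and the tail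
          -- bound is multiplied by m ≤ 2. The hypothesis 1 ≤ K gives `inv K` ≤ 1/2 and thus the
          -- ratio 3/2.
          contract : 1 ℕ.≤ K → ∀ B → 0ℚ ≤ B →
            (∀ l → l ℕ.< K → ∣ y K (n ℕ.∸ suc l) ∣ ≤ B * u (n ℕ.∸ suc l)) →
            ∣ y K n ∣ ≤ (½ * B + (ℤ.+ 33 / 1) * inv K) * u n
          contract 1≤K B 0≤B h = begin
            ∣ y K n ∣
              ≡⟨ cong ∣_∣ y-expand ⟩
            ∣ (- earlier (y K)) + ((- earlier (λ k → u k - u n)) + (- (m * remainder))) ∣
              ≤⟨ ≤-trans (∣p+q∣≤∣p∣+∣q∣ (- earlier (y K)) _) (+-monoʳ-≤ ∣ - earlier (y K) ∣ (∣p+q∣≤∣p∣+∣q∣ (- earlier (λ k → u k - u n)) _)) ⟩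
            ∣ - earlier (y K) ∣ + (∣ - earlier (λ k → u k - u n) ∣ + ∣ - (m * remainder) ∣)
              ≡⟨ cong₂ _+_ (∣-p∣≡∣p∣ (earlier (y K))) (cong₂ _+_ (∣-p∣≡∣p∣ (earlier λ k → u k - u n))
                   (trans (∣-p∣≡∣p∣ (m * remainder)) (0≤p⇒∣p∣≡p (0≤* 0≤m 0≤remainder)))) ⟩
            ∣ earlier (y K) ∣ + (∣ earlier (λ k → u k - u n) ∣ + m * remainder)
              ≤⟨ +-mono-≤ y-part (+-mono-≤ u-part r-part) ⟩
            ½ * B * u n + (u n * inv K + 2ℚ * (16ℚ * u n * inv K))
              ≡⟨ s (u n) B (inv K) ⟩
            (½ * B + (ℤ.+ 33 / 1) * inv K) * u n ∎
            where
            open ≤-Reasoning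
            0≤m = 0≤+ 0≤1 (0≤β K)
            β≤1 : β K ≤ 1ℚ
            β≤1 = ≤-trans (β≤ K) (from-yes (ℤ.+ 5 / 16 ≤? 1ℚ))
            s : ∀ u B i → ½ * B * u + (u * i + 2ℚ * (16ℚ * u * i)) ≡ (½ * B + (ℤ.+ 33 / 1) * i) * u
            s = solve-∀ ring
            r-part : m * remainder ≤ 2ℚ * (16ℚ * u n * inv K)
            r-part = *-mono 0≤m (≤-trans 0≤remainder remainder≤) (+-monoʳ-≤ 1ℚ β≤1) remainder≤
            u-part : ∣ earlier (λ k → u k - u n) ∣ ≤ u n * inv K
            u-part = begin
              ∣ earlier (λ k → u k - u n) ∣ ≤⟨ earlier-bound (λ k → u k - u n) (u n * inv K) (λ l l<K →
                let lo , hi = recent l l<K in subst (_≤ u n * inv K) (sym (0≤p⇒∣p∣≡p lo)) hi) ⟩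
              u n * inv K * β K             ≤⟨ *-monoʳ (0≤* (0≤u n) (0≤inv K)) β≤1 ⟩
              u n * inv K * 1ℚ              ≡⟨ *-identityʳ (u n * inv K) ⟩
              u n * inv K                   ∎
            inv≤½ : inv K ≤ ½
            inv≤½ = Defs.1/suc-anti 1≤K
            y-part : ∣ earlier (y K) ∣ ≤ ½ * B * u n
            y-part = begin
              ∣ earlier (y K) ∣
                ≤⟨ earlier-bound (y K) (B * ((1ℚ + ½) * u n)) (λ l l<K → ≤-trans (h l l<K) (*-monoʳ 0≤B (begin
                     u (n ℕ.∸ suc l)               ≡⟨ t₁ (u (n ℕ.∸ suc l)) (u n) ⟩
                     u n + (u (n ℕ.∸ suc l) - u n) ≤⟨ +-monoʳ-≤ (u n) (≤-trans (proj₂ (recent l l<K)) (*-monoʳ (0≤u n) inv≤½)) ⟩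
                     u n + u n * ½                 ≡⟨ t₂ (u n) ⟩
                     (1ℚ + ½) * u n                ∎))) ⟩
              B * ((1ℚ + ½) * u n) * β K
                ≤⟨ *-monoʳ (0≤* 0≤B (0≤* (from-yes (0ℚ ≤? 1ℚ + ½)) (0≤u n))) (≤-trans (β≤ K) (from-yes (ℤ.+ 5 / 16 ≤? ℤ.+ 1 / 3))) ⟩
              B * ((1ℚ + ½) * u n) * (ℤ.+ 1 / 3)
                ≡⟨ t₃ B (u n) ⟩
              ½ * B * u n ∎
              where
              t₁ : ∀ x c → x ≡ c + (x - c)
              t₁ = solve-∀ ring
              t₂ : ∀ c → c + c * ½ ≡ (1ℚ + ½) * c
              t₂ = solve-∀ ring
              t₃ : ∀ B u → B * ((1ℚ + ½) * u) * (ℤ.+ 1 / 3) ≡ ½ * B * u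
              t₃ = solve-∀ ring

    y-trivial : ∀ K n → ∣ y K n ∣ ≤ 2ℚ * u n
    y-trivial K n = ∣∣-bound
      (≤-trans (≤-by (u n) (0≤u n) (s₁ ((1ℚ + β K) * γ n) (u n))) mγ≤)
      (≤-trans (≤-by ((1ℚ + β K) * γ n) (0≤* (0≤+ 0≤1 (0≤β K)) (0≤γ n)) (s₂ ((1ℚ + β K) * γ n) (u n)))
        (≤-by (u n) (0≤u n) (s₃ (u n))))
      where
      mγ≤ : (1ℚ + β K) * γ n ≤ 2ℚ * u n
      mγ≤ = *-mono (0≤+ 0≤1 (0≤β K)) (0≤u n) (+-monoʳ-≤ 1ℚ (≤-trans (β≤ K) (from-yes (ℤ.+ 5 / 16 ≤? 1ℚ)))) (γ≤u n)
      s₁ : ∀ a c → a ≡ a - c + c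
      s₁ = solve-∀ ring
      s₂ : ∀ a c → c ≡ - (a - c) + a
      s₂ = solve-∀ ring
      s₃ : ∀ c → 2ℚ * c ≡ c + c
      s₃ = solve-∀ ring

    half^ : ℕ → ℚ
    half^ zero    = 1ℚ
    half^ (suc i) = ½ * half^ i

    0≤half^ : ∀ i → 0ℚ ≤ half^ i
    0≤half^ zero    = 0≤1
    0≤half^ (suc i) = 0≤* 0≤½ (0≤half^ i)

    half^≤inv : ∀ i → half^ i ≤ inv i
    half^≤inv zero    = ≤-refl
    half^≤inv (suc i) = ≤-trans (≤*inv (suc i) (begin
      ι (suc (suc i)) * (½ * half^ i)
        ≤⟨ *-monoʳ (0≤ι (suc (suc i))) (*-monoʳ 0≤½ (half^≤inv i)) ⟩
      ι (suc (suc i)) * (½ * inv i)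
        ≤⟨ ≤-by (½ * ι i * inv i) (0≤* (0≤* 0≤½ (0≤ι i)) (0≤inv i)) (s (ι i) (inv i)) ⟩
      ι (suc i) * inv i
        ≡⟨ ι*inv i ⟩
      1ℚ ∎)) (≤-reflexive (*-identityˡ (inv (suc i))))
      where
      open ≤-Reasoning
      s : ∀ i v → (1ℚ + i) * v ≡ (1ℚ + (1ℚ + i)) * (½ * v) + ½ * i * v
      s = solve-∀ ring

    -- 66 = 2 · 33 comes from the fixed point of B ↦ B / 2 + 33 `inv K`, and the 2 from `y-trivial`.
    -- One step looks back at most K places, so each iteration raises the threshold by K + 1.
    y-iterate : ∀ K → 1 ℕ.≤ K → ∀ i n → suc K ℕ.+ 3 ℕ.* (K ℕ.* suc K) ℕ.+ i ℕ.* suc K ℕ.≤ n →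
      ∣ y K n ∣ ≤ ((ℤ.+ 66 / 1) * inv K + 2ℚ * half^ i) * u n
    y-iterate K 1≤K zero n _ = ≤-trans (y-trivial K n)
      (≤-by ((ℤ.+ 66 / 1) * inv K * u n) (0≤* (0≤* (from-yes (0ℚ ≤? ℤ.+ 66 / 1)) (0≤inv K)) (0≤u n)) (s (inv K) (u n)))
      where
      s : ∀ i u → ((ℤ.+ 66 / 1) * i + 2ℚ * 1ℚ) * u ≡ 2ℚ * u + (ℤ.+ 66 / 1) * i * u
      s = solve-∀ ring
    y-iterate K 1≤K (suc i) n N≤n = subst (λ n → ∣ y K n ∣ ≤ ((ℤ.+ 66 / 1) * inv K + 2ℚ * half^ (suc i)) * u n) n≡
      (≤-trans (Step.contract K M far 1≤K B 0≤B λ l l<K → y-iterate K 1≤K i (suc K ℕ.+ M ℕ.∸ suc l) (close l l<K))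
        (≤-reflexive (cong (_* u (suc K ℕ.+ M)) (s (inv K) (half^ i)))))
      where
      far₀ = 3 ℕ.* (K ℕ.* suc K)
      M = n ℕ.∸ suc K
      B = (ℤ.+ 66 / 1) * inv K + 2ℚ * half^ i
      0≤B = 0≤+ (0≤* (from-yes (0ℚ ≤? ℤ.+ 66 / 1)) (0≤inv K)) (0≤* (from-yes (0ℚ ≤? 2ℚ)) (0≤half^ i))
      s : ∀ i h → ½ * ((ℤ.+ 66 / 1) * i + 2ℚ * h) + (ℤ.+ 33 / 1) * i ≡ (ℤ.+ 66 / 1) * i + 2ℚ * (½ * h)
      s = solve-∀ ring
      n≡ : suc K ℕ.+ M ≡ n
      n≡ = ℕ.m+[n∸m]≡n (ℕ.≤-trans (ℕ.≤-trans (ℕ.m≤m+n (suc K) far₀) (ℕ.m≤m+n _ _)) N≤n)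
      N≤′ : (suc K ℕ.+ far₀ ℕ.+ i ℕ.* suc K) ℕ.+ suc K ℕ.≤ suc K ℕ.+ M
      N≤′ = subst₂ ℕ._≤_ (trans (cong (suc K ℕ.+ far₀ ℕ.+_) (ℕ.+-comm (suc K) (i ℕ.* suc K))) (sym (ℕ.+-assoc (suc K ℕ.+ far₀) _ _))) (sym n≡) N≤n
      N≤M : suc K ℕ.+ far₀ ℕ.+ i ℕ.* suc K ℕ.≤ M
      N≤M = ℕ.+-cancelˡ-≤ (suc K) _ _ (subst (ℕ._≤ suc K ℕ.+ M) (ℕ.+-comm _ (suc K)) N≤′)
      far : far₀ ℕ.≤ M
      far = ℕ.≤-trans (ℕ.≤-trans (ℕ.m≤n+m far₀ (suc K)) (ℕ.m≤m+n _ _)) N≤M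
      close : ∀ l → l ℕ.< K → suc K ℕ.+ far₀ ℕ.+ i ℕ.* suc K ℕ.≤ suc K ℕ.+ M ℕ.∸ suc l
      close l l<K = ℕ.≤-trans N≤M (subst (M ℕ.≤_) (sym (ℕ.+-∸-comm M (ℕ.≤-trans l<K (ℕ.n≤1+n K)))) (ℕ.m≤n+m M (suc K ℕ.∸ suc l)))

    -- K iterations leave 66 `inv K` + 2 `half^ K`, where `half^ K` is at most `inv K`. Replacing
    -- the truncated sum by the sum up to n costs another `inv K` / 2, and 68 1/2 is rounded up to
    -- 69.
    γ-asymptotic : ∀ K → ∃ λ N → ∀ n → N ℕ.≤ n → ∣ ∑< n b * γ n - u n ∣ ≤ (ℤ.+ 69 / 1) * inv K * u n
    γ-asymptotic K₀ = N , λ n N≤n →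
      let M = n ℕ.∸ suc K
          n≡ = ℕ.m+[n∸m]≡n {suc K} {n} (ℕ.≤-trans (ℕ.≤-trans (ℕ.m≤m+n (suc K) _) (ℕ.m≤m+n _ _)) N≤n)
          rest = ∑< M λ i → b (suc (K ℕ.+ i))
          0≤rest = ∑<-nonneg M λ i → 0≤b (suc (K ℕ.+ i))
      in begin
      ∣ ∑< n b * γ n - u n ∣
        ≡⟨ cong (λ z → ∣ z * γ n - u n ∣) (trans (cong (λ k → ∑< k b) (sym n≡)) (∑<-split (suc K) M b)) ⟩
      ∣ (1ℚ + β K + rest) * γ n - u n ∣
        ≡⟨ cong ∣_∣ (s₁ (1ℚ + β K) rest (γ n) (u n)) ⟩
      ∣ y K n + rest * γ n ∣
        ≤⟨ ∣p+q∣≤∣p∣+∣q∣ (y K n) (rest * γ n) ⟩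
      ∣ y K n ∣ + ∣ rest * γ n ∣
        ≡⟨ cong (∣ y K n ∣ +_) (0≤p⇒∣p∣≡p (0≤* 0≤rest (0≤γ n))) ⟩
      ∣ y K n ∣ + rest * γ n
        ≤⟨ +-mono-≤ (y-iterate K (s≤s z≤n) K n N≤n) (*-mono 0≤rest (0≤u n) (∑step≤ K M b b≤step) (γ≤u n)) ⟩
      ((ℤ.+ 66 / 1) * inv K + 2ℚ * half^ K) * u n + ½ * inv K * u n
        ≤⟨ +-monoˡ-≤ (½ * inv K * u n) (*-monoˡ (0≤u n) (+-monoʳ-≤ ((ℤ.+ 66 / 1) * inv K) (*-monoʳ (from-yes (0ℚ ≤? 2ℚ)) (half^≤inv K)))) ⟩
      ((ℤ.+ 66 / 1) * inv K + 2ℚ * inv K) * u n + ½ * inv K * u n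
        ≤⟨ ≤-by (½ * inv K * u n) (0≤* (0≤* 0≤½ (0≤inv K)) (0≤u n)) (s₂ (inv K) (u n)) ⟩
      (ℤ.+ 69 / 1) * inv K * u n
        ≤⟨ *-monoˡ (0≤u n) (*-monoʳ (from-yes (0ℚ ≤? ℤ.+ 69 / 1)) (Defs.1/suc-anti (ℕ.n≤1+n K₀))) ⟩
      (ℤ.+ 69 / 1) * inv K₀ * u n ∎
      where
      open ≤-Reasoning
      K = suc K₀
      N = suc K ℕ.+ 3 ℕ.* (K ℕ.* suc K) ℕ.+ K ℕ.* suc K
      s₁ : ∀ m r g u → (m + r) * g - u ≡ m * g - u + r * g
      s₁ = solve-∀ ring
      s₂ : ∀ i u → (ℤ.+ 69 / 1) * i * u ≡ ((ℤ.+ 66 / 1) * i + 2ℚ * i) * u + ½ * i * u + ½ * i * u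
      s₂ = solve-∀ ring

  -- Casting the counting identities to ℚ.

  ι-antidiagonal : ∀ F n → ι (antidiagonal F n) ≡ ∑< (suc n) λ l → ι (F l (n ℕ.∸ l))
  ι-antidiagonal F zero    = sym (+-identityʳ (ι (F 0 0)))
  ι-antidiagonal F (suc n) = trans (ι-+ (F 0 (suc n)) _) (cong (ι (F 0 (suc n)) +_) (ι-antidiagonal (λ l r → F (suc l) r) n))

  16⁻^ : ℕ → ℚ
  16⁻^ zero    = 1ℚ
  16⁻^ (suc n) = ¼ * ¼ * 16⁻^ n

  16⁻^-+ : ∀ m n → 16⁻^ (m ℕ.+ n) ≡ 16⁻^ m * 16⁻^ n
  16⁻^-+ zero    n = sym (*-identityˡ (16⁻^ n))
  16⁻^-+ (suc m) n = trans (cong (¼ * ¼ *_) (16⁻^-+ m n)) (sym (*-assoc (¼ * ¼) (16⁻^ m) (16⁻^ n)))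

  16^ : ℕ → ℚ
  16^ zero    = 1ℚ
  16^ (suc n) = 16ℚ * 16^ n

  16^*16⁻^ : ∀ n → 16^ n * 16⁻^ n ≡ 1ℚ
  16^*16⁻^ zero    = refl
  16^*16⁻^ (suc n) = trans (s (16^ n) (16⁻^ n)) (16^*16⁻^ n)
    where
    s : ∀ x y → 16ℚ * x * (¼ * ¼ * y) ≡ x * y
    s = solve-∀ ring

  0≤16⁻^ : ∀ n → 0ℚ ≤ 16⁻^ n
  0≤16⁻^ zero    = 0≤1
  0≤16⁻^ (suc n) = 0≤* (from-yes (0ℚ ≤? ¼ * ¼)) (0≤16⁻^ n)

  w-suc : ∀ n → w (suc n) ≡ (ι n + ½) * (ι n + ½) * b n
  w-suc n = *-cancelˡ-≡ (0<* (0<ι n) (0<ι n)) (trans (w-step n)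
    (trans (cong ((ι n + ½) * (ι n + ½) *_) (sym (b*≡w n))) (s (ι (suc n)) ((ι n + ½) * (ι n + ½)) (b n))))
    where
    s : ∀ a c b → c * (a * a * b) ≡ a * a * (c * b)
    s = solve-∀ ring

  b≡cat² : ∀ n → ι (cat n ℕ.* cat n) * 16⁻^ n ≡ b n
  b≡cat² zero    = cong (λ c → ι (c ℕ.* c) * 1ℚ) cat-0
  b≡cat² (suc n) = *-cancelˡ-≡ (0<* (0<ι (suc n)) (0<ι (suc n))) (begin
    N * N * (ι (cat (suc n) ℕ.* cat (suc n)) * (¼ * ¼ * 16⁻^ n))
      ≡⟨ cong (λ z → N * N * (z * (¼ * ¼ * 16⁻^ n))) (ι-* (cat (suc n)) (cat (suc n))) ⟩
    N * N * (ι (cat (suc n)) * ι (cat (suc n)) * (¼ * ¼ * 16⁻^ n))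
      ≡⟨ s₁ N (ι (cat (suc n))) (16⁻^ n) ⟩
    (N * ι (cat (suc n))) * (N * ι (cat (suc n))) * (¼ * ¼ * 16⁻^ n)
      ≡⟨ cong (λ z → z * z * (¼ * ¼ * 16⁻^ n)) recurrence ⟩
    (2ℚ + 4ℚ * ι n) * ι (cat n) * ((2ℚ + 4ℚ * ι n) * ι (cat n)) * (¼ * ¼ * 16⁻^ n)
      ≡⟨ s₂ (ι n) (ι (cat n)) (16⁻^ n) ⟩
    (ι n + ½) * (ι n + ½) * (ι (cat n) * ι (cat n) * 16⁻^ n)
      ≡⟨ cong (λ z → (ι n + ½) * (ι n + ½) * (z * 16⁻^ n)) (ι-* (cat n) (cat n)) ⟨
    (ι n + ½) * (ι n + ½) * (ι (cat n ℕ.* cat n) * 16⁻^ n)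
      ≡⟨ cong ((ι n + ½) * (ι n + ½) *_) (b≡cat² n) ⟩
    (ι n + ½) * (ι n + ½) * b n
      ≡⟨ w-suc n ⟨
    w (suc n)
      ≡⟨ b*≡w (suc n) ⟨
    N * N * b (suc n) ∎)
    where
    open ≡-Reasoning
    N = ι (suc (suc n))
    s₁ : ∀ N c q → N * N * (c * c * (¼ * ¼ * q)) ≡ (N * c) * (N * c) * (¼ * ¼ * q)
    s₁ = solve-∀ ring
    s₂ : ∀ n c q → (2ℚ + 4ℚ * n) * c * ((2ℚ + 4ℚ * n) * c) * (¼ * ¼ * q) ≡ (n + ½) * (n + ½) * (c * c * q)
    s₂ = solve-∀ ring
    s₃ : ∀ x → 1ℚ + (1ℚ + x) ≡ 2ℚ + x
    s₃ = solve-∀ ring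
    recurrence : N * ι (cat (suc n)) ≡ (2ℚ + 4ℚ * ι n) * ι (cat n)
    recurrence = trans (sym (ι-* (2 ℕ.+ n) (cat (suc n)))) (trans (cong ι (cat-recurrence n))
      (trans (ι-* (2 ℕ.+ 4 ℕ.* n) (cat n)) (cong (_* ι (cat n)) (trans (s₃ (ι (4 ℕ.* n))) (cong (2ℚ +_) (ι-* 4 n))))))

  γ : ℕ → ℚ
  γ n = ι (goods₂ n) * 16⁻^ n

  0≤γ : ∀ n → 0ℚ ≤ γ n
  0≤γ n = 0≤* (0≤ι (goods₂ n)) (0≤16⁻^ n)

  γ-convolution : ∀ n → ∑< (suc n) (λ l → b l * γ (n ℕ.∸ l)) ≡ u n
  γ-convolution n = begin
    ∑< (suc n) (λ l → b l * γ (n ℕ.∸ l))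
      ≡⟨ ∑<-cong (suc n) (λ l l≤n → term l (ℕ.≤-pred l≤n)) ⟩
    ∑< (suc n) (λ l → 16⁻^ n * ι (cat l ℕ.* cat l ℕ.* goods₂ (n ℕ.∸ l)))
      ≡⟨ ∑<-* (suc n) (16⁻^ n) (λ l → ι (cat l ℕ.* cat l ℕ.* goods₂ (n ℕ.∸ l))) ⟩
    16⁻^ n * ∑< (suc n) (λ l → ι (cat l ℕ.* cat l ℕ.* goods₂ (n ℕ.∸ l)))
      ≡⟨ cong (16⁻^ n *_) (trans (sym (ι-antidiagonal (λ l k → cat l ℕ.* cat l ℕ.* goods₂ k) n)) (cong ι (goods₂-convolution n))) ⟩
    16⁻^ n * ι (n ℕ.* (cat n ℕ.* cat n))
      ≡⟨ cong (16⁻^ n *_) (ι-* n (cat n ℕ.* cat n)) ⟩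
    16⁻^ n * (ι n * ι (cat n ℕ.* cat n))
      ≡⟨ s (16⁻^ n) (ι n) (ι (cat n ℕ.* cat n)) ⟩
    ι n * (ι (cat n ℕ.* cat n) * 16⁻^ n)
      ≡⟨ cong (ι n *_) (b≡cat² n) ⟩
    u n ∎
    where
    open ≡-Reasoning
    s : ∀ q n c → q * (n * c) ≡ n * (c * q)
    s = solve-∀ ring
    t : ∀ c q g q′ → c * q * (g * q′) ≡ q * q′ * (c * g)
    t = solve-∀ ring
    term : ∀ l → l ℕ.≤ n → b l * γ (n ℕ.∸ l) ≡ 16⁻^ n * ι (cat l ℕ.* cat l ℕ.* goods₂ (n ℕ.∸ l))
    term l l≤n = trans (cong (_* γ (n ℕ.∸ l)) (sym (b≡cat² l)))
      (trans (t (ι (cat l ℕ.* cat l)) (16⁻^ l) (ι (goods₂ (n ℕ.∸ l))) (16⁻^ (n ℕ.∸ l)))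
      (cong₂ _*_ (trans (sym (16⁻^-+ l (n ℕ.∸ l))) (cong 16⁻^ (ℕ.m+[n∸m]≡n l≤n)))
        (sym (ι-* (cat l ℕ.* cat l) (goods₂ (n ℕ.∸ l))))))

  module Q = Quotient γ 0≤γ γ-convolution

  /≡/1 : ∀ {a} c d .{{_ : ℕ.NonZero d}} → c ℕ.* d ≡ a → ℤ.+ a / d ≡ ℤ.+ c / 1
  /≡/1 c (suc d) refl = fromℚᵘ-cong {ℚᵘ.mkℚᵘ (ℤ.+ (c ℕ.* suc d)) d} {ℚᵘ.mkℚᵘ (ℤ.+ c) 0}
    (ℚᵘ.*≡* (trans (ℤ.*-identityʳ (ℤ.+ (c ℕ.* suc d))) (ℤ.pos-* c (suc d))))

  Cat≡ : ∀ n → Defs.Cat n ≡ ι (cat n)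
  Cat≡ n = trans (/≡/1 (cat n) (n ! ℕ.* suc n !) {{n ℕ.!* suc n !≢0}} (cat-factorial n)) (sym (ι≡/1 (cat n)))

  private
    integer-+ : ∀ x y → integer x + integer y ≡ (x ℤ.+ y) / 1
    integer-+ x y = cong (_/ 1) (cong₂ ℤ._+_ (ℤ.*-identityʳ x) (ℤ.*-identityʳ y))

    /1≡integer′ : ∀ z → z / 1 ≡ integer z
    /1≡integer′ (ℤ.+ n)      = /1≡integer n
    /1≡integer′ (ℤ.-[1+ n ]) = cong -_ (/1≡integer (suc n))

  /1-- : ∀ {z} g m → z ≡ ℤ.+ 2 ℤ.* ℤ.+ g ℤ.- ℤ.+ m → z / 1 ≡ 2ℚ * ι g - ι m
  /1-- {z} g m eq = trans (s (z / 1) (ι m)) (cong (_- ι m) (begin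
    z / 1 + ι m                     ≡⟨ cong (z / 1 +_) (ι≡/1 m) ⟩
    z / 1 + ℤ.+ m / 1               ≡⟨ cong₂ _+_ (/1≡integer′ z) (/1≡integer m) ⟩
    integer z + integer (ℤ.+ m)     ≡⟨ integer-+ z (ℤ.+ m) ⟩
    (z ℤ.+ ℤ.+ m) / 1               ≡⟨ cong (_/ 1) (trans (cong (ℤ._+ ℤ.+ m) eq) (t (ℤ.+ g) (ℤ.+ m))) ⟩
    (ℤ.+ 2 ℤ.* ℤ.+ g) / 1           ≡⟨ cong (_/ 1) (ℤ.pos-* 2 g) ⟨
    ℤ.+ (2 ℕ.* g) / 1               ≡⟨ ι≡/1 (2 ℕ.* g) ⟨
    ι (2 ℕ.* g)                     ≡⟨ ι-* 2 g ⟩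
    2ℚ * ι g                        ∎))
    where
    open ≡-Reasoning
    s : ∀ x m → x ≡ x + m - m
    s = solve-∀ ring
    t : ∀ g m → ℤ.+ 2 ℤ.* g ℤ.- m ℤ.+ m ≡ ℤ.+ 2 ℤ.* g
    t = ℤSolver.solve-∀

  -- The mean distance in terms of a ratio of counts

  module _ (k : ℕ) where
    private
      n  = suc k
      a  = ι (cat n ℕ.* cat n)
      Z₀ = inv k * (1/ (Defs.Cat n * Defs.Cat n)) {{Defs.Cat²≢0 n}}

      Z₀*na : Z₀ * (ι n * a) ≡ 1ℚ
      Z₀*na = trans (s (inv k) ((1/ (Defs.Cat n * Defs.Cat n)) {{Defs.Cat²≢0 n}}) (ι n) a) (trans
        (cong₂ _*_ (ι*inv k) (trans
          (cong ((1/ (Defs.Cat n * Defs.Cat n)) {{Defs.Cat²≢0 n}} *_) (trans (ι-* (cat n) (cat n)) (sym (cong₂ _*_ (Cat≡ n) (Cat≡ n)))))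
          (*-inverseˡ (Defs.Cat n * Defs.Cat n) {{Defs.Cat²≢0 n}})))
        (*-identityˡ 1ℚ))
        where
        s : ∀ i c n a → i * c * (n * a) ≡ (n * i) * (c * a)
        s = solve-∀ ring

      Z = Z₀ * 16^ n

      Z*u : Z * u n ≡ 1ℚ
      Z*u = trans (cong (λ z → Z * (ι n * z)) (sym (b≡cat² n)))
        (trans (s Z₀ (16^ n) (ι n) a (16⁻^ n)) (trans (cong₂ _*_ Z₀*na (16^*16⁻^ n)) (*-identityˡ 1ℚ)))
        where
        s : ∀ z p n a q → z * p * (n * (a * q)) ≡ z * (n * a) * (p * q)
        s = solve-∀ ring

      ∣Z∣*u : ∣ Z ∣ * u n ≡ 1ℚ
      ∣Z∣*u = trans (cong (∣ Z ∣ *_) (sym (0≤p⇒∣p∣≡p (0≤u n)))) (trans (sym (∣p*q∣≡∣p∣*∣q∣ Z (u n))) (cong ∣_∣ Z*u))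

    -- `Z` is the reciprocal of u n, so this is γ n / u n; the powers of 16 cancel and leave g n /
    -- (n a n).
    ratio : ℚ
    ratio = Z * γ n

    ∣ratio∣≤1 : ∣ ratio ∣ ≤ 1ℚ
    ∣ratio∣≤1 = ≤-trans (∣∣-*-bound {Z} (subst (_≤ u n) (sym (0≤p⇒∣p∣≡p (0≤γ n))) (Q.γ≤u n))) (≤-reflexive ∣Z∣*u)

    ratio-bound : ∀ M C → ∣ M * γ n - u n ∣ ≤ C * u n → ∣ M * ratio - 1ℚ ∣ ≤ C
    ratio-bound M C h = begin
      ∣ M * ratio - 1ℚ ∣          ≡⟨ cong (λ z → ∣ M * ratio - z ∣) (sym Z*u) ⟩
      ∣ M * ratio - Z * u n ∣     ≡⟨ cong ∣_∣ (s M Z (γ n) (u n)) ⟩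
      ∣ Z * (M * γ n - u n) ∣     ≤⟨ ∣∣-*-bound {Z} h ⟩
      ∣ Z ∣ * (C * u n)           ≡⟨ t ∣ Z ∣ C (u n) ⟩
      C * (∣ Z ∣ * u n)           ≡⟨ trans (cong (C *_) ∣Z∣*u) (*-identityʳ C) ⟩
      C                           ∎
      where
      open ≤-Reasoning
      s : ∀ M Z g u → M * (Z * g) - Z * u ≡ Z * (M * g - u)
      s = solve-∀ ring
      t : ∀ z C u → z * (C * u) ≡ C * (z * u)
      t = solve-∀ ring

    meanDistance≡ : Defs.meanDistance n ≡ 2ℚ * ratio - 1ℚ - inv k
    meanDistance≡ = begin
      Z₀ * (Defs.sum (cartesianProductWith Defs.distance (Defs.allNC n) (Defs.allNC n)) / 1)
        ≡⟨ cong (Z₀ *_) (/1-- (goods₂ n) ((2 ℕ.+ k) ℕ.* (cat n ℕ.* cat n)) (∑distance k)) ⟩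
      Z₀ * (2ℚ * ι (goods₂ n) - ι ((2 ℕ.+ k) ℕ.* (cat n ℕ.* cat n)))
        ≡⟨ cong (λ z → Z₀ * (2ℚ * ι (goods₂ n) - z)) (ι-* (2 ℕ.+ k) (cat n ℕ.* cat n)) ⟩
      Z₀ * (2ℚ * ι (goods₂ n) - (1ℚ + ι n) * a)
        ≡⟨ s₁ Z₀ (ι (goods₂ n)) (ι n) a ⟩
      2ℚ * (Z₀ * ι (goods₂ n) * 1ℚ) - Z₀ * (ι n * a) - Z₀ * a * 1ℚ
        ≡⟨ cong₂ (λ x y → 2ℚ * (Z₀ * ι (goods₂ n) * x) - Z₀ * (ι n * a) - Z₀ * a * y) (16^*16⁻^ n) (ι*inv k) ⟨
      2ℚ * (Z₀ * ι (goods₂ n) * (16^ n * 16⁻^ n)) - Z₀ * (ι n * a) - Z₀ * a * (ι n * inv k)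
        ≡⟨ s₂ Z₀ (ι (goods₂ n)) (16^ n) (16⁻^ n) (ι n) a (inv k) ⟩
      2ℚ * ratio - Z₀ * (ι n * a) - Z₀ * (ι n * a) * inv k
        ≡⟨ cong (λ z → 2ℚ * ratio - z - z * inv k) Z₀*na ⟩
      2ℚ * ratio - 1ℚ - 1ℚ * inv k
        ≡⟨ cong (λ z → 2ℚ * ratio - 1ℚ - z) (*-identityˡ (inv k)) ⟩
      2ℚ * ratio - 1ℚ - inv k ∎
      where
      open ≡-Reasoning
      s₁ : ∀ z g n a → z * (2ℚ * g - (1ℚ + n) * a) ≡ 2ℚ * (z * g * 1ℚ) - z * (n * a) - z * a * 1ℚ
      s₁ = solve-∀ ring
      s₂ : ∀ z g p q n a i → 2ℚ * (z * g * (p * q)) - z * (n * a) - z * a * (n * i) ≡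
        2ℚ * (z * p * (g * q)) - z * (n * a) - z * (n * a) * i
      s₂ = solve-∀ ring

  -- Limits of the ratio and of Wallis' product

  Null-suc : ∀ {f} → Null f → Null (λ k → f (suc k))
  Null-suc nf ε 0<ε = let N , h = nf ε 0<ε in N , λ k N≤k → h (suc k) (ℕ.m≤n⇒m≤1+n N≤k)

  Null-const* : ∀ {f} C → 0ℚ < C → Null f → Null (λ k → C * f k)
  Null-const* C 0<C nf = Null-* C 0<C (0 , λ _ _ → ≤-reflexive (0≤p⇒∣p∣≡p (<⇒≤ 0<C))) nf

  Null-neg : ∀ {f} → Null f → Null (λ k → - f k)
  Null-neg {f} nf = Null-squeeze nf (0 , λ n _ → ≤-reflexive (∣-p∣≡∣p∣ (f n)))

  ratio-null : Null (λ k → ∑< (suc k) b * ratio k - 1ℚ)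
  ratio-null = Null-by-inv (ℤ.+ 69 / 1) (from-yes (0ℚ <? ℤ.+ 69 / 1)) λ K →
    let N , h = Q.γ-asymptotic K in N , λ k N≤k →
    ratio-bound k (∑< (suc k) b) ((ℤ.+ 69 / 1) * inv K) (h (suc k) (ℕ.m≤n⇒m≤1+n N≤k))

  leibniz-bounds : ∀ n → 0ℚ ≤ leibnizSum n × leibnizSum n ≤ 1ℚ
  leibniz-bounds n = subst (λ z → 0ℚ ≤ z × z ≤ 1ℚ) (sym (trans (leibnizSum≡∑ n) (∑<-cong n λ i _ → leibnizTerm≡ i)))
    (alternating n odd⁻¹ 0≤odd⁻¹ (λ i → odd⁻¹-anti (ℕ.n≤1+n i)))

  -- Wallis' product formula: (1 + 4n) w n tends to 4/π.
  wallis-leibniz : Null (λ n → (1ℚ + 4ℚ * ι n) * w n * leibnizSum n - 1ℚ)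
  wallis-leibniz = Null-cong
    (Null-+ (Null-neg (Null-const* ½ (positive⁻¹ ½) (Null-* 2ℚ (from-yes (0ℚ <? 2ℚ)) (0 , λ n _ → q≤2 n) wallisSum-null)))
            (Null-neg (Null-const* ½ (positive⁻¹ ½) odd⁻¹-null)))
    -- With A / 2 in place of the Leibniz sum, (1 + 4n) / 2 = (1 + 2n) - 1/2 splits the product into
    -- the one evaluated by `wallis` and the null term w A / 2, where w A = 1 / (2n + 1).
    λ n → trans (s₁ (ι n) (w n) (leibnizSum n) (A n)) (trans
      (cong₂ (λ x y → (- (½ * (q n * (A n - 2ℚ * leibnizSum n)))) + (x - ½ * y))
        (trans (cong (_- 1ℚ) (wallis n)) (+-inverseʳ 1ℚ)) (wA n))
      (s₂ (½ * (q n * (A n - 2ℚ * leibnizSum n))) (½ * odd⁻¹ n)))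
    where
    A : ℕ → ℚ
    A n = wallisSum n (suc n)
    q : ℕ → ℚ
    q n = (1ℚ + 4ℚ * ι n) * w n
    s₁ : ∀ n w l A → (1ℚ + 4ℚ * n) * w * l - 1ℚ ≡
      (- (½ * ((1ℚ + 4ℚ * n) * w * (A - 2ℚ * l)))) + (((1ℚ + 2ℚ * n) * w * A - 1ℚ) - ½ * (w * A))
    s₁ = solve-∀ ring
    s₂ : ∀ x y → (- x) + (0ℚ - y) ≡ (- x) + (- y)
    s₂ = solve-∀ ring
    wA : ∀ n → w n * A n ≡ odd⁻¹ n
    wA n = *-cancelˡ-≡ (0<2n+1 n) (trans (sym (*-assoc (1ℚ + 2ℚ * ι n) (w n) (A n))) (trans (wallis n) (sym (odd*odd⁻¹ n))))
    q≤2 : ∀ n → ∣ q n ∣ ≤ 2ℚ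
    q≤2 n = subst (_≤ 2ℚ) (sym (0≤p⇒∣p∣≡p (≤-trans 0≤1 (w-lower n))))
      (≤-trans (≤-by (w n) (0≤w n) (s (ι n) (w n))) (*-monoʳ (from-yes (0ℚ ≤? 2ℚ)) (w-upper n)))
      where
      s : ∀ n w → 2ℚ * ((1ℚ + 2ℚ * n) * w) ≡ (1ℚ + 4ℚ * n) * w + w
      s = solve-∀ ring
    odd⁻¹-null : Null odd⁻¹
    odd⁻¹-null = Null-squeeze Null-inv (0 , λ n _ → subst₂ _≤_ (sym (0≤p⇒∣p∣≡p (0≤odd⁻¹ n))) (sym (0≤p⇒∣p∣≡p (0≤inv n)))
      (Defs.1/suc-anti (ℕ.m≤m+n n (n ℕ.+ 0))))

  -- The terms of the Cauchy sequence (3π - 8) ÷ (8 - 2π).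

  numerator denominator : ℕ → ℚ
  numerator   n = (ℤ.+ 3 / 1) * (4ℚ * leibnizSum n) - 8ℚ
  denominator n = 8ℚ - 2ℚ * (4ℚ * leibnizSum n)

  1≤denominator : ∃ λ N → ∀ n → N ℕ.≤ n → 1ℚ ≤ denominator n
  -- From the third on, the Leibniz sums stay below `leibnizSum 3` = 13/15, so these denominators
  -- are at least 16/15.
  1≤denominator = 3 , λ n 3≤n → begin
    1ℚ
      ≤⟨ from-yes (1ℚ ≤? 8ℚ - 2ℚ * (4ℚ * leibnizSum 3)) ⟩
    8ℚ - 2ℚ * (4ℚ * leibnizSum 3)
      ≤⟨ +-monoʳ-≤ 8ℚ (neg-antimono-≤ (*-monoʳ {2ℚ} (from-yes (0ℚ ≤? 2ℚ)) (*-monoʳ {4ℚ} (from-yes (0ℚ ≤? 4ℚ)) (Defs.leibnizSum≤ n 3≤n)))) ⟩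
    denominator n ∎
    where open ≤-Reasoning

  denominator*recip : ∀ n → 1ℚ ≤ denominator n → denominator n * recip (denominator n) ≡ 1ℚ
  denominator*recip n 1≤D = *-recip λ D≡0 → <⇒≢ (<-≤-trans (positive⁻¹ 1ℚ) 1≤D) (sym D≡0)

  ∣recip∣≤1 : ∀ n → 1ℚ ≤ denominator n → ∣ recip (denominator n) ∣ ≤ 1ℚ
  ∣recip∣≤1 n 1≤D = begin
    ∣ rc ∣          ≡⟨ *-identityˡ ∣ rc ∣ ⟨
    1ℚ * ∣ rc ∣     ≤⟨ *-monoˡ (0≤∣p∣ rc) (≤-trans 1≤D (p≤∣p∣ D)) ⟩
    ∣ D ∣ * ∣ rc ∣  ≡⟨ ∣p*q∣≡∣p∣*∣q∣ D rc ⟨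
    ∣ D * rc ∣      ≡⟨ cong ∣_∣ (denominator*recip n 1≤D) ⟩
    1ℚ              ∎
    where
    open ≤-Reasoning
    D  = denominator n
    rc = recip D

  -- Let x be the ratio, ℓ the Leibniz sum and q = (1 + 4n) w n. Up to 1 / n, the difference
  -- multiplied by the denominator 8 - 8ℓ is 16x - 16xℓ - 4ℓ, that is 4ℓ ((4q - 4) x - 1) - 16x (qℓ
  -- - 1). Both brackets are null, the first because 4q - 4 is the partial sum of `b`; the constant
  -- M thus enters only through its partial sums.
  meanDistance-null : Null (λ k → Defs.meanDistance (suc k) - numerator (suc k) * recip (denominator (suc k)))
  meanDistance-null = Null-squeeze
    (Null-+ (Null-* 1ℚ (positive⁻¹ 1ℚ) (N , λ k N≤k → ∣recip∣≤1 (suc k) (D≥1 (suc k) (ℕ.m≤n⇒m≤1+n N≤k))) error-null) (Null-neg Null-inv))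
    (N , λ k N≤k → ≤-reflexive (cong ∣_∣ (equation k (denominator*recip (suc k) (D≥1 (suc k) (ℕ.m≤n⇒m≤1+n N≤k))))))
    where
    N   = proj₁ 1≤denominator
    D≥1 = proj₂ 1≤denominator
    q : ℕ → ℚ
    q n = (1ℚ + 4ℚ * ι n) * w n
    error : ℕ → ℚ
    error k = 4ℚ * (leibnizSum (suc k) * (∑< (suc k) b * ratio k - 1ℚ)) + (- (16ℚ * (ratio k * (q (suc k) * leibnizSum (suc k) - 1ℚ))))
    error-null : Null error
    error-null = Null-+
      (Null-const* 4ℚ (from-yes (0ℚ <? 4ℚ)) (Null-* 1ℚ (positive⁻¹ 1ℚ)
        (0 , λ k _ → subst (_≤ 1ℚ) (sym (0≤p⇒∣p∣≡p (proj₁ (leibniz-bounds (suc k))))) (proj₂ (leibniz-bounds (suc k)))) ratio-null))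
      (Null-neg (Null-const* 16ℚ (from-yes (0ℚ <? 16ℚ)) (Null-* 1ℚ (positive⁻¹ 1ℚ) (0 , λ k _ → ∣ratio∣≤1 k) (Null-suc wallis-leibniz))))
    equation : ∀ k → denominator (suc k) * recip (denominator (suc k)) ≡ 1ℚ →
      Defs.meanDistance (suc k) - numerator (suc k) * recip (denominator (suc k)) ≡ recip (denominator (suc k)) * error k + (- inv k)
    equation k D*rc = begin
      Defs.meanDistance (suc k) - numerator (suc k) * rc
        ≡⟨ cong (_- numerator (suc k) * rc) (meanDistance≡ k) ⟩
      2ℚ * x - 1ℚ - inv k - numerator (suc k) * rc
        ≡⟨ s₀ x (inv k) (numerator (suc k) * rc) ⟩
      (2ℚ * x - 1ℚ) * 1ℚ - inv k - numerator (suc k) * rc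
        ≡⟨ cong (λ z → (2ℚ * x - 1ℚ) * z - inv k - numerator (suc k) * rc) D*rc ⟨
      (2ℚ * x - 1ℚ) * (denominator (suc k) * rc) - inv k - numerator (suc k) * rc
        ≡⟨ s₁ x (inv k) rc (leibnizSum (suc k)) (q (suc k)) ⟩
      rc * (4ℚ * (leibnizSum (suc k) * ((4ℚ * q (suc k) - 4ℚ) * x - 1ℚ)) + (- (16ℚ * (x * (q (suc k) * leibnizSum (suc k) - 1ℚ))))) + (- inv k)
        ≡⟨ cong (λ z → rc * (4ℚ * (leibnizSum (suc k) * (z * x - 1ℚ)) + (- (16ℚ * (x * (q (suc k) * leibnizSum (suc k) - 1ℚ))))) + (- inv k)) (∑b (suc k)) ⟨
      rc * error k + (- inv k) ∎
      where
      open ≡-Reasoning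
      x  = ratio k
      rc = recip (denominator (suc k))
      s₀ : ∀ x i p → 2ℚ * x - 1ℚ - i - p ≡ (2ℚ * x - 1ℚ) * 1ℚ - i - p
      s₀ = solve-∀ ring
      s₁ : ∀ x i rc l q → (2ℚ * x - 1ℚ) * ((8ℚ - 2ℚ * (4ℚ * l)) * rc) - i - ((ℤ.+ 3 / 1) * (4ℚ * l) - 8ℚ) * rc ≡
        rc * (4ℚ * (l * ((4ℚ * q - 4ℚ) * x - 1ℚ)) + (- (16ℚ * (x * (q * l - 1ℚ))))) + (- i)
      s₁ = solve-∀ ring

  -- From null sequences to convergence of reals

  converges : ∀ (f : ℕ → ℚ) (L : Defs.ℝ) → Null (λ k → f k - Defs.seq L (suc k)) → (λ k → Defs.fromℚ (f k)) Defs.⟶ L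
  converges f L null ε (δ , 0<δ , N₀ , h) =
    -- One third of δ bounds the distance to the sequence of `L`, one third its Cauchy oscillation,
    -- and the last third is the positive gap demanded by the order on reals.
    let η   = (ℤ.+ 1 / 3) * δ
        0<η = *-monoʳ-<-pos (ℤ.+ 1 / 3) 0<δ
        N₁ , close  = null η 0<η
        N₂ , cauchy = Defs.cauchy L η 0<η
    in N₁ ℕ.⊔ N₂ , λ k N≤k → η , 0<η , N₂ ℕ.⊔ N₀ , λ n N≤n → begin
      ∣ f k - Defs.seq L n ∣ + η
        ≡⟨ cong (λ z → ∣ z ∣ + η) (s (f k) (Defs.seq L (suc k)) (Defs.seq L n)) ⟩
      ∣ (f k - Defs.seq L (suc k)) + (Defs.seq L (suc k) - Defs.seq L n) ∣ + η
        ≤⟨ +-monoˡ-≤ η (≤-trans (∣p+q∣≤∣p∣+∣q∣ (f k - Defs.seq L (suc k)) _) (+-mono-≤ (close k (ℕ.m⊔n≤o⇒m≤o N₁ N₂ N≤k))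
             (<⇒≤ (cauchy (suc k) n (ℕ.m≤n⇒m≤1+n (ℕ.m⊔n≤o⇒n≤o N₁ N₂ N≤k)) (ℕ.m⊔n≤o⇒m≤o N₂ N₀ N≤n))))) ⟩
      η + η + η
        ≡⟨ t δ ⟩
      0ℚ + δ
        ≤⟨ h n (ℕ.m⊔n≤o⇒n≤o N₂ N₀ N≤n) ⟩
      Defs.seq ε n ∎
    where
    open ≤-Reasoning
    s : ∀ a b c → a - c ≡ (a - b) + (b - c)
    s = solve-∀ ring
    t : ∀ d → (ℤ.+ 1 / 3) * d + (ℤ.+ 1 / 3) * d + (ℤ.+ 1 / 3) * d ≡ 0ℚ + d
    t = solve-∀ ring

  -- Adding 1/(4n) to an even partial sum of n terms accelerates the Leibniz series enough for the numerical bound.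

  index : ℕ → ℕ
  index zero    = 29
  index (suc i) = suc (suc (index i))

  sign-index : ∀ i → sign (suc (index i)) ≡ 1ℚ
  sign-index zero    = refl
  sign-index (suc i) = cong (λ z → - - z) (sign-index i)

  accelerated : ℕ → ℚ
  accelerated i = leibnizSum (suc (index i)) + ¼ * inv (index i)

  -- Here ¼ (h - h′) is ½ h h′ and p - q is 2 p q. Over the common factor p q h h′ the terms
  -- depending on `Y` cancel and 3/2 remains; this cancellation is what dictates the weight 1/4.
  accelerated-anti : ∀ i → accelerated (suc i) ≤ accelerated i
  accelerated-anti i = ≤-by ((ℤ.+ 3 / 1) * ½ * (p * q * (h * h′)))
    (0≤* (from-yes (0ℚ ≤? (ℤ.+ 3 / 1) * ½)) (0≤* (0≤* (0≤odd⁻¹ m) (0≤odd⁻¹ (suc m))) (0≤* (0≤inv (index i)) (0≤inv (suc m)))))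
    (trans (identity Y (leibnizSum m) p q h h′ (odd*odd⁻¹ m) (odd*odd⁻¹ (suc m)) (ι*inv (index i)) (ι*inv (suc m)))
      (cong (λ z → z + ¼ * h′ + (ℤ.+ 3 / 1) * ½ * (p * q * (h * h′))) (sym sums)))
    where
    m  = suc (index i)
    Y  = ι m
    p  = odd⁻¹ m
    q  = odd⁻¹ (suc m)
    h  = inv (index i)
    h′ = inv (suc m)
    sums : leibnizSum (suc (suc m)) ≡ leibnizSum m + (p - q)
    sums = trans (cong₂ (λ x y → leibnizSum m + x + y) (leibnizTerm≡ m) (leibnizTerm≡ (suc m)))
      (trans (cong (λ z → leibnizSum m + z * p + (- z) * q) (sign-index i)) (s (leibnizSum m) p q))
      where
      s : ∀ l p q → l + 1ℚ * p + (- 1ℚ) * q ≡ l + (p - q)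
      s = solve-∀ ring
    identity : ∀ Y l p q h h′ → (1ℚ + 2ℚ * Y) * p ≡ 1ℚ → (1ℚ + 2ℚ * (1ℚ + Y)) * q ≡ 1ℚ →
      Y * h ≡ 1ℚ → (1ℚ + (1ℚ + Y)) * h′ ≡ 1ℚ →
      l + ¼ * h ≡ l + (p - q) + ¼ * h′ + (ℤ.+ 3 / 1) * ½ * (p * q * (h * h′))
    identity Y l p q h h′ p≡ q≡ h≡ h′≡ = begin
      l + ¼ * h
        ≡⟨ s₁ l p q h h′ ⟩
      l + (p * 1ℚ - q * 1ℚ) + ¼ * h′ + (¼ * (h * 1ℚ - h′ * 1ℚ) - (p * 1ℚ - q * 1ℚ))
        ≡⟨ cong₂ (λ x y → l + (p * 1ℚ - q * 1ℚ) + ¼ * h′ + (¼ * (h * x - h′ * y) - (p * 1ℚ - q * 1ℚ))) (sym h′≡) (sym h≡) ⟩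
      l + (p * 1ℚ - q * 1ℚ) + ¼ * h′ + (¼ * (h * ((1ℚ + (1ℚ + Y)) * h′) - h′ * (Y * h)) - (p * 1ℚ - q * 1ℚ))
        ≡⟨ cong₂ (λ x y → l + (p * 1ℚ - q * 1ℚ) + ¼ * h′ + (¼ * (h * ((1ℚ + (1ℚ + Y)) * h′) - h′ * (Y * h)) - (p * x - q * y))) (sym q≡) (sym p≡) ⟩
      l + (p * 1ℚ - q * 1ℚ) + ¼ * h′ + (¼ * (h * ((1ℚ + (1ℚ + Y)) * h′) - h′ * (Y * h)) - (p * ((1ℚ + 2ℚ * (1ℚ + Y)) * q) - q * ((1ℚ + 2ℚ * Y) * p)))
        ≡⟨ s₂ Y l p q h h′ ⟩
      l + (p - q) + ¼ * h′ + (½ * (1ℚ * 1ℚ) * (h * h′) - 2ℚ * (1ℚ * 1ℚ) * (p * q))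
        ≡⟨ cong₂ (λ x y → l + (p - q) + ¼ * h′ + (½ * x * (h * h′) - 2ℚ * y * (p * q))) (sym (cong₂ _*_ p≡ q≡)) (sym (cong₂ _*_ h≡ h′≡)) ⟩
      l + (p - q) + ¼ * h′ + (½ * ((1ℚ + 2ℚ * Y) * p * ((1ℚ + 2ℚ * (1ℚ + Y)) * q)) * (h * h′) - 2ℚ * (Y * h * ((1ℚ + (1ℚ + Y)) * h′)) * (p * q))
        ≡⟨ s₃ Y l p q h h′ ⟩
      l + (p - q) + ¼ * h′ + (ℤ.+ 3 / 1) * ½ * (p * q * (h * h′)) ∎
      where
      open ≡-Reasoning
      s₁ : ∀ l p q h h′ → l + ¼ * h ≡ l + (p * 1ℚ - q * 1ℚ) + ¼ * h′ + (¼ * (h * 1ℚ - h′ * 1ℚ) - (p * 1ℚ - q * 1ℚ))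
      s₁ = solve-∀ ring
      s₂ : ∀ Y l p q h h′ →
        l + (p * 1ℚ - q * 1ℚ) + ¼ * h′ + (¼ * (h * ((1ℚ + (1ℚ + Y)) * h′) - h′ * (Y * h)) - (p * ((1ℚ + 2ℚ * (1ℚ + Y)) * q) - q * ((1ℚ + 2ℚ * Y) * p))) ≡
        l + (p - q) + ¼ * h′ + (½ * (1ℚ * 1ℚ) * (h * h′) - 2ℚ * (1ℚ * 1ℚ) * (p * q))
      s₂ = solve-∀ ring
      s₃ : ∀ Y l p q h h′ →
        l + (p - q) + ¼ * h′ + (½ * ((1ℚ + 2ℚ * Y) * p * ((1ℚ + 2ℚ * (1ℚ + Y)) * q)) * (h * h′) - 2ℚ * (Y * h * ((1ℚ + (1ℚ + Y)) * h′)) * (p * q)) ≡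
        l + (p - q) + ¼ * h′ + (ℤ.+ 3 / 1) * ½ * (p * q * (h * h′))
      s₃ = solve-∀ ring

  accelerated≤ : ∀ i → accelerated i ≤ accelerated 0
  accelerated≤ zero    = ≤-refl
  accelerated≤ (suc i) = ≤-trans (accelerated-anti i) (accelerated≤ i)

  n≤index : ∀ n → n ℕ.≤ suc (index n)
  n≤index zero    = z≤n
  n≤index (suc n) = ℕ.≤-trans (s≤s (n≤index n)) (ℕ.n≤1+n _)

  -- The quotient lies below 83/100 as soon as π/4 < 366/466.
  π/4⁺ : ℚ
  π/4⁺ = ℤ.+ 785405 / 1000000

  -- Only `accelerated 0`, 30 terms plus 1/120, is evaluated. It bounds the even partial sum
  -- belonging to N, however large, and every later sum exceeds that one by at most 1/250000.
  leibnizSum≤π/4⁺ : ∀ N → odd⁻¹ N ≤ ℤ.+ 1 / 250000 → ∀ n → suc (index N) ℕ.≤ n → leibnizSum n ≤ π/4⁺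
  leibnizSum≤π/4⁺ N small n m≤n = begin
    leibnizSum n
      ≡⟨ s (leibnizSum n) (leibnizSum m) ⟩
    leibnizSum m + (leibnizSum n - leibnizSum m)
      ≤⟨ +-mono-≤ (≤-by {leibnizSum m} {accelerated N} (¼ * inv (index N)) (0≤* (from-yes (0ℚ ≤? ¼)) (0≤inv (index N))) refl)
           (≤-trans (p≤∣p∣ (leibnizSum n - leibnizSum m)) (≤-trans (leibnizSum-close m≤n) (≤-trans (odd⁻¹-anti (n≤index N)) small))) ⟩
    accelerated N + ℤ.+ 1 / 250000
      ≤⟨ +-monoˡ-≤ (ℤ.+ 1 / 250000) (accelerated≤ N) ⟩
    accelerated 0 + ℤ.+ 1 / 250000
      ≤⟨ from-yes (accelerated 0 + ℤ.+ 1 / 250000 ≤? π/4⁺) ⟩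
    π/4⁺ ∎
    where
    open ≤-Reasoning
    m = suc (index N)
    s : ∀ a b → a ≡ b + (a - b)
    s = solve-∀ ring

  quotient-bound : ∀ N → odd⁻¹ N ≤ ℤ.+ 1 / 250000 → ∃ λ M → ∀ n → M ℕ.≤ n →
    numerator n * recip (denominator n) + ℤ.+ 1 / 1000000 ≤ ℤ.+ 83 / 100
  quotient-bound N small = N₁ ℕ.⊔ N₂ , λ n N≤n →
    let 1≤D = proj₂ 1≤denominator n (ℕ.m⊔n≤o⇒m≤o N₁ N₂ N≤n)
        ℓ   = leibnizSum n
        gap = p≤q⇒0≤q-p (leibnizSum≤π/4⁺ N small n (ℕ.m⊔n≤o⇒n≤o N₁ N₂ N≤n))
    in *-cancelˡ-≤ (<-≤-trans (positive⁻¹ 1ℚ) 1≤D) (begin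
      denominator n * (numerator n * recip (denominator n) + ℤ.+ 1 / 1000000)
        ≡⟨ s₁ (denominator n) (numerator n) (recip (denominator n)) (ℤ.+ 1 / 1000000) ⟩
      numerator n * (denominator n * recip (denominator n)) + denominator n * (ℤ.+ 1 / 1000000)
        ≡⟨ cong (λ z → numerator n * z + denominator n * (ℤ.+ 1 / 1000000)) (denominator*recip n 1≤D) ⟩
      numerator n * 1ℚ + denominator n * (ℤ.+ 1 / 1000000)
        -- Cleared of denominators, 12ℓ - 8 ≤ 0.83 (8 - 8ℓ) reads (466/25) ℓ ≤ 366/25. `slack` is
        -- the room left at ℓ = `π/4⁺` once the gap of 1/1000000 has been paid for.
        ≤⟨ ≤-by ((ℤ.+ 466 / 25) * (π/4⁺ - ℓ) + (8ℚ * (ℤ.+ 1 / 1000000) * ℓ + slack))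
             (0≤+ (0≤* (from-yes (0ℚ ≤? ℤ.+ 466 / 25)) gap)
                  (0≤+ (0≤* (from-yes (0ℚ ≤? 8ℚ * (ℤ.+ 1 / 1000000))) (proj₁ (leibniz-bounds n))) (from-yes (0ℚ ≤? slack))))
             (s₂ ℓ π/4⁺ (ℤ.+ 1 / 1000000)) ⟩
      denominator n * (ℤ.+ 83 / 100) ∎)
    where
    open ≤-Reasoning
    N₁ = proj₁ 1≤denominator
    N₂ = suc (index N)
    slack : ℚ
    slack = ℤ.+ 366 / 25 - (ℤ.+ 466 / 25) * π/4⁺ - 8ℚ * (ℤ.+ 1 / 1000000)
    s₁ : ∀ D p rc δ → D * (p * rc + δ) ≡ p * (D * rc) + D * δ
    s₁ = solve-∀ ring
    s₂ : ∀ l c δ → (8ℚ - 2ℚ * (4ℚ * l)) * (ℤ.+ 83 / 100) ≡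
      ((ℤ.+ 3 / 1) * (4ℚ * l) - 8ℚ) * 1ℚ + (8ℚ - 2ℚ * (4ℚ * l)) * δ +
      ((ℤ.+ 466 / 25) * (c - l) + (8ℚ * δ * l + (ℤ.+ 366 / 25 - (ℤ.+ 466 / 25) * c - 8ℚ * δ)))
    s₂ = solve-∀ ring

-- Limit and numerical bound

open import Defs
open import Data.Nat.Base using (suc)
open import Data.Product.Base using (_×_; ∃; _,_)
open import Data.Integer.Base using (+_)
open import Data.Rational.Base using (_/_; 0ℚ)
import Data.Rational.Base as ℚ
import Data.Rational.Properties as ℚ
open import Relation.Nullary.Decidable using (from-yes)
open Analysis using (converges; meanDistance-null; quotient-bound)

limit : ℝ
limit = (fromℕ 3 * π - fromℕ 8) ÷ (fromℕ 8 - fromℕ 2 * π)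

meanDistance⟶limit : (λ k → fromℚ (meanDistance (suc k))) ⟶ limit
meanDistance⟶limit = converges (λ k → meanDistance (suc k)) limit meanDistance-null

-- The witness N is kept a variable, since computing it from odd⁻¹-small is costly.
limit<83/100 : (∃ λ N → odd⁻¹ N ℚ.< + 1 / 250000) → limit < fromℚ (+ 83 / 100)
limit<83/100 (N , small) =
  + 1 / 1000000 , from-yes (0ℚ ℚ.<? + 1 / 1000000) , quotient-bound N (ℚ.<⇒≤ small)

proposition1p4 : let L = (fromℕ 3 * π - fromℕ 8) ÷ (fromℕ 8 - fromℕ 2 * π) in
    ((λ k → fromℚ (meanDistance (suc k))) ⟶ L) × (L < fromℚ (+ 83 / 100))
proposition1p4 =
  meanDistance⟶limit ,
  limit<83/100 (odd⁻¹-small (+ 1 / 250000) (from-yes (0ℚ ℚ.<? + 1 / 250000)))
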